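{- For $\ell=1,2,\dots$, in the formal power series ring $\mathbb{Z}[t][[x_1,\dots,x_\ell]]$, \[ \sum_{\overline{a}\in\{0,1,2,\dots\}^\ell}{\sf Poin}(P_{\overline{a}},t)\,\mathbf{x}^{\overline{a}} =\frac{1}{1-\sum_{j=1}^{\ell}e_j(\mathbf{x})\,(t-1)(2t-1)\cdots((j-1)t-1)}, \] where $\mathbf{x}^{\overline{a}}=x_1^{a_1}\cdots x_\ell^{a_\ell}$ and $e_j(\mathbf{x})=\sum_{1\le i_1<\dots<i_j\le\ell}x_{i_1}\cdots x_{i_j}$ (for $j=1$ the product $(t-1)\cdots((j-1)t-1)$ is empty, equal to $1$).
   Context: For $\overline{a}=(a_1,\dots,a_\ell)$ with $n=\sum a_i$, $P_{\overline{a}}$ is the poset on $[n]$ which is a disjoint union of chains of sizes $a_1,\dots,a_\ell$ (no relations between distinct chains). For a poset $P$ on $[n]$: $H_{ij}=\{x\in\mathbb{R}^n:x_i=x_j\}$; $\mathcal{L}$ is the set of intersections of subsets of these hyperplanes (including $V=\mathbb{R}^n$), ordered by reverse inclusion, with Möbius function $\mu$; $\mathcal{K}_P=\{x:x_i<x_j\text{ whenever } i<_Pj\}$; $\mathcal{L}^{int}(\mathcal{K}_P)=\{X\in\mathcal{L}:X\cap\mathcal{K}_P\neq\emptyset\}$; ${\sf Poin}(P,t)=\sum_k c_k(P)t^k$ with $c_k(P)=\sum_{X\in\mathcal{L}^{int}(\mathcal{K}_P),\operatorname{codim}X=k}|\mu(V,X)|$ (for $n=0$, ${\sf Poin}=1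$).
   Formalization: The condition that X meets the cone K_P is stated with points of Q^n in place of R^n; replacing real coordinates by their ranks shows that the two conditions agree. -}

module Defs where

open import Data.Bool using (Bool; true; false; _∧_; _∨_; not; if_then_else_)
import Data.Bool.Properties as BoolP
open import Data.Nat using (ℕ; zero; suc; _≤_; _<_; _≡ᵇ_)
import Data.Nat as N
import Data.Nat.Properties as NP
open import Data.Integer using (ℤ; +_; -_; ∣_∣) renaming (_+_ to _+ℤ_; _*_ to _*ℤ_)
open import Data.Fin using (Fin; toℕ)
open import Data.Vec using (Vec; []; _∷_; lookup; zipWith; replicate)
import Data.Vec as V
open import Data.Vec.Properties using (≡-dec)
open import Data.List using (List; []; _∷_; map; concatMap; upTo; allFin; filterᵇ; foldr; length)
open import Data.Bool.ListAction using (all; any)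
open import Data.Product using (Σ; _×_)
open import Data.Rational using (ℚ) renaming (_<_ to _<ℚ_)
open import Relation.Nullary using (Dec; does)
open import Relation.Binary.PropositionalEquality using (_≡_)

allVec : {A : Set} → (k : ℕ) → List A → List (Vec A k)
allVec zero xs = [] ∷ []
allVec (suc k) xs = concatMap (λ v → map (λ x → x ∷ v) xs) (allVec k xs)

sumℤ : List ℤ → ℤ
sumℤ = foldr _+ℤ_ (+ 0)

bools : List Bool
bools = true ∷ false ∷ []

-- The intersection lattice of the braid arrangement {H_ij} in R^n.
-- A flat X ∈ L is encoded by the n×n Boolean matrix E with
-- E i j = true  iff  X ⊆ H_ij  (i.e. x_i = x_j on all of X).
-- These matrices are exactly the equivalence relations on Fin n,
-- and X = {x : x_i = x_j whenever E i j}.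

Mat : ℕ → Set
Mat n = Vec (Vec Bool n) n

get : {n : ℕ} → Mat n → Fin n → Fin n → Bool
get M i j = lookup (lookup M i) j

isEquiv : {n : ℕ} → Mat n → Bool
isEquiv {n} M =
  all (λ i → get M i i) fs ∧
  (all (λ i → all (λ j → not (get M i j) ∨ get M j i) fs) fs ∧
   all (λ i → all (λ j → all (λ k → not (get M i j ∧ get M j k) ∨ get M i k) fs) fs) fs)
  where fs = allFin n

flats : (n : ℕ) → List (Mat n)
flats n = filterᵇ isEquiv (allVec n (allVec n bools))

matEq : {n : ℕ} → Mat n → Mat n → Bool
matEq M M' = does (≡-dec (≡-dec BoolP._≟_) M M')

-- V = R^n itself: only the diagonal relations hold
bottom : (n : ℕ) → Mat n
bottom n = V.tabulate (λ i → V.tabulate (λ j → does (i Data.Fin.≟ j)))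

-- order of L (reverse inclusion): X ≤ Y iff Y ⊆ X iff every H_ij ⊇ X also ⊇ Y
leqL : {n : ℕ} → Mat n → Mat n → Bool
leqL {n} X Y = all (λ i → all (λ j → not (get X i j) ∨ get Y i j) (allFin n)) (allFin n)

ltL : {n : ℕ} → Mat n → Mat n → Bool
ltL X Y = leqL X Y ∧ not (matEq X Y)

-- dim X = number of equivalence classes (count class-minimal elements);
-- codim X = n - dim X
dimL : {n : ℕ} → Mat n → ℕ
dimL {n} X = length (filterᵇ (λ i → not (any (λ j → (toℕ j N.<ᵇ toℕ i) ∧ get X j i) (allFin n))) (allFin n))

codim : {n : ℕ} → Mat n → ℕ
codim {n} X = n N.∸ dimL X

-- Möbius function μ(V, X) of L, by the defining recursion
-- μ(V,V) = 1,  μ(V,X) = - Σ_{V ≤ Y < X} μ(V,Y).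
-- (fuel-bounded; fuel n suffices since strict chains in L have length ≤ n)
mobF : {n : ℕ} → ℕ → Mat n → ℤ
mobF {n} fuel X with matEq X (bottom n)
... | true = + 1
mobF {n} zero X | false = + 0
mobF {n} (suc f) X | false =
  - sumℤ (map (mobF f) (filterᵇ (λ Y → ltL Y X) (flats n)))

μV : {n : ℕ} → Mat n → ℤ
μV {n} X = mobF n X

-- Cones and the Poincaré polynomial.
-- A poset on [n] is given by its strict order relation _<P_.
-- Points of R^n are replaced by points of Q^n.

Meets : {n : ℕ} → (Fin n → Fin n → Set) → Mat n → Set
Meets {n} lt X = Σ (Fin n → ℚ) λ x →
  ((i j : Fin n) → get X i j ≡ true → x i ≡ x j) ×
  ((i j : Fin n) → lt i j → x i <ℚ x j)

Poly : Set
Poly = ℕ → ℤ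

-- c_k(P) = Σ_{X ∈ L^int(K_P), codim X = k} |μ(V,X)|, as the coefficient of t^k.
-- The decision procedure for X ∩ K_P ≠ ∅ is supplied as an argument
-- (the resulting sum does not depend on which decider is used).
Poin : {n : ℕ} → (lt : Fin n → Fin n → Set) → ((X : Mat n) → Dec (Meets lt X)) → Poly
Poin {n} lt d k =
  sumℤ (map (λ X → if does (d X) ∧ (codim X ≡ᵇ k) then + ∣ μV X ∣ else + 0) (flats n))

-- The poset P_a: chains on consecutive blocks of [n],
-- the c-th chain being {start c, ..., start c + a_c - 1} (0-based) with its natural order.
total : {ℓ : ℕ} → Vec ℕ ℓ → ℕ
total = V.sum

start : {ℓ : ℕ} → Vec ℕ ℓ → Fin ℓ → ℕ
start (x ∷ xs) Fin.zero = 0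
start (x ∷ xs) (Fin.suc c) = x N.+ start xs c

chainLt : {ℓ : ℕ} → (a : Vec ℕ ℓ) → Fin (total a) → Fin (total a) → Set
chainLt {ℓ} a i j = Σ (Fin ℓ) λ c →
  (start a c ≤ toℕ i) × ((toℕ i < toℕ j) × (toℕ j < start a c N.+ lookup a c))

_+P_ : Poly → Poly → Poly
(p +P q) k = p k +ℤ q k

_-P_ : Poly → Poly → Poly
(p -P q) k = p k +ℤ (- q k)

_*P_ : Poly → Poly → Poly
(p *P q) k = sumℤ (map (λ i → p i *ℤ q (k N.∸ i)) (upTo (suc k)))

zeroP : Poly
zeroP k = + 0

constP : ℤ → Poly
constP c zero = c
constP c (suc k) = + 0

linP : ℕ → Poly
linP i zero = - (+ 1)
linP i (suc zero) = + i
linP i (suc (suc k)) = + 0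

factorP : ℕ → Poly
factorP zero = constP (+ 1)
factorP (suc zero) = constP (+ 1)
factorP (suc (suc j)) = factorP (suc j) *P linP (suc j)

Series : ℕ → Set
Series ℓ = Vec ℕ ℓ → Poly

_≈S_ : {ℓ : ℕ} → Series ℓ → Series ℓ → Set
F ≈S G = ∀ a k → F a k ≡ G a k

below : {ℓ : ℕ} → Vec ℕ ℓ → List (Vec ℕ ℓ)
below [] = [] ∷ []
below (x ∷ xs) = concatMap (λ y → map (λ v → y ∷ v) (below xs)) (upTo (suc x))

sumP : List Poly → Poly
sumP = foldr _+P_ zeroP

_+S_ : {ℓ : ℕ} → Series ℓ → Series ℓ → Series ℓ
(F +S G) a = F a +P G a

_-S_ : {ℓ : ℕ} → Series ℓ → Series ℓ → Series ℓ
(F -S G) a = F a -P G a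

_*S_ : {ℓ : ℕ} → Series ℓ → Series ℓ → Series ℓ
(F *S G) a = sumP (map (λ b → F b *P G (zipWith N._∸_ a b)) (below a))

scaleS : {ℓ : ℕ} → Poly → Series ℓ → Series ℓ
scaleS p F a = p *P F a

zeroS : {ℓ : ℕ} → Series ℓ
zeroS a = zeroP

monoS : {ℓ : ℕ} → Vec ℕ ℓ → Series ℓ
monoS m a = if does (≡-dec N._≟_ a m) then constP (+ 1) else zeroP

oneS : (ℓ : ℕ) → Series ℓ
oneS ℓ = monoS (replicate ℓ 0)

sumS : {ℓ : ℕ} → List (Series ℓ) → Series ℓ
sumS = foldr _+S_ zeroS

countTrue : {ℓ : ℕ} → Vec Bool ℓ → ℕ
countTrue [] = 0
countTrue (true ∷ bs) = suc (countTrue bs)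
countTrue (false ∷ bs) = countTrue bs

indicator : {ℓ : ℕ} → Vec Bool ℓ → Vec ℕ ℓ
indicator = V.map (λ b → if b then 1 else 0)

elemS : (ℓ j : ℕ) → Series ℓ
elemS ℓ j = sumS (map (λ S → monoS (indicator S)) (filterᵇ (λ S → countTrue S ≡ᵇ j) (allVec ℓ bools)))

denomSum : (ℓ : ℕ) → Series ℓ
denomSum ℓ = sumS (map (λ j → scaleS (factorP j) (elemS ℓ j)) (Data.List.applyUpTo suc ℓ))

poinSeries : (ℓ : ℕ) → ((a : Vec ℕ ℓ) (X : Mat (total a)) → Dec (Meets (chainLt a) X)) → Series ℓ
poinSeries ℓ dec a = Poin (chainLt a) (dec a)

-- A flat X meets the cone of P_a iff the set partition of X is acyclic, i.e. its blocks can be put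
-- on a line compatibly with the chains, and |μ(V,X)| t^(codim X) is the product over the blocks B
-- of (|B|-1)! t^(|B|-1).  A nonempty acyclic partition has a source block, all of whose elements
-- are minimal.  Hence the product over the blocks of w(B) - [B consists of minima] w(B) vanishes.
-- Expanding it removes from P_a a set S of minima, carrying an arbitrary partition with signed
-- weight, from an acyclic partition of the rest, so that the sum over S of
-- ε_|S| Poin(P_(a-1_S)) vanishes for a ≠ 0.  Here ε_j is the sum over the permutations of j points
-- of (-1)^cycles t^(j-cycles), that is, (-1)(t-1)(2t-1)...((j-1)t-1), and these are exactly the
-- coefficients of the denominator.
module Submission where

open import Defs
open import Level using (0ℓ)
open import Algebra.Bundles using (CommutativeRing)
open import Data.Bool using (Bool; true; false; _∧_; _∨_; not; T; if_then_else_)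
open import Data.Bool.ListAction using (all; any)
open import Data.Bool.Properties using (T-≡; T?; ⇔→≡)
import Data.Bool.Properties as BoolP
open import Data.Empty using (⊥; ⊥-elim)
open import Data.Fin using (Fin; toℕ)
import Data.Fin as F
import Data.Fin.Properties as FP
open import Data.Integer using (ℤ; +_; ∣_∣) renaming (_+_ to _+ℤ_; _*_ to _*ℤ_; -_ to -ℤ_)
import Data.Integer.Properties as ℤP
open import Data.List using (List; []; _∷_; _++_; map; concat; concatMap; filterᵇ; allFin; length; upTo; applyUpTo; cartesianProductWith)
import Data.List as L
open import Data.List.Membership.Propositional using (_∈_; _∉_; find; lose)
open import Data.List.Membership.Propositional.Properties using (∈-map⁺; ∈-map⁻; ∈-++⁺ˡ; ∈-++⁺ʳ; ∈-++⁻; ∈-concat⁺′; ∈-concat⁻′; ∈-concatMap⁺; ∈-concatMap⁻; ∈-filter⁺; ∈-filter⁻; ∈-allFin; ∈-upTo⁻)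
open import Data.List.Membership.Propositional.Properties.WithK using (unique∧set⇒bag)
import Data.List.Membership.DecPropositional as DecMem
open import Data.List.Properties using (++-assoc; filter-++; filter-all; length-++; length-tabulate; map-∘; map-tabulate; map-applyUpTo; map-upTo; upTo-∷ʳ; concatMap-map; map-concatMap; concatMap-cong)
open import Data.List.Relation.Binary.BagAndSetEquality using (∼bag⇒↭)
open import Data.List.Relation.Binary.Permutation.Propositional using (_↭_; ↭-refl; ↭-reflexive; ↭-sym; ↭-trans; ↭-prep; ↭⇒↭ₛ)
import Data.List.Relation.Binary.Permutation.Propositional.Properties as Perm
open import Data.List.Relation.Unary.All using (All; []; _∷_)
import Data.List.Relation.Unary.All as All
import Data.List.Relation.Unary.All.Properties as AllP
open import Data.List.Relation.Unary.AllPairs using (AllPairs; []; _∷_)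
import Data.List.Relation.Unary.AllPairs as AllPairs
import Data.List.Relation.Unary.AllPairs.Properties as AllPairsP
open import Data.List.Relation.Unary.Any using (here; there; any?)
open import Data.List.Relation.Unary.Unique.Propositional using (Unique)
import Data.List.Relation.Unary.Unique.Propositional.Properties as UniqueP
open import Data.List.Relation.Unary.Unique.Propositional.Properties using (Unique[x∷xs]⇒x∉xs)
open import Data.Nat using (ℕ; zero; suc; _<_; _≤_; z≤n; s≤s; _≡ᵇ_)
import Data.Nat as N
import Data.Nat.Properties as ℕP
open import Data.Product using (Σ; _×_; _,_; proj₁; proj₂; ∃; ∃₂)
import Data.Product.Properties as ProductP
open import Data.Rational using (ℚ; 0ℚ; 1ℚ; _⊓_) renaming (_<_ to _<ℚ_; _≤_ to _≤ℚ_; _+_ to _+ℚ_; -_ to -ℚ_)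
import Data.Rational.Properties as ℚP
open import Data.Sum using (_⊎_; inj₁; inj₂; [_,_])
import Data.Sum as Sum
open import Data.Vec using (Vec; []; _∷_; lookup; tabulate; replicate; toList; zipWith)
import Data.Vec as V
import Data.Vec.Properties as VecP
open import Function using (_∘_; _⇔_; mk⇔; Equivalence)
open import Function.Construct.Composition using (_⇔-∘_)
open import Function.Construct.Symmetry using (⇔-sym)
open import Relation.Binary using (DecidableEquality; tri<; tri≈; tri>)
open import Relation.Binary.Bundles using (module DecTotalOrder)
open import Relation.Binary.PropositionalEquality using (_≡_; _≢_; _≗_; refl; sym; trans; cong; cong₂; subst; subst₂; module ≡-Reasoning)
import Relation.Binary.PropositionalEquality as ≡
open import Relation.Nullary using (¬_; Dec; yes; no; does; contradiction)
open import Relation.Nullary.Decidable using (_×-dec_; map′; dec-true; dec-false; does-⇔; from-yes)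
open import Data.List.Extrema (DecTotalOrder.totalOrder ℚP.≤-decTotalOrder) using (argmin; argmin-sel; f[argmin]≤f[xs]; f[argmin]≤f[⊤])

-- A partition of `x ∷ xs` arises from one of `xs` by making `x` a singleton or by putting it in
-- front of a block. The second option multiplies the weight of that block by a sum over its
-- elements, so the options together contribute a factor `s x + ∑ xs (u x)` that does not see the
-- partition, and the sum over all partitions is a product along the list. For minima the factors
-- are `-1 + j t`. For a flat X, with `s = 1` and `u x y = -1` or 0 as x and y are equivalent or
-- not, the same product is the sum of the candidate Möbius values over the flats up to X; the last
-- but one point of a class with at least two members has factor 1 - 1, so the sum vanishes unless X
-- is the whole space. The obstacle is that the cones of the vectors `a - 1_S` live in spaces of
-- different dimension and come with unrelated deciders. Chain elements are therefore named
-- independently of their position in [n], so that a shorter chain consists of some of the very same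
-- elements, and every decider is compared with one predicate, `Acyclic`, on lists of elements.

private variable
  A B : Set

-- Set partitions and splittings of lists

ins : A → List (List A) → List (List (List A))
ins x []      = []
ins x (b ∷ p) = ((x ∷ b) ∷ p) ∷ map (b ∷_) (ins x p)

ext : A → List (List A) → List (List (List A))
ext x p = ((x ∷ []) ∷ p) ∷ ins x p

parts : List A → List (List (List A))
parts []       = [] ∷ []
parts (x ∷ xs) = concatMap (ext x) (parts xs)

splitStep : A → List A × List A → List (List A × List A)
splitStep x (us , ws) = (x ∷ us , ws) ∷ (us , x ∷ ws) ∷ []

splits : List A → List (List A × List A)
splits []       = ([] , []) ∷ []
splits (x ∷ xs) = concatMap (splitStep x) (splits xs)

-- `Ins`, `Part` and `Split` are the graphs of `ins`, `parts` and `splits`; invariants of partitions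
-- are proved by induction on them instead of on list membership.
data Ins {A : Set} (x : A) : List (List A) → List (List A) → Set where
  here  : ∀ {b p} → Ins x (b ∷ p) ((x ∷ b) ∷ p)
  there : ∀ {b p p′} → Ins x p p′ → Ins x (b ∷ p) (b ∷ p′)

data Part {A : Set} : List A → List (List A) → Set where
  []     : Part [] []
  single : ∀ {x xs p} → Part xs p → Part (x ∷ xs) ((x ∷ []) ∷ p)
  join   : ∀ {x xs p p′} → Part xs p → Ins x p p′ → Part (x ∷ xs) p′

data Split {A : Set} : List A → List A → List A → Set where
  []    : Split [] [] []
  left  : ∀ {x xs us ws} → Split xs us ws → Split (x ∷ xs) (x ∷ us) ws
  right : ∀ {x xs us ws} → Split xs us ws → Split (x ∷ xs) us (x ∷ ws)

∈-concatMap : ∀ {f : A → List B} {y} xs → y ∈ concatMap f xs → ∃ λ x → x ∈ xs × y ∈ f x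
∈-concatMap {f = f} xs y∈ = find (∈-concatMap⁻ f {xs = xs} y∈)

∈-ins⇒Ins : ∀ {x : A} p {p′} → p′ ∈ ins x p → Ins x p p′
∈-ins⇒Ins (b ∷ p) (here refl) = here
∈-ins⇒Ins (b ∷ p) (there m) with ∈-map⁻ (b ∷_) m
... | _ , m′ , refl = there (∈-ins⇒Ins p m′)

Ins⇒∈-ins : ∀ {x : A} {p p′} → Ins x p p′ → p′ ∈ ins x p
Ins⇒∈-ins here = here refl
Ins⇒∈-ins (there i) = there (∈-map⁺ (_ ∷_) (Ins⇒∈-ins i))

∈-parts⇒Part : ∀ (xs : List A) {p} → p ∈ parts xs → Part xs p
∈-parts⇒Part [] (here refl) = []
∈-parts⇒Part (x ∷ xs) m with ∈-concatMap (parts xs) m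
... | p , p∈ , here refl = single (∈-parts⇒Part xs p∈)
... | p , p∈ , there i     = join (∈-parts⇒Part xs p∈) (∈-ins⇒Ins p i)

concatMap-∈ : ∀ {f : A → List B} {x y xs} → x ∈ xs → y ∈ f x → y ∈ concatMap f xs
concatMap-∈ {f = f} x∈ y∈ = ∈-concatMap⁺ f (lose x∈ y∈)

Part⇒∈-parts : ∀ {xs : List A} {p} → Part xs p → p ∈ parts xs
Part⇒∈-parts []         = here refl
Part⇒∈-parts (single P) = concatMap-∈ (Part⇒∈-parts P) (here refl)
Part⇒∈-parts (join P i) = concatMap-∈ (Part⇒∈-parts P) (there (Ins⇒∈-ins i))

∈-splits⇒Split : ∀ (xs : List A) {us ws} → (us , ws) ∈ splits xs → Split xs us ws
∈-splits⇒Split [] (here refl) = []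
∈-splits⇒Split (x ∷ xs) m with ∈-concatMap (splits xs) m
... | p , p∈ , here refl         = left (∈-splits⇒Split xs p∈)
... | p , p∈ , there (here refl) = right (∈-splits⇒Split xs p∈)

Ins-nonempty : ∀ {x : A} {p p′} → Ins x p p′ → All (_≢ []) p → All (_≢ []) p′
Ins-nonempty here      (_ ∷ ne) = (λ ()) ∷ ne
Ins-nonempty (there i) (n ∷ ne) = n ∷ Ins-nonempty i ne

Part-nonempty : ∀ {xs : List A} {p} → Part xs p → All (_≢ []) p
Part-nonempty []         = []
Part-nonempty (single P) = (λ ()) ∷ Part-nonempty P
Part-nonempty (join P i) = Ins-nonempty i (Part-nonempty P)

Ins-concat : ∀ {x : A} {p p′} → Ins x p p′ → concat p′ ↭ x ∷ concat p
Ins-concat here = ↭-refl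
Ins-concat {x = x} (there {b} {p} i) = ↭-trans (Perm.++⁺ˡ b (Ins-concat i)) (Perm.shift x b (concat p))

Part-concat : ∀ {xs : List A} {p} → Part xs p → concat p ↭ xs
Part-concat []                 = ↭-refl
Part-concat (single {x = x} P) = ↭-prep x (Part-concat P)
Part-concat (join {x = x} P i) = ↭-trans (Ins-concat i) (↭-prep x (Part-concat P))

-- Sums over set partitions in a commutative ring

module RingSums (R : CommutativeRing 0ℓ 0ℓ) where
  open CommutativeRing R hiding (refl; sym; trans)
  open CommutativeRing R using () renaming (refl to ≈-refl; sym to ≈-sym; trans to ≈-trans; reflexive to ≈-reflexive)
  open import Relation.Binary.Reasoning.Setoid setoid
  open import Algebra.Properties.CommutativeSemigroup +-commutativeSemigroup using (interchange) renaming (x∙yz≈y∙xz to +-left-comm)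
  open import Algebra.Properties.CommutativeSemigroup *-commutativeSemigroup using () renaming (interchange to *-interchange; x∙yz≈y∙xz to *-left-comm)

  ∑ ∏ : List A → (A → Carrier) → Carrier
  ∑ []       f = 0#
  ∑ (x ∷ xs) f = f x + ∑ xs f
  ∏ []       f = 1#
  ∏ (x ∷ xs) f = f x * ∏ xs f

  ∑-cong∈ : ∀ (xs : List A) {f g} → (∀ {x} → x ∈ xs → f x ≈ g x) → ∑ xs f ≈ ∑ xs g
  ∑-cong∈ []       e = ≈-refl
  ∑-cong∈ (x ∷ xs) e = +-cong (e (here refl)) (∑-cong∈ xs (λ m → e (there m)))

  ∑-cong : ∀ (xs : List A) {f g} → (∀ x → f x ≈ g x) → ∑ xs f ≈ ∑ xs g
  ∑-cong xs e = ∑-cong∈ xs (λ {x} _ → e x)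

  ∏-cong∈ : ∀ (xs : List A) {f g} → (∀ {x} → x ∈ xs → f x ≈ g x) → ∏ xs f ≈ ∏ xs g
  ∏-cong∈ []       e = ≈-refl
  ∏-cong∈ (x ∷ xs) e = *-cong (e (here refl)) (∏-cong∈ xs (λ m → e (there m)))

  ∑-zero : ∀ (xs : List A) {f} → (∀ {x} → x ∈ xs → f x ≈ 0#) → ∑ xs f ≈ 0#
  ∑-zero []       e = ≈-refl
  ∑-zero (x ∷ xs) e = ≈-trans (+-cong (e (here refl)) (∑-zero xs (λ m → e (there m)))) (+-identityˡ 0#)

  ∏-zero : ∀ {xs : List A} {f x} → x ∈ xs → f x ≈ 0# → ∏ xs f ≈ 0#
  ∏-zero (here refl) e = ≈-trans (*-congʳ e) (zeroˡ _)
  ∏-zero (there m)     e = ≈-trans (*-congˡ (∏-zero m e)) (zeroʳ _)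

  ∑-++ : ∀ (xs ys : List A) f → ∑ (xs ++ ys) f ≈ ∑ xs f + ∑ ys f
  ∑-++ []       ys f = ≈-sym (+-identityˡ _)
  ∑-++ (x ∷ xs) ys f = ≈-trans (+-congˡ (∑-++ xs ys f)) (≈-sym (+-assoc _ _ _))

  ∑-map : ∀ (h : A → B) xs f → ∑ (map h xs) f ≡ ∑ xs (λ x → f (h x))
  ∑-map h []       f = refl
  ∑-map h (x ∷ xs) f = cong (λ s → f (h x) + s) (∑-map h xs f)

  ∑-concatMap : ∀ (h : A → List B) xs f → ∑ (concatMap h xs) f ≈ ∑ xs (λ x → ∑ (h x) f)
  ∑-concatMap h []       f = ≈-refl
  ∑-concatMap h (x ∷ xs) f = ≈-trans (∑-++ (h x) _ f) (+-congˡ (∑-concatMap h xs f))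

  ∑-+ : ∀ (xs : List A) f g → ∑ xs (λ x → f x + g x) ≈ ∑ xs f + ∑ xs g
  ∑-+ []       f g = ≈-sym (+-identityˡ 0#)
  ∑-+ (x ∷ xs) f g = ≈-trans (+-congˡ (∑-+ xs f g)) (interchange _ _ _ _)

  ∑-*ˡ : ∀ (xs : List A) c f → ∑ xs (λ x → c * f x) ≈ c * ∑ xs f
  ∑-*ˡ []       c f = ≈-sym (zeroʳ c)
  ∑-*ˡ (x ∷ xs) c f = ≈-trans (+-congˡ (∑-*ˡ xs c f)) (≈-sym (distribˡ c _ _))

  ∑-*ʳ : ∀ (xs : List A) f c → ∑ xs (λ x → f x * c) ≈ ∑ xs f * c
  ∑-*ʳ xs f c = begin
    ∑ xs (λ x → f x * c) ≈⟨ ∑-cong xs (λ x → *-comm _ c) ⟩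
    ∑ xs (λ x → c * f x) ≈⟨ ∑-*ˡ xs c f ⟩
    c * ∑ xs f           ≈⟨ *-comm _ _ ⟩
    ∑ xs f * c           ∎

  ∑-product : ∀ (xs : List A) (ys : List B) f g → ∑ xs (λ x → ∑ ys (λ y → f x * g y)) ≈ ∑ xs f * ∑ ys g
  ∑-product xs ys f g = ≈-trans (∑-cong xs (λ x → ∑-*ˡ ys (f x) g)) (∑-*ʳ xs f _)

  ∑-swap : ∀ (xs : List A) (ys : List B) (f : A → B → Carrier) → ∑ xs (λ x → ∑ ys (f x)) ≈ ∑ ys (λ y → ∑ xs (λ x → f x y))
  ∑-swap []       ys f = ≈-sym (∑-zero ys (λ _ → ≈-refl))
  ∑-swap (x ∷ xs) ys f = ≈-trans (+-congˡ (∑-swap xs ys f)) (≈-sym (∑-+ ys (f x) _))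

  ∑-↭ : ∀ {xs ys : List A} → xs ↭ ys → ∀ f → ∑ xs f ≈ ∑ ys f
  ∑-↭ _↭_.refl         f = ≈-refl
  ∑-↭ (_↭_.prep x r)   f = +-congˡ (∑-↭ r f)
  ∑-↭ (_↭_.swap x y r) f = ≈-trans (+-left-comm _ _ _) (+-congˡ (+-congˡ (∑-↭ r f)))
  ∑-↭ (_↭_.trans r s)  f = ≈-trans (∑-↭ r f) (∑-↭ s f)

  ∑-filterᵇ : ∀ (P : A → Bool) xs f → ∑ (filterᵇ P xs) f ≈ ∑ xs (λ x → if P x then f x else 0#)
  ∑-filterᵇ P []       f = ≈-refl
  ∑-filterᵇ P (x ∷ xs) f with P x
  ... | true  = +-congˡ (∑-filterᵇ P xs f)
  ... | false = ≈-trans (∑-filterᵇ P xs f) (≈-sym (+-identityˡ _))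

  ∏-splits : ∀ (xs : List A) f g →
    ∏ xs (λ x → f x + g x) ≈ ∑ (splits xs) (λ s → ∏ (proj₁ s) f * ∏ (proj₂ s) g)
  ∏-splits []       f g = ≈-sym (≈-trans (+-identityʳ _) (*-identityˡ 1#))
  ∏-splits (x ∷ xs) f g = ≈-sym (begin
    ∑ (splits (x ∷ xs)) F                           ≈⟨ ∑-concatMap (splitStep x) (splits xs) F ⟩
    ∑ (splits xs) (λ s → ∑ (splitStep x s) F)       ≈⟨ ∑-cong (splits xs) step ⟩
    ∑ (splits xs) (λ s → (f x + g x) * F s)         ≈⟨ ∑-*ˡ (splits xs) _ F ⟩
    (f x + g x) * ∑ (splits xs) F                   ≈⟨ *-congˡ (≈-sym (∏-splits xs f g)) ⟩
    (f x + g x) * ∏ xs (λ x → f x + g x)            ∎)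
    where
    F : _ → Carrier
    F s = ∏ (proj₁ s) f * ∏ (proj₂ s) g
    step : ∀ s → ∑ (splitStep x s) F ≈ (f x + g x) * F s
    step (us , ws) = begin
      (f x * ∏ us f) * ∏ ws g + (∏ us f * (g x * ∏ ws g) + 0#)
        ≈⟨ +-cong (*-assoc _ _ _) (≈-trans (+-identityʳ _) (*-left-comm _ _ _)) ⟩
      f x * (∏ us f * ∏ ws g) + g x * (∏ us f * ∏ ws g)
        ≈⟨ ≈-sym (distribʳ _ _ _) ⟩
      (f x + g x) * (∏ us f * ∏ ws g) ∎

  -- The block that receives `x` ends up on exactly one side of a splitting, whence the two inner
  -- sums. `F` is arbitrary because the induction hypothesis is applied to a function that already
  -- holds the head block on either side.
  ∑-ins-splits : ∀ (x : A) p (F : List (List A) → List (List A) → Carrier) →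
    ∑ (ins x p) (λ p′ → ∑ (splits p′) (λ s → F (proj₁ s) (proj₂ s))) ≈
    ∑ (splits p) (λ s → ∑ (ins x (proj₁ s)) (λ q → F q (proj₂ s)) + ∑ (ins x (proj₂ s)) (λ q → F (proj₁ s) q))
  ∑-ins-splits x []      F = ≈-sym (≈-trans (+-identityʳ _) (+-identityʳ _))
  ∑-ins-splits x (b ∷ p) F = begin
    ∑ (splits ((x ∷ b) ∷ p)) (λ s → F (proj₁ s) (proj₂ s))
      + ∑ (map (b ∷_) (ins x p)) (λ p′ → ∑ (splits p′) (λ s → F (proj₁ s) (proj₂ s)))
        ≈⟨ +-cong (∑-concatMap _ (splits p) _) (≈-reflexive (∑-map (b ∷_) (ins x p) _)) ⟩
    ∑ (splits p) (λ s → F ((x ∷ b) ∷ proj₁ s) (proj₂ s) + (F (proj₁ s) ((x ∷ b) ∷ proj₂ s) + 0#))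
      + ∑ (ins x p) (λ p′ → ∑ (splits (b ∷ p′)) (λ s → F (proj₁ s) (proj₂ s)))
        ≈⟨ +-congˡ (∑-cong (ins x p) (λ p′ → ∑-concatMap _ (splits p′) _)) ⟩
    ∑ (splits p) (λ s → F ((x ∷ b) ∷ proj₁ s) (proj₂ s) + (F (proj₁ s) ((x ∷ b) ∷ proj₂ s) + 0#))
      + ∑ (ins x p) (λ p′ → ∑ (splits p′) (λ s → F (b ∷ proj₁ s) (proj₂ s) + (F (proj₁ s) (b ∷ proj₂ s) + 0#)))
        ≈⟨ +-congˡ (∑-ins-splits x p (λ q r → F (b ∷ q) r + (F q (b ∷ r) + 0#))) ⟩
    ∑ (splits p) (λ s → F ((x ∷ b) ∷ proj₁ s) (proj₂ s) + (F (proj₁ s) ((x ∷ b) ∷ proj₂ s) + 0#))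
      + ∑ (splits p) (λ s → ∑ (ins x (proj₁ s)) (λ q → F (b ∷ q) (proj₂ s) + (F q (b ∷ proj₂ s) + 0#))
                           + ∑ (ins x (proj₂ s)) (λ q → F (b ∷ proj₁ s) q + (F (proj₁ s) (b ∷ q) + 0#)))
        ≈⟨ ≈-sym (∑-+ (splits p) _ _) ⟩
    ∑ (splits p) (λ s → F ((x ∷ b) ∷ proj₁ s) (proj₂ s) + (F (proj₁ s) ((x ∷ b) ∷ proj₂ s) + 0#)
                      + (∑ (ins x (proj₁ s)) (λ q → F (b ∷ q) (proj₂ s) + (F q (b ∷ proj₂ s) + 0#))
                           + ∑ (ins x (proj₂ s)) (λ q → F (b ∷ proj₁ s) q + (F (proj₁ s) (b ∷ q) + 0#))))
        ≈⟨ ∑-cong (splits p) step ⟩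
    ∑ (splits p) (λ s → ∑ (splitStep b s) G)
        ≈⟨ ≈-sym (∑-concatMap (splitStep b) (splits p) G) ⟩
    ∑ (splits (b ∷ p)) G ∎
    where
    G : _ → Carrier
    G s = ∑ (ins x (proj₁ s)) (λ q → F q (proj₂ s)) + ∑ (ins x (proj₂ s)) (λ q → F (proj₁ s) q)
    rearrange : ∀ a c d e f g → (a + c) + ((d + e) + (f + g)) ≈ ((a + d) + f) + (e + (c + g))
    rearrange a c d e f g = begin
      (a + c) + ((d + e) + (f + g)) ≈⟨ +-congˡ (interchange d e f g) ⟩
      (a + c) + ((d + f) + (e + g)) ≈⟨ interchange a c _ _ ⟩
      (a + (d + f)) + (c + (e + g)) ≈⟨ +-cong (≈-sym (+-assoc a d f)) (+-left-comm c e g) ⟩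
      ((a + d) + f) + (e + (c + g)) ∎
    split-sum : ∀ (L : List (List (List _))) (h k : _ → Carrier) → ∑ L (λ q → h q + (k q + 0#)) ≈ ∑ L h + ∑ L k
    split-sum L h k = ≈-trans (∑-cong L (λ q → +-congˡ (+-identityʳ _))) (∑-+ L h k)
    step : ∀ s → F ((x ∷ b) ∷ proj₁ s) (proj₂ s) + (F (proj₁ s) ((x ∷ b) ∷ proj₂ s) + 0#)
                      + (∑ (ins x (proj₁ s)) (λ q → F (b ∷ q) (proj₂ s) + (F q (b ∷ proj₂ s) + 0#))
                           + ∑ (ins x (proj₂ s)) (λ q → F (b ∷ proj₁ s) q + (F (proj₁ s) (b ∷ q) + 0#)))
             ≈ ∑ (splitStep b s) G
    step (q , r) = begin
      F ((x ∷ b) ∷ q) r + (F q ((x ∷ b) ∷ r) + 0#)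
        + (∑ (ins x q) (λ q′ → F (b ∷ q′) r + (F q′ (b ∷ r) + 0#)) + ∑ (ins x r) (λ r′ → F (b ∷ q) r′ + (F q (b ∷ r′) + 0#)))
          ≈⟨ +-cong (+-congˡ (+-identityʳ _)) (+-cong (split-sum (ins x q) _ _) (split-sum (ins x r) _ _)) ⟩
      F ((x ∷ b) ∷ q) r + F q ((x ∷ b) ∷ r)
        + ((∑ (ins x q) (λ q′ → F (b ∷ q′) r) + ∑ (ins x q) (λ q′ → F q′ (b ∷ r)))
          + (∑ (ins x r) (λ r′ → F (b ∷ q) r′) + ∑ (ins x r) (λ r′ → F q (b ∷ r′))))
          ≈⟨ rearrange _ _ _ _ _ _ ⟩
      ((F ((x ∷ b) ∷ q) r + ∑ (ins x q) (λ q′ → F (b ∷ q′) r)) + ∑ (ins x r) (λ r′ → F (b ∷ q) r′))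
        + (∑ (ins x q) (λ q′ → F q′ (b ∷ r)) + (F q ((x ∷ b) ∷ r) + ∑ (ins x r) (λ r′ → F q (b ∷ r′))))
          ≈⟨ +-cong (+-congʳ (+-congˡ (≈-sym (≈-reflexive (∑-map (b ∷_) (ins x q) _)))))
                    (≈-trans (+-congˡ (+-congˡ (≈-sym (≈-reflexive (∑-map (b ∷_) (ins x r) _))))) (≈-sym (+-identityʳ _))) ⟩
      G (b ∷ q , r) + (G (q , b ∷ r) + 0#) ∎

  -- Distributing the blocks over two sides distributes the points, and each side then carries an
  -- arbitrary partition: the product rule for exponential structures. It lets the removed blocks be
  -- summed independently of the remaining ones.
  ∑-parts-splits : ∀ (xs : List A) (F : List (List A) → List (List A) → Carrier) →
    ∑ (parts xs) (λ p → ∑ (splits p) (λ s → F (proj₁ s) (proj₂ s))) ≈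
    ∑ (splits xs) (λ s → ∑ (parts (proj₁ s)) (λ q → ∑ (parts (proj₂ s)) (λ r → F q r)))
  ∑-parts-splits []       F = +-congʳ (≈-sym (+-identityʳ _))
  ∑-parts-splits (x ∷ xs) F = begin
    ∑ (parts (x ∷ xs)) (λ p → ∑ (splits p) F′)              ≈⟨ ∑-concatMap (ext x) (parts xs) _ ⟩
    ∑ (parts xs) (λ p → ∑ (ext x p) (λ p′ → ∑ (splits p′) F′)) ≈⟨ ∑-cong (parts xs) step₁ ⟩
    ∑ (parts xs) (λ p → ∑ (splits p) (λ s → G (proj₁ s) (proj₂ s)))
      ≈⟨ ∑-parts-splits xs G ⟩
    ∑ (splits xs) (λ s → ∑ (parts (proj₁ s)) (λ q → ∑ (parts (proj₂ s)) (λ r → G q r)))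
      ≈⟨ ∑-cong (splits xs) step₂ ⟩
    ∑ (splits xs) (λ s → ∑ (splitStep x s) H)               ≈⟨ ≈-sym (∑-concatMap (splitStep x) (splits xs) H) ⟩
    ∑ (splits (x ∷ xs)) H                                   ∎
    where
    F′ : _ → Carrier
    F′ s = F (proj₁ s) (proj₂ s)
    G : _ → _ → Carrier
    G q r = ∑ (ext x q) (λ q′ → F q′ r) + ∑ (ext x r) (λ r′ → F q r′)
    H : _ → Carrier
    H s = ∑ (parts (proj₁ s)) (λ q → ∑ (parts (proj₂ s)) (λ r → F q r))
    step₁ : ∀ p → ∑ (ext x p) (λ p′ → ∑ (splits p′) F′) ≈ ∑ (splits p) (λ s → G (proj₁ s) (proj₂ s))
    step₁ p = begin
      ∑ (splits ((x ∷ []) ∷ p)) F′ + ∑ (ins x p) (λ p′ → ∑ (splits p′) F′)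
        ≈⟨ +-cong (∑-concatMap _ (splits p) F′) (∑-ins-splits x p F) ⟩
      ∑ (splits p) _ + ∑ (splits p) _
        ≈⟨ ≈-sym (∑-+ (splits p) _ _) ⟩
      ∑ (splits p) _
        ≈⟨ ∑-cong (splits p) (λ s → ≈-trans (+-congʳ (+-congˡ (+-identityʳ _))) (interchange _ _ _ _)) ⟩
      ∑ (splits p) (λ s → G (proj₁ s) (proj₂ s)) ∎
    step₂ : ∀ s → ∑ (parts (proj₁ s)) (λ q → ∑ (parts (proj₂ s)) (λ r → G q r)) ≈ ∑ (splitStep x s) H
    step₂ (us , ws) = begin
      ∑ (parts us) (λ q → ∑ (parts ws) (λ r → G q r))
        ≈⟨ ∑-cong (parts us) (λ q → ∑-+ (parts ws) _ _) ⟩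
      ∑ (parts us) (λ q → ∑ (parts ws) (λ r → ∑ (ext x q) (λ q′ → F q′ r)) + ∑ (parts ws) (λ r → ∑ (ext x r) (λ r′ → F q r′)))
        ≈⟨ ∑-+ (parts us) _ _ ⟩
      ∑ (parts us) (λ q → ∑ (parts ws) (λ r → ∑ (ext x q) (λ q′ → F q′ r)))
        + ∑ (parts us) (λ q → ∑ (parts ws) (λ r → ∑ (ext x r) (λ r′ → F q r′)))
        ≈⟨ +-cong
             (≈-trans (∑-cong (parts us) (λ q → ∑-swap (parts ws) (ext x q) (λ r q′ → F q′ r))) (≈-sym (∑-concatMap (ext x) (parts us) _)))
             (∑-cong (parts us) (λ q → ≈-sym (∑-concatMap (ext x) (parts ws) (F q)))) ⟩
      H (x ∷ us , ws) + H (us , x ∷ ws)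
        ≈⟨ +-congˡ (≈-sym (+-identityʳ _)) ⟩
      H (x ∷ us , ws) + (H (us , x ∷ ws) + 0#) ∎

  -- For s = 1 and constant u the weight of b is (|b|-1)! u^(|b|-1).  General s and u allow one formula
  -- for the sum over all partitions to serve both the Möbius recursion and the coefficients ε.
  module Weight {A : Set} (s : A → Carrier) (u : A → A → Carrier) where

    weight : List A → Carrier
    weight []           = 1#
    weight (x ∷ [])     = s x
    weight (x ∷ y ∷ ys) = ∑ (y ∷ ys) (u x) * weight (y ∷ ys)

    tailProduct : List A → Carrier
    tailProduct []       = 1#
    tailProduct (x ∷ xs) = (s x + ∑ xs (u x)) * tailProduct xs

    -- The new element stands in front of its block `b` and gives it the factor `∑ b (u x)`; over
    -- all blocks these add up to a sum over all points. Blocks have to be nonempty, since an empty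
    -- one would turn into a singleton of weight `s x`.
    ∑-ins-weight : ∀ x {p} → All (_≢ []) p →
      ∑ (ins x p) (λ p′ → ∏ p′ weight) ≈ ∑ (concat p) (u x) * ∏ p weight
    ∑-ins-weight x {[]}          []       = ≈-sym (zeroˡ _)
    ∑-ins-weight x {[] ∷ p}      (n ∷ ne) = ⊥-elim (n refl)
    ∑-ins-weight x {b@(y ∷ ys) ∷ p} (n ∷ ne) = begin
      (∑ b (u x) * weight b) * ∏ p weight + ∑ (map (b ∷_) (ins x p)) (λ p′ → ∏ p′ weight)
        ≈⟨ +-cong (*-assoc _ _ _) (≈-reflexive (∑-map (b ∷_) (ins x p) _)) ⟩
      ∑ b (u x) * (weight b * ∏ p weight) + ∑ (ins x p) (λ p′ → weight b * ∏ p′ weight)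
        ≈⟨ +-congˡ (≈-trans (∑-*ˡ (ins x p) (weight b) _) (*-congˡ (∑-ins-weight x ne))) ⟩
      ∑ b (u x) * (weight b * ∏ p weight) + weight b * (∑ (concat p) (u x) * ∏ p weight)
        ≈⟨ +-congˡ (*-left-comm _ _ _) ⟩
      ∑ b (u x) * (weight b * ∏ p weight) + ∑ (concat p) (u x) * (weight b * ∏ p weight)
        ≈⟨ ≈-sym (distribʳ _ _ _) ⟩
      (∑ b (u x) + ∑ (concat p) (u x)) * (weight b * ∏ p weight)
        ≈⟨ *-congʳ (≈-sym (∑-++ b (concat p) (u x))) ⟩
      ∑ (b ++ concat p) (u x) * (weight b * ∏ p weight) ∎

    -- The factor gained by adding `x` depends on the points of `xs` only, not on how they are
    -- partitioned, so it leaves the sum.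
    ∑-parts-weight : ∀ xs → ∑ (parts xs) (λ p → ∏ p weight) ≈ tailProduct xs
    ∑-parts-weight []       = +-identityʳ 1#
    ∑-parts-weight (x ∷ xs) = begin
      ∑ (parts (x ∷ xs)) (λ p → ∏ p weight)
        ≈⟨ ∑-concatMap (ext x) (parts xs) _ ⟩
      ∑ (parts xs) (λ p → s x * ∏ p weight + ∑ (ins x p) (λ p′ → ∏ p′ weight))
        ≈⟨ ∑-cong∈ (parts xs) (λ {p} p∈ → step p (∈-parts⇒Part xs p∈)) ⟩
      ∑ (parts xs) (λ p → (s x + ∑ xs (u x)) * ∏ p weight)
        ≈⟨ ∑-*ˡ (parts xs) _ _ ⟩
      (s x + ∑ xs (u x)) * ∑ (parts xs) (λ p → ∏ p weight)
        ≈⟨ *-congˡ (∑-parts-weight xs) ⟩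
      tailProduct (x ∷ xs) ∎
      where
      step : ∀ p → Part xs p → s x * ∏ p weight + ∑ (ins x p) (λ p′ → ∏ p′ weight) ≈ (s x + ∑ xs (u x)) * ∏ p weight
      step p P = begin
        s x * ∏ p weight + ∑ (ins x p) (λ p′ → ∏ p′ weight)
          ≈⟨ +-congˡ (≈-trans (∑-ins-weight x (Part-nonempty P)) (*-congʳ (∑-↭ (Part-concat P) (u x)))) ⟩
        s x * ∏ p weight + ∑ xs (u x) * ∏ p weight
          ≈⟨ ≈-sym (distribʳ _ _ _) ⟩
        (s x + ∑ xs (u x)) * ∏ p weight ∎

-- The relation of a set partition

Rel : List (List A) → A → A → Set
Rel p y z = ∃ λ b → b ∈ p × y ∈ b × z ∈ b

Rel-sym : ∀ {p : List (List A)} {y z} → Rel p y z → Rel p z y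
Rel-sym (b , b∈ , y∈ , z∈) = b , b∈ , z∈ , y∈

Rel-there : ∀ {b p} {y z : A} → Rel p y z → Rel (b ∷ p) y z
Rel-there (c , c∈ , yz) = c , there c∈ , yz

Rel-∈ : ∀ {xs} {p : List (List A)} {y z} → Part xs p → Rel p y z → y ∈ xs
Rel-∈ P (b , b∈ , y∈ , z∈) = Perm.∈-resp-↭ (Part-concat P) (∈-concat⁺′ y∈ b∈)

∈⇒block : ∀ {xs} {p : List (List A)} {y} → Part xs p → y ∈ xs → ∃ λ b → b ∈ p × y ∈ b
∈⇒block {p = p} P y∈ with ∈-concat⁻′ p (Perm.∈-resp-↭ (↭-sym (Part-concat P)) y∈)
... | b , y∈b , b∈ = b , b∈ , y∈b

Rel-refl : ∀ {xs} {p : List (List A)} {y} → Part xs p → y ∈ xs → Rel p y y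
Rel-refl P y∈ with ∈⇒block P y∈
... | b , b∈ , y∈b = b , b∈ , y∈b , y∈b

Unique-++-disjoint : ∀ {xs ys : List A} {y} → Unique (xs ++ ys) → y ∈ xs → y ∈ ys → ⊥
Unique-++-disjoint {xs = x ∷ xs} (x∉ ∷ u) (here refl) y∈ = All.lookup x∉ (∈-++⁺ʳ xs y∈) refl
Unique-++-disjoint {xs = x ∷ xs} (_  ∷ u) (there m)   y∈ = Unique-++-disjoint u m y∈

Unique-++ʳ : ∀ (xs : List A) {ys} → Unique (xs ++ ys) → Unique ys
Unique-++ʳ []       u       = u
Unique-++ʳ (x ∷ xs) (_ ∷ u) = Unique-++ʳ xs u

Unique-++ˡ : ∀ (xs : List A) {ys} → Unique (xs ++ ys) → Unique xs
Unique-++ˡ []       u        = []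
Unique-++ˡ (x ∷ xs) (x∉ ∷ u) = AllP.++⁻ˡ xs x∉ ∷ Unique-++ˡ xs u

block-unique : ∀ {p : List (List A)} {b c y} → Unique (concat p) → b ∈ p → c ∈ p → y ∈ b → y ∈ c → b ≡ c
block-unique u (here refl) (here refl) y∈b y∈c = refl
block-unique u (here refl) (there c∈)  y∈b y∈c = ⊥-elim (Unique-++-disjoint u y∈b (∈-concat⁺′ y∈c c∈))
block-unique u (there b∈)  (here refl) y∈b y∈c = ⊥-elim (Unique-++-disjoint u y∈c (∈-concat⁺′ y∈b b∈))
block-unique {p = b ∷ p} u (there b∈) (there c∈) y∈b y∈c = block-unique (Unique-++ʳ b u) b∈ c∈ y∈b y∈c

Unique-resp-↭ : ∀ {xs ys : List A} → xs ↭ ys → Unique xs → Unique ys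
Unique-resp-↭ r = PermS.Unique-resp-↭ (↭⇒↭ₛ r)
  where import Data.List.Relation.Binary.Permutation.Setoid.Properties (≡.setoid _) as PermS

Unique-concat : ∀ {xs} {p : List (List A)} → Unique xs → Part xs p → Unique (concat p)
Unique-concat u P = Unique-resp-↭ (↭-sym (Part-concat P)) u

Rel-trans : ∀ {p : List (List A)} {x y z} → Unique (concat p) → Rel p x y → Rel p y z → Rel p x z
Rel-trans u (b , b∈ , x∈ , y∈) (c , c∈ , y∈′ , z∈) with block-unique u b∈ c∈ y∈ y∈′
... | refl = b , b∈ , x∈ , z∈

Unique-block : ∀ {p : List (List A)} {b} → Unique (concat p) → b ∈ p → Unique b
Unique-block {p = b ∷ p} u (here refl) = Unique-++ˡ b u
Unique-block {p = b ∷ p} u (there b∈)  = Unique-block (Unique-++ʳ b u) b∈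

-- Later entries of `xs` are placed before earlier ones and each goes to the front of its block, so
-- every block keeps the order of `xs`. For `F._<_` this makes the head of a block its least
-- element.
AllPairs-block : ∀ {R : A → A → Set} {xs p} → AllPairs R xs → Part xs p → All (AllPairs R) p
AllPairs-block []       []         = []
AllPairs-block (r ∷ rs) (single P) = ([] ∷ []) ∷ AllPairs-block rs P
AllPairs-block {R = R} (r ∷ rs) (join {x = x} P i) = go i (Perm.All-resp-↭ (↭-sym (Part-concat P)) r) (AllPairs-block rs P)
  where
  go : ∀ {p p′} → Ins x p p′ → All (R x) (concat p) → All (AllPairs R) p → All (AllPairs R) p′
  go (here {b}) a (q ∷ qs) = (AllP.++⁻ˡ b a ∷ q) ∷ qs
  go (there {b} i) a (q ∷ qs) = q ∷ go i (AllP.++⁻ʳ b a) qs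

Ins-Rel⁺ : ∀ {x : A} {p p′ y z} → Ins x p p′ → Rel p y z → Rel p′ y z
Ins-Rel⁺ here      (b , here refl , y∈ , z∈) = _ , here refl , there y∈ , there z∈
Ins-Rel⁺ here      (b , there b∈ , yz)       = b , there b∈ , yz
Ins-Rel⁺ (there i) (b , here refl , yz)      = b , here refl , yz
Ins-Rel⁺ (there i) (b , there b∈ , yz)       = Rel-there (Ins-Rel⁺ i (b , b∈ , yz))

∈-tail : ∀ {x y : A} {xs} → y ≢ x → y ∈ x ∷ xs → y ∈ xs
∈-tail ne (here e)  = ⊥-elim (ne e)
∈-tail ne (there m) = m

Ins-Rel⁻ : ∀ {x : A} {p p′ y z} → Ins x p p′ → y ≢ x → z ≢ x → Rel p′ y z → Rel p y z
Ins-Rel⁻ here      y≢ z≢ (b , here refl , y∈ , z∈) = _ , here refl , ∈-tail y≢ y∈ , ∈-tail z≢ z∈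
Ins-Rel⁻ here      y≢ z≢ (b , there b∈ , yz)       = b , there b∈ , yz
Ins-Rel⁻ (there i) y≢ z≢ (b , here refl , yz)      = b , here refl , yz
Ins-Rel⁻ (there i) y≢ z≢ (b , there b∈ , yz)       = Rel-there (Ins-Rel⁻ i y≢ z≢ (b , b∈ , yz))

single-Rel⁻ : ∀ {x : A} {p y z} → y ≢ x → Rel ((x ∷ []) ∷ p) y z → Rel p y z
single-Rel⁻ y≢ (b , here refl , here e , _) = ⊥-elim (y≢ e)
single-Rel⁻ y≢ (b , there b∈ , yz)          = b , b∈ , yz

insertAt : ∀ {x w : A} {p b} → x ∉ concat p → b ∈ p → w ∈ b →
  ∃ λ p′ → Ins x p p′ × (∀ z → z ∈ b → Rel p′ x z) × (∀ z → z ≢ x → Rel p′ x z → z ∈ b)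
insertAt {x = x} {p = b ∷ p} x∉ (here refl) w∈ =
  (x ∷ b) ∷ p , here , (λ z z∈ → x ∷ b , here refl , here refl , there z∈) , from
  where
  from : ∀ z → z ≢ x → Rel ((x ∷ b) ∷ p) x z → z ∈ b
  from z z≢ (_ , here refl , _ , z∈) = ∈-tail z≢ z∈
  from z z≢ (c , there c∈ , x∈ , _)  = ⊥-elim (x∉ (∈-++⁺ʳ b (∈-concat⁺′ x∈ c∈)))
insertAt {x = x} {p = c ∷ p} {b} x∉ (there b∈) w∈ with insertAt (x∉ ∘ ∈-++⁺ʳ c) b∈ w∈
... | p′ , i , to , from = c ∷ p′ , there i , (λ z z∈ → Rel-there (to z z∈)) , from′
  where
  from′ : ∀ z → z ≢ x → Rel (c ∷ p′) x z → z ∈ b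
  from′ z z≢ (_ , here refl , x∈ , _) = ⊥-elim (x∉ (∈-++⁺ˡ x∈))
  from′ z z≢ (d , there d∈ , xz)      = from z z≢ (d , d∈ , xz)

∉-≢ : ∀ {x y : A} {xs} → x ∉ xs → y ∈ xs → y ≢ x
∉-≢ x∉ y∈ refl = x∉ y∈

∉-concat : ∀ {x : A} {xs p} → x ∉ xs → Part xs p → x ∉ concat p
∉-concat x∉ P m = x∉ (Perm.∈-resp-↭ (Part-concat P) m)

module _ {R : A → A → Set} (R? : ∀ y z → Dec (R y z))
         (R-refl : ∀ y → R y y) (R-sym : ∀ {y z} → R y z → R z y)
         (R-trans : ∀ {x y z} → R x y → R y z → R x z) where

  -- The point `x` joins the block of some already placed point related to it, and opens a block if
  -- there is none; by transitivity it does not matter which point is taken.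
  equivalence⇒Part : ∀ xs → Unique xs →
    ∃ λ p → Part xs p × (∀ {y z} → Rel p y z → R y z) × (∀ {y z} → y ∈ xs → z ∈ xs → R y z → Rel p y z)
  equivalence⇒Part []       u = [] , [] , (λ { (_ , () , _) }) , λ ()
  equivalence⇒Part (x ∷ xs) u@(_ ∷ u′) with equivalence⇒Part xs u′ | any? (R? x) xs
  ... | p , P , to , from | no none = _ , single P , to′ , from′
    where
    to′ : ∀ {y z} → Rel ((x ∷ []) ∷ p) y z → R y z
    to′ (_ , here refl , here refl , here refl) = R-refl x
    to′ (b , there b∈ , yz) = to (b , b∈ , yz)
    from′ : ∀ {y z} → y ∈ x ∷ xs → z ∈ x ∷ xs → R y z → Rel ((x ∷ []) ∷ p) y z
    from′ (here refl) (here refl) r = _ , here refl , here refl , here refl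
    from′ (here refl) (there z∈)  r = ⊥-elim (none (lose z∈ r))
    from′ (there y∈)  (here refl) r = ⊥-elim (none (lose y∈ (R-sym r)))
    from′ (there y∈)  (there z∈)  r = Rel-there (from y∈ z∈ r)
  ... | p , P , to , from | yes some with find some
  ... | w , w∈ , xRw with ∈⇒block P w∈
  ... | b , b∈ , w∈b with insertAt (∉-concat (Unique[x∷xs]⇒x∉xs u) P) b∈ w∈b
  ... | p′ , i , i-to , i-from = p′ , join P i , to′ , from′
    where
    x∉ = Unique[x∷xs]⇒x∉xs u
    xR : ∀ {z} → z ∈ x ∷ xs → Rel p′ x z → R x z
    xR (here refl) r = R-refl x
    xR (there z∈)  r = R-trans xRw (to (b , b∈ , w∈b , i-from _ (∉-≢ x∉ z∈) r))
    to″ : ∀ {y z} → y ∈ x ∷ xs → z ∈ x ∷ xs → Rel p′ y z → R y z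
    to″ (here refl) z∈          r = xR z∈ r
    to″ y∈          (here refl) r = R-sym (xR y∈ (Rel-sym r))
    to″ (there y∈)  (there z∈)  r = to (Ins-Rel⁻ i (∉-≢ x∉ y∈) (∉-≢ x∉ z∈) r)
    to′ : ∀ {y z} → Rel p′ y z → R y z
    to′ r = to″ (Rel-∈ (join P i) r) (Rel-∈ (join P i) (Rel-sym r)) r
    xR⁻ : ∀ {z} → z ∈ xs → R x z → Rel p′ x z
    xR⁻ z∈ r with from w∈ z∈ (R-trans (R-sym xRw) r)
    ... | c , c∈ , w∈c , z∈c with block-unique (Unique-concat u′ P) b∈ c∈ w∈b w∈c
    ... | refl = i-to _ z∈c
    from′ : ∀ {y z} → y ∈ x ∷ xs → z ∈ x ∷ xs → R y z → Rel p′ y z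
    from′ (here refl) (here refl) r = Rel-refl (join P i) (here refl)
    from′ (here refl) (there z∈)  r = xR⁻ z∈ r
    from′ (there y∈)  (here refl) r = Rel-sym (xR⁻ y∈ (R-sym r))
    from′ (there y∈)  (there z∈)  r = Ins-Rel⁺ i (from y∈ z∈ r)

-- A pair of points that is together in just one of the partitions. Unlike `p ≢ q`, such a pair
-- shows that the induced relations, and hence the matrices, differ.
data Distinguished {A : Set} (xs : List A) (p q : List (List A)) : Set where
  left  : ∀ {y z} → y ∈ xs → z ∈ xs → Rel p y z → ¬ Rel q y z → Distinguished xs p q
  right : ∀ {y z} → y ∈ xs → z ∈ xs → ¬ Rel p y z → Rel q y z → Distinguished xs p q

∈-ext-Rel : ∀ {x : A} {p e y z} → e ∈ ext x p → y ≢ x → z ≢ x → (Rel e y z → Rel p y z) × (Rel p y z → Rel e y z)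
∈-ext-Rel (here refl) y≢ z≢ = single-Rel⁻ y≢ , Rel-there
∈-ext-Rel {p = p} (there e∈) y≢ z≢ = let i = ∈-ins⇒Ins p e∈ in Ins-Rel⁻ i y≢ z≢ , Ins-Rel⁺ i

Distinguished-ext : ∀ {x : A} {xs p q d e} → x ∉ xs → Distinguished xs p q → d ∈ ext x p → e ∈ ext x q → Distinguished (x ∷ xs) d e
Distinguished-ext x∉ (left y∈ z∈ r s) d∈ e∈ = left (there y∈) (there z∈)
  (proj₂ (∈-ext-Rel d∈ (∉-≢ x∉ y∈) (∉-≢ x∉ z∈)) r) (s ∘ proj₁ (∈-ext-Rel e∈ (∉-≢ x∉ y∈) (∉-≢ x∉ z∈)))
Distinguished-ext x∉ (right y∈ z∈ r s) d∈ e∈ = right (there y∈) (there z∈)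
  (r ∘ proj₁ (∈-ext-Rel d∈ (∉-≢ x∉ y∈) (∉-≢ x∉ z∈))) (proj₂ (∈-ext-Rel e∈ (∉-≢ x∉ y∈) (∉-≢ x∉ z∈)) s)

ins-new : ∀ {x z : A} {p p′} → x ∉ concat p → z ∉ concat p → z ≢ x → Ins x p p′ → ¬ Rel p′ x z
ins-new x∉ z∉ z≢ i (b , b∈ , _ , z∈) = z∉ (∈-tail z≢ (Perm.∈-resp-↭ (Ins-concat i) (∈-concat⁺′ z∈ b∈)))

Separated : A → List A → List (List A) → List (List A) → Set
Separated x ys d e = ∃ λ z → z ∈ ys × ((Rel d x z × ¬ Rel e x z) ⊎ (¬ Rel d x z × Rel e x z))

-- Of two blocks into which `x` may go, the head of the earlier one is related to `x` in just one of
-- the two results.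
ins-distinguished : ∀ {x : A} p → x ∉ concat p → Unique (concat p) → All (_≢ []) p →
  AllPairs (Separated x (concat p)) (ins x p)
ins-distinguished []      x∉ u ne = []
ins-distinguished ([] ∷ p) x∉ u (n ∷ ne) = ⊥-elim (n refl)
ins-distinguished {x = x} (b@(y ∷ ys) ∷ p) x∉ u (n ∷ ne) =
  AllP.map⁺ (All.tabulate first) ∷
  AllPairsP.map⁺ (AllPairs.map lift (ins-distinguished p (x∉ ∘ ∈-++⁺ʳ b) (Unique-++ʳ b u) ne))
  where
  lower : ∀ {d z} → Rel (b ∷ d) x z → Rel d x z
  lower (_ , here refl , x∈ , _) = ⊥-elim (x∉ (∈-++⁺ˡ x∈))
  lower (c , there c∈ , xz)      = c , c∈ , xz
  first : ∀ {e} → e ∈ ins x p → Separated x (b ++ concat p) ((x ∷ b) ∷ p) (b ∷ e)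
  first e∈ = y , here refl , inj₁ ((_ , here refl , here refl , there (here refl)) ,
    ins-new (x∉ ∘ ∈-++⁺ʳ b) (Unique-++-disjoint u (here refl)) (λ { refl → x∉ (here refl) }) (∈-ins⇒Ins p e∈) ∘ lower)
  lift : ∀ {d e} → Separated x (concat p) d e → Separated x (b ++ concat p) (b ∷ d) (b ∷ e)
  lift (z , z∈ , inj₁ (r , s)) = z , ∈-++⁺ʳ b z∈ , inj₁ (Rel-there r , s ∘ lower)
  lift (z , z∈ , inj₂ (r , s)) = z , ∈-++⁺ʳ b z∈ , inj₂ (r ∘ lower , Rel-there s)

ext-distinguished : ∀ {x : A} {xs p} → x ∉ xs → Unique xs → Part xs p → AllPairs (Distinguished (x ∷ xs)) (ext x p)
ext-distinguished {x = x} {xs} {p} x∉ u P = All.tabulate first ∷ AllPairs.map lift (ins-distinguished p x∉p (Unique-concat u P) (Part-nonempty P))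
  where
  x∉p = ∉-concat x∉ P
  lift : ∀ {d e} → Separated x (concat p) d e → Distinguished (x ∷ xs) d e
  lift (z , z∈ , inj₁ (r , s)) = left (here refl) (there (Perm.∈-resp-↭ (Part-concat P) z∈)) r s
  lift (z , z∈ , inj₂ (r , s)) = right (here refl) (there (Perm.∈-resp-↭ (Part-concat P) z∈)) r s
  witness : ∀ {p e} → Ins x p e → All (_≢ []) p → ∃ λ z → z ∈ concat p × Rel e x z
  witness (here {[]}) (n ∷ _) = ⊥-elim (n refl)
  witness (here {z ∷ b}) _ = z , here refl , _ , here refl , here refl , there (here refl)
  witness (there {b} i) (_ ∷ ne) with witness i ne
  ... | z , z∈ , r = z , ∈-++⁺ʳ b z∈ , Rel-there r
  first : ∀ {e} → e ∈ ins x p → Distinguished (x ∷ xs) ((x ∷ []) ∷ p) e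
  first e∈ with witness (∈-ins⇒Ins p e∈) (Part-nonempty P)
  ... | z , z∈ , r = right (here refl) (there (Perm.∈-resp-↭ (Part-concat P) z∈)) separate r
    where
    separate : ¬ Rel ((x ∷ []) ∷ p) x z
    separate (_ , here refl , _ , here refl) = x∉p z∈
    separate (c , there c∈ , x∈ , _)         = x∉p (∈-concat⁺′ x∈ c∈)

-- Extensions of different partitions stay distinguished by the old pair of points, extensions of
-- the same partition by a pair containing `x`. This is the injectivity that matches `parts` with
-- `flats`.
parts-distinguished : ∀ {xs : List A} → Unique xs → AllPairs (Distinguished xs) (parts xs)
parts-distinguished {xs = []}     u = [] ∷ []
parts-distinguished {xs = x ∷ xs} u@(_ ∷ u′) = AllPairsP.concat⁺
  (AllP.map⁺ (All.tabulate (λ {p} p∈ → ext-distinguished x∉ u′ (∈-parts⇒Part xs p∈))))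
  (AllPairsP.map⁺ (AllPairs.map (λ D → All.tabulate (λ d∈ → All.tabulate (Distinguished-ext x∉ D d∈))) (parts-distinguished u′)))
  where x∉ = Unique[x∷xs]⇒x∉xs u

-- Flats of the braid arrangement as set partitions

toT : ∀ {b} → b ≡ true → T b
toT = Equivalence.from T-≡

fromT : ∀ {b} → T b → b ≡ true
fromT = Equivalence.to T-≡

not-true : ∀ {b} → ¬ (b ≡ true) → b ≡ false
not-true {false} _ = refl
not-true {true}  f = ⊥-elim (f refl)

does-true⁻ : ∀ {P : Set} (P? : Dec P) → does P? ≡ true → P
does-true⁻ (yes p) e = p

∧-true⁻ : ∀ {a b} → a ∧ b ≡ true → a ≡ true × b ≡ true
∧-true⁻ {true} {true} refl = refl , refl

implies⁻ : ∀ {a b} → not a ∨ b ≡ true → a ≡ true → b ≡ true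
implies⁻ {true} e refl = e

implies⁺ : ∀ {a b} → (a ≡ true → b ≡ true) → not a ∨ b ≡ true
implies⁺ {true}  f = f refl
implies⁺ {false} f = refl

all-true⁻ : ∀ (f : A → Bool) {xs x} → all f xs ≡ true → x ∈ xs → f x ≡ true
all-true⁻ f {x ∷ xs} e (here refl) = proj₁ (∧-true⁻ e)
all-true⁻ f {x ∷ xs} e (there m)   = all-true⁻ f (proj₂ (∧-true⁻ {f x} e)) m

all-true⁺ : ∀ (f : A → Bool) xs → (∀ {x} → x ∈ xs → f x ≡ true) → all f xs ≡ true
all-true⁺ f []       h = refl
all-true⁺ f (x ∷ xs) h rewrite h (here refl) = all-true⁺ f xs (h ∘ there)

any-true⁺ : ∀ (f : A → Bool) {xs x} → x ∈ xs → f x ≡ true → any f xs ≡ true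
any-true⁺ f (here refl) e rewrite e = refl
any-true⁺ f {y ∷ ys} (there m) e with f y
... | true  = refl
... | false = any-true⁺ f m e

any-true⁻ : ∀ (f : A → Bool) xs → any f xs ≡ true → ∃ λ x → f x ≡ true
any-true⁻ f (x ∷ xs) e with f x in eq
... | true  = x , eq
... | false = any-true⁻ f xs e

record Equiv {n : ℕ} (X : Mat n) : Set where
  field
    reflexive  : ∀ i → get X i i ≡ true
    symmetric  : ∀ {i j} → get X i j ≡ true → get X j i ≡ true
    transitive : ∀ {i j k} → get X i j ≡ true → get X j k ≡ true → get X i k ≡ true

_⊑_ : ∀ {n} → Mat n → Mat n → Set
X ⊑ Y = ∀ i j → get X i j ≡ true → get Y i j ≡ true

isEquiv⁻ : ∀ {n} {X : Mat n} → isEquiv X ≡ true → Equiv X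
isEquiv⁻ {n} {X} e = record
  { reflexive  = λ i → all-true⁻ _ (proj₁ parts₁) (∈-allFin i)
  ; symmetric  = λ {i} {j} → implies⁻ (all-true⁻ _ (all-true⁻ _ (proj₁ parts₂) (∈-allFin i)) (∈-allFin j))
  ; transitive = λ {i} {j} {k} p q →
      implies⁻ (all-true⁻ _ (all-true⁻ _ (all-true⁻ _ (proj₂ parts₂) (∈-allFin i)) (∈-allFin j)) (∈-allFin k))
               (cong₂ _∧_ p q)
  }
  where
  parts₁ = ∧-true⁻ {all (λ i → get X i i) (allFin n)} e
  parts₂ = ∧-true⁻ {all (λ i → all (λ j → not (get X i j) ∨ get X j i) (allFin n)) (allFin n)} (proj₂ parts₁)

isEquiv⁺ : ∀ {n} {X : Mat n} → Equiv X → isEquiv X ≡ true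
isEquiv⁺ {n} {X} E = cong₂ _∧_ (all-true⁺ _ fs λ {i} _ → reflexive i)
  (cong₂ _∧_ (all-true⁺ _ fs λ _ → all-true⁺ _ fs λ _ → implies⁺ symmetric)
             (all-true⁺ _ fs λ _ → all-true⁺ _ fs λ _ → all-true⁺ _ fs λ _ → implies⁺ λ e →
               transitive (proj₁ (∧-true⁻ e)) (proj₂ (∧-true⁻ e))))
  where
  open Equiv E
  fs = allFin n

leqL⁻ : ∀ {n} {X Y : Mat n} → leqL X Y ≡ true → X ⊑ Y
leqL⁻ e i j = implies⁻ (all-true⁻ _ (all-true⁻ _ e (∈-allFin i)) (∈-allFin j))

leqL⁺ : ∀ {n} {X Y : Mat n} → X ⊑ Y → leqL X Y ≡ true
leqL⁺ {n} h = all-true⁺ _ (allFin n) λ _ → all-true⁺ _ (allFin n) λ _ → implies⁺ (h _ _)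

_≟M_ : ∀ {n} → DecidableEquality (Mat n)
_≟M_ = VecP.≡-dec (VecP.≡-dec BoolP._≟_)

matEq⁻ : ∀ {n} {X Y : Mat n} → matEq X Y ≡ true → X ≡ Y
matEq⁻ {X = X} {Y} e = does-true⁻ (X ≟M Y) e

matEq-refl : ∀ {n} (X : Mat n) → matEq X X ≡ true
matEq-refl X = dec-true (X ≟M X) refl

lookup-ext : ∀ {n} {v w : Vec A n} → (∀ i → lookup v i ≡ lookup w i) → v ≡ w
lookup-ext {v = v} {w} h = trans (sym (VecP.tabulate∘lookup v)) (trans (VecP.tabulate-cong h) (VecP.tabulate∘lookup w))

get-ext : ∀ {n} {X Y : Mat n} → (∀ i j → get X i j ≡ get Y i j) → X ≡ Y
get-ext h = lookup-ext (λ i → lookup-ext (h i))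

⊑-antisym : ∀ {n} {X Y : Mat n} → X ⊑ Y → Y ⊑ X → X ≡ Y
⊑-antisym h k = get-ext λ i j → ⇔→≡ (mk⇔ (h i j) (k i j))

get-tabulate : ∀ {n} (f : Fin n → Fin n → Bool) i j → get (tabulate (λ i → tabulate (f i))) i j ≡ f i j
get-tabulate f i j = trans (cong (λ v → lookup v j) (VecP.lookup∘tabulate (λ i → tabulate (f i)) i)) (VecP.lookup∘tabulate (f i) j)

get-bottom⁻ : ∀ {n} {i j : Fin n} → get (bottom n) i j ≡ true → i ≡ j
get-bottom⁻ {i = i} {j} e = does-true⁻ (i F.≟ j) (trans (sym (get-tabulate (λ i j → does (i F.≟ j)) i j)) e)

bottom-⊑ : ∀ {n} {X : Mat n} → Equiv X → bottom n ⊑ X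
bottom-⊑ {X = X} E i j e with get-bottom⁻ {i = i} {j} e
... | refl = Equiv.reflexive E i

module _ (_≟_ : DecidableEquality A) where
  rel? : ∀ p (y z : A) → Dec (Rel p y z)
  rel? p y z = map′ find (λ (b , b∈ , yz) → lose b∈ yz) (any? (λ b → (y ∈? b) ×-dec (z ∈? b)) p)
    where open DecMem _≟_ using (_∈?_)

  toMat : ∀ {n} → (Fin n → A) → List (List A) → Mat n
  toMat el p = tabulate λ i → tabulate λ j → does (rel? p (el i) (el j))

  get-toMat⁻ : ∀ {n} (el : Fin n → A) p i j → get (toMat el p) i j ≡ true → Rel p (el i) (el j)
  get-toMat⁻ el p i j e = does-true⁻ (rel? p (el i) (el j)) (trans (sym (get-tabulate (λ i j → does (rel? p (el i) (el j))) i j)) e)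

  get-toMat⁺ : ∀ {n} (el : Fin n → A) p i j → Rel p (el i) (el j) → get (toMat el p) i j ≡ true
  get-toMat⁺ el p i j r = trans (get-tabulate (λ i j → does (rel? p (el i) (el j))) i j) (dec-true (rel? p (el i) (el j)) r)

∈-allVec : ∀ {k} {xs : List A} (v : Vec A k) → (∀ i → lookup v i ∈ xs) → v ∈ allVec k xs
∈-allVec []      h = here refl
∈-allVec (x ∷ v) h = concatMap-∈ (∈-allVec v (h ∘ F.suc)) (∈-map⁺ (_∷ v) (h F.zero))

∈-bools : ∀ b → b ∈ bools
∈-bools true  = here refl
∈-bools false = there (here refl)

concatMap≡cartesianProductWith : ∀ {C : Set} (f : A → B → C) xs ys → concatMap (λ x → map (f x) ys) xs ≡ cartesianProductWith f xs ys
concatMap≡cartesianProductWith f []       ys = refl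
concatMap≡cartesianProductWith f (x ∷ xs) ys = cong (map (f x) ys ++_) (concatMap≡cartesianProductWith f xs ys)

allVec-unique : ∀ k {xs : List A} → Unique xs → Unique (allVec k xs)
allVec-unique zero    u = [] ∷ []
allVec-unique (suc k) {xs} u = subst Unique (sym (concatMap≡cartesianProductWith (λ v x → x ∷ v) (allVec k xs) xs))
  (UniqueP.cartesianProductWith⁺ (λ v x → x ∷ v) (λ { refl → refl , refl }) (allVec-unique k u) u)

bools-unique : Unique bools
bools-unique = ((λ ()) ∷ []) ∷ [] ∷ []

∈-flats⁺ : ∀ {n} {X : Mat n} → Equiv X → X ∈ flats n
∈-flats⁺ {X = X} E = ∈-filter⁺ (T? ∘ isEquiv) (∈-allVec X (λ i → ∈-allVec (lookup X i) (λ j → ∈-bools _))) (toT (isEquiv⁺ E))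

∈-flats⁻ : ∀ {n} {X : Mat n} → X ∈ flats n → Equiv X
∈-flats⁻ {n} m = isEquiv⁻ (fromT (proj₂ (∈-filter⁻ (T? ∘ isEquiv) {xs = allVec n (allVec n bools)} m)))

flats-unique : ∀ n → Unique (flats n)
flats-unique n = UniqueP.filter⁺ (T? ∘ isEquiv) (allVec-unique n (allVec-unique n bools-unique))

toFlat : ∀ {n} → List (List (Fin n)) → Mat n
toFlat = toMat F._≟_ (λ i → i)

toFlat-Equiv : ∀ {n} {p : List (List (Fin n))} → Part (allFin n) p → Equiv (toFlat p)
toFlat-Equiv {n} {p} P = record
  { reflexive  = λ i → to _ _ (Rel-refl P (∈-allFin i))
  ; symmetric  = λ e → to _ _ (Rel-sym (from _ _ e))
  ; transitive = λ e f → to _ _ (Rel-trans (Unique-concat (UniqueP.allFin⁺ n) P) (from _ _ e) (from _ _ f))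
  }
  where
  to   = get-toMat⁺ F._≟_ (λ i → i) p
  from = get-toMat⁻ F._≟_ (λ i → i) p

toFlat-unique : ∀ n → Unique (map toFlat (parts (allFin n)))
toFlat-unique n = AllPairsP.map⁺ (AllPairs.map differ (parts-distinguished (UniqueP.allFin⁺ n)))
  where
  to   = get-toMat⁺ F._≟_ (λ i → i)
  from = get-toMat⁻ F._≟_ (λ i → i)
  differ : ∀ {p q} → Distinguished (allFin n) p q → toFlat p ≢ toFlat q
  differ {p} {q} (left _ _ r s)  e = s (from q _ _ (subst (λ X → get X _ _ ≡ true) e (to p _ _ r)))
  differ {p} {q} (right _ _ r s) e = r (from p _ _ (subst (λ X → get X _ _ ≡ true) (sym e) (to q _ _ s)))

Equiv⇒toFlat : ∀ {n} {X : Mat n} → Equiv X → ∃ λ p → Part (allFin n) p × toFlat p ≡ X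
Equiv⇒toFlat {n} {X} E with equivalence⇒Part {R = λ i j → get X i j ≡ true} (λ i j → get X i j BoolP.≟ true)
       reflexive symmetric transitive (allFin n) (UniqueP.allFin⁺ n)
  where
  open Equiv E
... | p , P , to , from = p , P , ⊑-antisym (λ i j e → to (get-toMat⁻ F._≟_ (λ i → i) p i j e))
                                            (λ i j e → get-toMat⁺ F._≟_ (λ i → i) p i j (from (∈-allFin i) (∈-allFin j) e))

-- Two lists without repetition and with the same members are permutations of each other, so sums
-- over flats become sums over partitions.
flats-↭-parts : ∀ n → flats n ↭ map toFlat (parts (allFin n))
flats-↭-parts n = ∼bag⇒↭ (unique∧set⇒bag (flats-unique n) (toFlat-unique n) (mk⇔ to from))
  where
  to : ∀ {X} → X ∈ flats n → X ∈ map toFlat (parts (allFin n))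
  to m with Equiv⇒toFlat (∈-flats⁻ m)
  ... | p , P , refl = ∈-map⁺ toFlat (Part⇒∈-parts P)
  from : ∀ {X} → X ∈ map toFlat (parts (allFin n)) → X ∈ flats n
  from m with ∈-map⁻ toFlat m
  ... | p , p∈ , refl = ∈-flats⁺ (toFlat-Equiv (∈-parts⇒Part (allFin n) p∈))

-- Dimension of a flat and its strict monotonicity

isMin : ∀ {n} → Mat n → Fin n → Bool
isMin {n} X i = not (any (λ j → (toℕ j N.<ᵇ toℕ i) ∧ get X j i) (allFin n))

isMin⁻ : ∀ {n} (X : Mat n) {i j} → isMin X i ≡ true → j F.< i → ¬ (get X j i ≡ true)
isMin⁻ X {i} {j} e j<i r = contradiction (trans (sym e) (cong not (any-true⁺ _ (∈-allFin j) (cong₂ _∧_ (fromT (ℕP.<⇒<ᵇ j<i)) r)))) λ ()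

isMin⁺ : ∀ {n} (X : Mat n) {i} → (∀ j → j F.< i → ¬ (get X j i ≡ true)) → isMin X i ≡ true
isMin⁺ {n} X {i} h with any (λ j → (toℕ j N.<ᵇ toℕ i) ∧ get X j i) (allFin n) in eq
... | false = refl
... | true with any-true⁻ _ (allFin n) eq
... | j , e = ⊥-elim (h j (ℕP.<ᵇ⇒< _ _ (toT (proj₁ (∧-true⁻ e)))) (proj₂ (∧-true⁻ {toℕ j N.<ᵇ toℕ i} e)))

count : (A → Bool) → List A → ℕ
count f xs = length (filterᵇ f xs)

count-cong-≤ : ∀ {f g : A → Bool} xs → (∀ x → f x ≡ true → g x ≡ true) → count f xs ≤ count g xs
count-cong-≤ [] h = z≤n
count-cong-≤ {f = f} {g} (x ∷ xs) h with f x in e₁ | g x in e₂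
... | true  | true  = s≤s (count-cong-≤ xs h)
... | false | true  = ℕP.m≤n⇒m≤1+n (count-cong-≤ xs h)
... | false | false = count-cong-≤ xs h
... | true  | false = contradiction (trans (sym e₂) (h x e₁)) λ ()

-- An entry with `g` but not `f` would make the second count strictly larger.
count-≤-cong : ∀ {f g : A → Bool} xs → (∀ x → f x ≡ true → g x ≡ true) → count g xs ≤ count f xs →
  ∀ {x} → x ∈ xs → g x ≡ true → f x ≡ true
count-≤-cong {f = f} {g} (y ∷ xs) h le m e with f y in e₁ | g y in e₂
count-≤-cong (y ∷ xs) h (s≤s le) (here refl) e | true | true = e₁
count-≤-cong (y ∷ xs) h (s≤s le) (there m) e | true | true = count-≤-cong xs h le m e
... | false | true  = contradiction (ℕP.≤-trans le (count-cong-≤ xs h)) ℕP.1+n≰n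
count-≤-cong (y ∷ xs) h le (here refl) e | false | false = contradiction (trans (sym e₂) e) λ ()
count-≤-cong (y ∷ xs) h le (there m) e | false | false = count-≤-cong xs h le m e
... | true  | false = contradiction (trans (sym e₂) (h y e₁)) λ ()

module _ {n} {p : List (List (Fin n))} (P : Part (allFin n) p) where
  private
    X = toFlat p
    u = Unique-concat (UniqueP.allFin⁺ n) P

    ordered : All (AllPairs F._<_) p
    ordered = AllPairs-block (AllPairsP.tabulate⁺-< (λ i<j → i<j)) P

    isMin-head : ∀ {h t} → AllPairs F._<_ (h ∷ t) → (h ∷ t) ∈ p → isMin X h ≡ true
    isMin-head {h} {t} (h< ∷ _) b∈ = isMin⁺ X no-smaller
      where
      no-smaller : ∀ j → j F.< h → ¬ (get X j h ≡ true)
      no-smaller j j<h e with get-toMat⁻ F._≟_ (λ i → i) p j h e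
      ... | c , c∈ , j∈ , h∈ with block-unique u b∈ c∈ (here refl) h∈
      no-smaller j j<h e | c , c∈ , here refl , h∈ | refl = ℕP.<-irrefl refl j<h
      no-smaller j j<h e | c , c∈ , there j∈ , h∈ | refl = ℕP.<-asym j<h (All.lookup h< j∈)

    isMin-tail : ∀ {h t y} → AllPairs F._<_ (h ∷ t) → (h ∷ t) ∈ p → y ∈ t → isMin X y ≡ false
    isMin-tail {h} {t} {y} (h< ∷ _) b∈ y∈ = not-true λ e →
      isMin⁻ X e (All.lookup h< y∈) (get-toMat⁺ F._≟_ (λ i → i) p h y (_ , b∈ , here refl , there y∈))

    count-none : ∀ (f : Fin n → Bool) xs → (∀ {x} → x ∈ xs → f x ≡ false) → count f xs ≡ 0
    count-none f []       h = refl
    count-none f (x ∷ xs) h rewrite h (here refl) = count-none f xs (h ∘ there)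

    count-block : ∀ {b} → b ≢ [] → AllPairs F._<_ b → b ∈ p → count (isMin X) b ≡ 1
    count-block {[]}    ne o b∈ = ⊥-elim (ne refl)
    count-block {h ∷ t} ne o b∈ rewrite isMin-head o b∈ = cong suc (count-none (isMin X) t (isMin-tail o b∈))

    count-concat : ∀ q → (∀ {b} → b ∈ q → b ∈ p) → count (isMin X) (concat q) ≡ length q
    count-concat []      h = refl
    count-concat (b ∷ q) h = trans (cong length (filter-++ (T? ∘ isMin X) b (concat q)))
      (trans (length-++ (filterᵇ (isMin X) b))
        (cong₂ N._+_ (count-block (All.lookup (Part-nonempty P) (h (here refl))) (All.lookup ordered (h (here refl))) (h (here refl)))
                     (count-concat q (h ∘ there))))

  -- Blocks are increasing lists, so the head of each is its only class-minimal element.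
  dimL-toFlat : dimL X ≡ length p
  dimL-toFlat = trans (Perm.↭-length (Perm.filter-↭ (T? ∘ isMin X) (↭-sym (Part-concat P)))) (count-concat p (λ m → m))

-- `k` bounds the descent through ever smaller members of the class of `i`.
isMin-below : ∀ {n} {Y : Mat n} → Equiv Y → ∀ k i → toℕ i < k → ∃ λ i₀ → get Y i₀ i ≡ true × isMin Y i₀ ≡ true
isMin-below {n} {Y} E (suc k) i (s≤s i≤k) with any (λ j → (toℕ j N.<ᵇ toℕ i) ∧ get Y j i) (allFin n) in eq
... | false = i , Equiv.reflexive E i , cong not eq
... | true with any-true⁻ _ (allFin n) eq
... | j , e with isMin-below E k j (ℕP.<-≤-trans (ℕP.<ᵇ⇒< (toℕ j) (toℕ i) (toT (proj₁ (∧-true⁻ e)))) i≤k)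
... | i₀ , r , m = i₀ , Equiv.transitive E r (proj₂ (∧-true⁻ {toℕ j N.<ᵇ toℕ i} e)) , m

isMin-unique : ∀ {n} {X : Mat n} → Equiv X → ∀ {i j} → isMin X i ≡ true → isMin X j ≡ true → get X i j ≡ true → i ≡ j
isMin-unique {X = X} E {i} {j} mi mj r with FP.<-cmp i j
... | tri< i<j _ _ = ⊥-elim (isMin⁻ X mj i<j r)
... | tri≈ _ e _   = e
... | tri> _ _ j<i = ⊥-elim (isMin⁻ X mi j<i (Equiv.symmetric E r))

-- A finer relation keeps all class minima. If it has no more of them, the `Y`-minima of two
-- `X`-related points are also `X`-minima of a single class, hence equal, and `Y` would be `X`.
dimL-strict : ∀ {n} {X Y : Mat n} → Equiv X → Equiv Y → Y ⊑ X → Y ≢ X → dimL X < dimL Y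
dimL-strict {n} {X} {Y} EX EY Y⊑X Y≢X = ℕP.≰⇒> λ le → Y≢X (⊑-antisym Y⊑X (X⊑Y le))
  where
  min-mono : ∀ i → isMin X i ≡ true → isMin Y i ≡ true
  min-mono i e = isMin⁺ Y λ j j<i r → isMin⁻ X e j<i (Y⊑X j i r)
  X⊑Y : dimL Y ≤ dimL X → X ⊑ Y
  X⊑Y le i j e with isMin-below EY (suc (toℕ i)) i ℕP.≤-refl | isMin-below EY (suc (toℕ j)) j ℕP.≤-refl
  ... | i₀ , ri , mi | j₀ , rj , mj with isMin-unique EX (back mi) (back mj)
        (Equiv.transitive EX (Y⊑X _ _ ri) (Equiv.transitive EX e (Y⊑X _ _ (Equiv.symmetric EY rj))))
    where
    back : ∀ {i} → isMin Y i ≡ true → isMin X i ≡ true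
    back = count-≤-cong (allFin n) min-mono le (∈-allFin _)
  ... | refl = Equiv.transitive EY (Equiv.symmetric EY ri) rj

-- If there are `n` class minima then every point is one, so all classes are singletons. This
-- settles the Möbius recursion when its fuel is spent.
n≤dimL⇒bottom : ∀ {n} {X : Mat n} → Equiv X → n ≤ dimL X → X ≡ bottom n
n≤dimL⇒bottom {n} {X} E le = ⊑-antisym X⊑⊥ (bottom-⊑ E)
  where
  count-all : count (λ _ → true) (allFin n) ≡ n
  count-all = trans (cong length (filter-all (T? ∘ (λ _ → true)) (All.tabulate {xs = allFin n} _))) (length-tabulate {n = n} (λ i → i))
  allMin : ∀ i → isMin X i ≡ true
  allMin i = count-≤-cong (allFin n) (λ _ _ → refl) (ℕP.≤-trans (ℕP.≤-reflexive count-all) le) (∈-allFin i) refl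
  X⊑⊥ : X ⊑ bottom n
  X⊑⊥ i j e with isMin-unique E (allMin i) (allMin j) e
  ... | refl = trans (get-tabulate (λ i j → does (i F.≟ j)) i i) (dec-true (i F.≟ i) refl)

-- Disjoint unions of chains

-- (c , h) is an element of the chain labelled c.  Heights decrease along the order of a chain,
-- so that deleting minima of chains leaves the elements of a tuple of shorter chains.
Element : Set
Element = ℕ × ℕ

_≟E_ : DecidableEquality Element
_≟E_ = ProductP.≡-dec N._≟_ N._≟_

open DecMem _≟E_ using (_∈?_)

_≺_ : Element → Element → Set
(c , h) ≺ (c′ , h′) = c ≡ c′ × h′ < h

chain : ℕ → ℕ → List Element
chain c zero    = []
chain c (suc x) = (c , x) ∷ chain c x

-- The head chain is labelled by the number of chains behind it, so the tail of a vector keeps its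
-- labels under recursion.
elements : ∀ {ℓ} → Vec ℕ ℓ → List Element
elements []                = []
elements {suc ℓ} (x ∷ a) = chain ℓ x ++ elements a

-- Acyclic partitions and their source blocks

IsMinimal : List Element → Element → Set
IsMinimal xs z = ∀ {y} → y ∈ xs → ¬ y ≺ z

-- The point of the cone is a function on all of `Element` that is constrained only by `xs` and `p`.
-- Partitions of different lists can thus be compared without reindexing.
Acyclic : List Element → List (List Element) → Set
Acyclic xs p = Σ (Element → ℚ) λ x →
  (∀ {y z} → Rel p y z → x y ≡ x z) × (∀ {y z} → y ∈ xs → z ∈ xs → y ≺ z → x y <ℚ x z)

p-1<p : ∀ p → p +ℚ -ℚ 1ℚ <ℚ p
p-1<p p = subst (p +ℚ -ℚ 1ℚ <ℚ_) (ℚP.+-identityʳ p) (ℚP.+-monoʳ-< p (from-yes (-ℚ 1ℚ ℚP.<? 0ℚ)))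

lowerBound : ∀ {A : Set} (x : A → ℚ) ws → ∃ λ lo → ∀ {y} → y ∈ ws → lo <ℚ x y
lowerBound x []       = 0ℚ , λ ()
lowerBound x (w ∷ ws) with lowerBound x ws
... | lo , below-ws = (lo ⊓ x w) +ℚ -ℚ 1ℚ , λ
  { (here refl) → ℚP.<-≤-trans (p-1<p (lo ⊓ x w)) (ℚP.p⊓q≤q lo (x w))
  ; (there m)   → ℚP.<-trans (ℚP.<-≤-trans (p-1<p (lo ⊓ x w)) (ℚP.p⊓q≤p lo (x w))) (below-ws m) }

Acyclic-restrict : ∀ {xs ws p q} → (∀ {y} → y ∈ ws → y ∈ xs) → (∀ {y z} → Rel q y z → Rel p y z) → Acyclic xs p → Acyclic ws q
Acyclic-restrict ws⊆xs q⊆p (x , const , increasing) = x , const ∘ q⊆p , λ y∈ z∈ → increasing (ws⊆xs y∈) (ws⊆xs z∈)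

-- All elements outside ws receive the same value, below all values on ws.
Acyclic-extend : ∀ {xs ws p q} → (∀ {y} → y ∈ xs → y ∈ ws ⊎ IsMinimal xs y) →
  (∀ {y z} → Rel p y z → (y ∈ ws × z ∈ ws × Rel q y z) ⊎ (y ∉ ws × z ∉ ws)) → Acyclic ws q → Acyclic xs p
Acyclic-extend {xs} {ws} {p} cover relate (x , const , increasing) = x′ , const′ , increasing′
  where
  lo = proj₁ (lowerBound x ws)
  x′ : Element → ℚ
  x′ y with y ∈? ws
  ... | yes _ = x y
  ... | no _  = lo
  x′-in : ∀ {y} → y ∈ ws → x′ y ≡ x y
  x′-in {y} y∈ with y ∈? ws
  ... | yes _ = refl
  ... | no y∉ = ⊥-elim (y∉ y∈)
  x′-out : ∀ {y} → y ∉ ws → x′ y ≡ lo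
  x′-out {y} y∉ with y ∈? ws
  ... | yes y∈ = ⊥-elim (y∉ y∈)
  ... | no _   = refl
  const′ : ∀ {y z} → Rel p y z → x′ y ≡ x′ z
  const′ r with relate r
  ... | inj₁ (y∈ , z∈ , s) = trans (x′-in y∈) (trans (const s) (sym (x′-in z∈)))
  ... | inj₂ (y∉ , z∉)     = trans (x′-out y∉) (sym (x′-out z∉))
  increasing′ : ∀ {y z} → y ∈ xs → z ∈ xs → y ≺ z → x′ y <ℚ x′ z
  increasing′ {y} {z} y∈ z∈ y≺z with cover z∈
  ... | inj₂ z-min = ⊥-elim (z-min y∈ y≺z)
  ... | inj₁ z∈ws with y ∈? ws
  ...   | yes y∈ws = subst (x y <ℚ_) (sym (x′-in z∈ws)) (increasing y∈ws z∈ws y≺z)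
  ...   | no _     = subst (lo <ℚ_) (sym (x′-in z∈ws)) (proj₂ (lowerBound x ws) z∈ws)

-- Take the block of a point `m` of least value: an element below a member of this block would have
-- a value below that of `m`.
Acyclic⇒minimal-block : ∀ {e xs p} → Part (e ∷ xs) p → Acyclic (e ∷ xs) p → ∃ λ b → b ∈ p × (∀ {z} → z ∈ b → IsMinimal (e ∷ xs) z)
Acyclic⇒minimal-block {e} {xs} {p} P (x , const , increasing) = source
  where
  m = argmin x e xs
  m∈ : m ∈ e ∷ xs
  m∈ with argmin-sel x e xs
  ... | inj₁ eq = here eq
  ... | inj₂ i  = there i
  m-least : ∀ {y} → y ∈ e ∷ xs → x m ≤ℚ x y
  m-least (here refl) = f[argmin]≤f[⊤] {f = x} e xs
  m-least (there i)   = All.lookup (f[argmin]≤f[xs] {f = x} e xs) i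
  source : ∃ λ b → b ∈ p × (∀ {z} → z ∈ b → IsMinimal (e ∷ xs) z)
  source with ∈⇒block P m∈
  ... | b , b∈ , m∈b = b , b∈ , λ {z} z∈ y∈ y≺z →
    ℚP.<-irrefl refl (ℚP.<-≤-trans (increasing y∈ (Rel-∈ P (b , b∈ , z∈ , m∈b)) y≺z) (ℚP.≤-trans (ℚP.≤-reflexive (const (b , b∈ , z∈ , m∈b))) (m-least y∈)))

Split-∈ : ∀ {A : Set} {p q r : List A} {b} → Split p q r → b ∈ p → b ∈ q ⊎ b ∈ r
Split-∈ (left s)  (here refl) = inj₁ (here refl)
Split-∈ (left s)  (there b∈)  = Sum.map₁ there (Split-∈ s b∈)
Split-∈ (right s) (here refl) = inj₂ (here refl)
Split-∈ (right s) (there b∈)  = Sum.map₂ there (Split-∈ s b∈)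

Split-∈ʳ : ∀ {A : Set} {p q r : List A} {b} → Split p q r → b ∈ r → b ∈ p
Split-∈ʳ (left s)  b∈          = there (Split-∈ʳ s b∈)
Split-∈ʳ (right s) (here refl) = here refl
Split-∈ʳ (right s) (there b∈)  = there (Split-∈ʳ s b∈)

Split-concat : ∀ {A : Set} {p q r : List (List A)} → Split p q r → concat p ↭ concat q ++ concat r
Split-concat []                 = ↭-refl
Split-concat {p = b ∷ p} {q = _ ∷ q} {r} (left s) = ↭-trans (Perm.++⁺ˡ b (Split-concat s)) (↭-reflexive (sym (++-assoc b (concat q) (concat r))))
Split-concat {p = b ∷ p} {q} {_ ∷ r} (right s) = ↭-trans (Perm.++⁺ˡ b (Split-concat s)) (Perm.shifts b (concat q))

-- No relation of the order ends at a minimum, and different blocks may share a value, so all blocks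
-- of `q` can be placed at one common value below everything else. Hence the acyclicity of `p`
-- depends on `r` alone.
Acyclic-split : ∀ {xs p q r} → Unique xs → Part xs p → Split p q r → (∀ {b z} → b ∈ q → z ∈ b → IsMinimal xs z) →
  Acyclic xs p ⇔ Acyclic xs r
Acyclic-split {xs} {p} {q} {r} u P S q-min = mk⇔
  (Acyclic-restrict (λ m → m) r⊆p)
  -- The given values on the removed points need not be constant on the blocks of `q`, so they are
  -- first forgotten and then chosen anew.
  (Acyclic-extend cover relate ∘ Acyclic-restrict {q = r} r⊆xs (λ m → m))
  where
  r⊆p : ∀ {y z} → Rel r y z → Rel p y z
  r⊆p (b , b∈ , yz) = b , Split-∈ʳ S b∈ , yz
  r⊆xs : ∀ {y} → y ∈ concat r → y ∈ xs
  r⊆xs m = Perm.∈-resp-↭ (Part-concat P) (Perm.∈-resp-↭ (↭-sym (Split-concat S)) (∈-++⁺ʳ (concat q) m))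
  disjoint : ∀ {y} → y ∈ concat q → y ∉ concat r
  disjoint = Unique-++-disjoint (Unique-resp-↭ (Split-concat S) (Unique-concat u P))
  cover : ∀ {y} → y ∈ xs → y ∈ concat r ⊎ IsMinimal xs y
  cover y∈ with ∈⇒block P y∈
  ... | b , b∈ , y∈b with Split-∈ S b∈
  ...   | inj₁ b∈q = inj₂ (q-min b∈q y∈b)
  ...   | inj₂ b∈r = inj₁ (∈-concat⁺′ y∈b b∈r)
  relate : ∀ {y z} → Rel p y z → (y ∈ concat r × z ∈ concat r × Rel r y z) ⊎ (y ∉ concat r × z ∉ concat r)
  relate (b , b∈ , y∈ , z∈) with Split-∈ S b∈
  ... | inj₁ b∈q = inj₂ (disjoint (∈-concat⁺′ y∈ b∈q) , disjoint (∈-concat⁺′ z∈ b∈q))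
  ... | inj₂ b∈r = inj₁ (∈-concat⁺′ y∈ b∈r , ∈-concat⁺′ z∈ b∈r , b , b∈r , y∈ , z∈)

chain-∈⁻ : ∀ {c x d h} → (d , h) ∈ chain c x → d ≡ c × h < x
chain-∈⁻ {x = suc x} (here refl) = refl , ℕP.≤-refl
chain-∈⁻ {x = suc x} (there m) with chain-∈⁻ {x = x} m
... | e , h< = e , ℕP.m≤n⇒m≤1+n h<

chain-∈⁺ : ∀ {c x h} → h < x → (c , h) ∈ chain c x
chain-∈⁺ {x = suc x} {h} (s≤s h≤x) with h N.≟ x
... | yes refl = here refl
... | no h≢x   = there (chain-∈⁺ (ℕP.≤∧≢⇒< h≤x h≢x))

elements-label : ∀ {ℓ} (a : Vec ℕ ℓ) {c h} → (c , h) ∈ elements a → c < ℓ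
elements-label {suc ℓ} (x ∷ a) m with ∈-++⁻ (chain ℓ x) m
... | inj₁ m₁ = s≤s (ℕP.≤-reflexive (proj₁ (chain-∈⁻ {x = x} m₁)))
... | inj₂ m₂ = ℕP.m≤n⇒m≤1+n (elements-label a m₂)

∈-head-chain : ∀ {ℓ x} {a : Vec ℕ ℓ} {h} → (ℓ , h) ∈ elements (x ∷ a) → h < x
∈-head-chain {ℓ} {x} {a} m with ∈-++⁻ (chain ℓ x) m
... | inj₁ m₁ = proj₂ (chain-∈⁻ {x = x} m₁)
... | inj₂ m₂ = contradiction (elements-label a m₂) (ℕP.<-irrefl refl)

∈-tail-chains : ∀ {ℓ x} {a : Vec ℕ ℓ} {c h} → c < ℓ → (c , h) ∈ elements (x ∷ a) → (c , h) ∈ elements a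
∈-tail-chains {ℓ} {x} c<ℓ m with ∈-++⁻ (chain ℓ x) m
... | inj₁ m₁ = contradiction c<ℓ (ℕP.<-irrefl (proj₁ (chain-∈⁻ {x = x} m₁)))
... | inj₂ m₂ = m₂

elements-downward : ∀ {ℓ} (a : Vec ℕ ℓ) {c g h} → g ≤ h → (c , h) ∈ elements a → (c , g) ∈ elements a
elements-downward {suc ℓ} (x ∷ a) g≤h m with ∈-++⁻ (chain ℓ x) m
... | inj₂ m₂ = ∈-++⁺ʳ (chain ℓ x) (elements-downward a g≤h m₂)
... | inj₁ m₁ with chain-∈⁻ {x = x} m₁
...   | refl , h<x = ∈-++⁺ˡ (chain-∈⁺ (ℕP.≤-<-trans g≤h h<x))

-- Heights decrease along a chain, so `(c , suc h)` is the element just below `(c , h)`.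
minᵇ : ∀ {ℓ} → Vec ℕ ℓ → Element → Bool
minᵇ a (c , h) = not (does ((c , suc h) ∈? elements a))

minᵇ-true⁺ : ∀ {ℓ} (a : Vec ℕ ℓ) {c h} → (c , suc h) ∉ elements a → minᵇ a (c , h) ≡ true
minᵇ-true⁺ a {c} {h} ∉a with (c , suc h) ∈? elements a
... | yes m = ⊥-elim (∉a m)
... | no _  = refl

minᵇ-true⁻ : ∀ {ℓ} (a : Vec ℕ ℓ) {c h} → minᵇ a (c , h) ≡ true → (c , suc h) ∉ elements a
minᵇ-true⁻ a {c} {h} e with (c , suc h) ∈? elements a
... | no m = m

minᵇ-false⁺ : ∀ {ℓ} (a : Vec ℕ ℓ) {c h} → (c , suc h) ∈ elements a → minᵇ a (c , h) ≡ false
minᵇ-false⁺ a {c} {h} m with (c , suc h) ∈? elements a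
... | yes _ = refl
... | no ∉a = ⊥-elim (∉a m)

∉⇒IsMinimal : ∀ {ℓ} (a : Vec ℕ ℓ) {c h} → (c , suc h) ∉ elements a → IsMinimal (elements a) (c , h)
∉⇒IsMinimal a ∉a y∈ (refl , h<) = ∉a (elements-downward a h< y∈)

IsMinimal⇒minᵇ : ∀ {ℓ} (a : Vec ℕ ℓ) {z} → IsMinimal (elements a) z → minᵇ a z ≡ true
IsMinimal⇒minᵇ a z-min = minᵇ-true⁺ a λ m → z-min m (refl , ℕP.≤-refl)

-- `Shrink a b` says that `b` is `a - 1_S` for a set S of nonempty chains, those marked by `drop`.
data Shrink : ∀ {ℓ} → Vec ℕ ℓ → Vec ℕ ℓ → Set where
  []   : Shrink [] []
  keep : ∀ {ℓ x} {a b : Vec ℕ ℓ} → Shrink a b → Shrink (x ∷ a) (x ∷ b)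
  drop : ∀ {ℓ x} {a b : Vec ℕ ℓ} → Shrink a b → Shrink (suc x ∷ a) (x ∷ b)

Shrink-⊆ : ∀ {ℓ} {a b : Vec ℕ ℓ} → Shrink a b → ∀ {y} → y ∈ elements b → y ∈ elements a
Shrink-⊆ (keep {ℓ} {x} S) m = [ ∈-++⁺ˡ , ∈-++⁺ʳ (chain ℓ x) ∘ Shrink-⊆ S ] (∈-++⁻ (chain ℓ x) m)
Shrink-⊆ (drop {ℓ} {x} S) m = [ ∈-++⁺ˡ ∘ there , ∈-++⁺ʳ (chain ℓ (suc x)) ∘ Shrink-⊆ S ] (∈-++⁻ (chain ℓ x) m)

-- A chain that is shortened loses its element of greatest height, which is its minimum.
Shrink-cover : ∀ {ℓ} {a b : Vec ℕ ℓ} → Shrink a b → ∀ {c h} → (c , h) ∈ elements a → (c , h) ∈ elements b ⊎ (c , suc h) ∉ elements a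
Shrink-cover (keep {ℓ} {x} {a} S) m with ∈-++⁻ (chain ℓ x) m
... | inj₁ m₁ = inj₁ (∈-++⁺ˡ m₁)
... | inj₂ m₂ = Sum.map (∈-++⁺ʳ (chain ℓ x)) (λ ∉a m′ → ∉a (∈-tail-chains {x = x} {a} (elements-label a m₂) m′)) (Shrink-cover S m₂)
Shrink-cover (drop {ℓ} {x} {a} S) m with ∈-++⁻ (chain ℓ (suc x)) m
... | inj₁ (here refl) = inj₂ λ m′ → ℕP.<-irrefl refl (∈-head-chain {a = a} m′)
... | inj₁ (there m₁)  = inj₁ (∈-++⁺ˡ m₁)
... | inj₂ m₂ = Sum.map (∈-++⁺ʳ (chain ℓ x)) (λ ∉a m′ → ∉a (∈-tail-chains {x = suc x} {a} (elements-label a m₂) m′)) (Shrink-cover S m₂)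

-- The elements of `a` missing from `b` are minima and lie in no block of `r`, so they can be placed
-- below everything else.
Acyclic-shrink : ∀ {ℓ} {a b : Vec ℕ ℓ} {r} → Shrink a b → Part (elements b) r → Acyclic (elements b) r ⇔ Acyclic (elements a) r
Acyclic-shrink {a = a} S R = mk⇔
  (Acyclic-extend (λ m → Sum.map₂ (∉⇒IsMinimal a) (Shrink-cover S m)) (λ s → inj₁ (Rel-∈ R s , Rel-∈ R (Rel-sym s) , s)))
  (Acyclic-restrict (Shrink-⊆ S) (λ s → s))

-- Positions in [n] and elements of chains

chainV : ℕ → (x : ℕ) → Vec Element x
chainV c zero    = []
chainV c (suc x) = (c , x) ∷ chainV c x

elementsV : ∀ {ℓ} (a : Vec ℕ ℓ) → Vec Element (total a)
elementsV []                = []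
elementsV {suc ℓ} (x ∷ a) = chainV ℓ x V.++ elementsV a

element : ∀ {ℓ} (a : Vec ℕ ℓ) → Fin (total a) → Element
element a = lookup (elementsV a)

toList-elementsV : ∀ {ℓ} (a : Vec ℕ ℓ) → toList (elementsV a) ≡ elements a
toList-elementsV []                = refl
toList-elementsV {suc ℓ} (x ∷ a) = trans (VecP.toList-++ (chainV ℓ x) (elementsV a)) (cong₂ _++_ (toList-chainV x) (toList-elementsV a))
  where
  toList-chainV : ∀ {c} x → toList (chainV c x) ≡ chain c x
  toList-chainV zero    = refl
  toList-chainV {c} (suc x) = cong ((c , x) ∷_) (toList-chainV x)

map-element : ∀ {ℓ} (a : Vec ℕ ℓ) → map (element a) (allFin (total a)) ≡ elements a
map-element a = trans (map-tabulate (λ i → i) (element a)) (trans (tabulate-lookup (elementsV a)) (toList-elementsV a))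
  where
  tabulate-lookup : ∀ {n} (v : Vec Element n) → L.tabulate (lookup v) ≡ toList v
  tabulate-lookup []      = refl
  tabulate-lookup (y ∷ v) = cong (y ∷_) (tabulate-lookup v)

label : ∀ {ℓ} → Fin ℓ → ℕ
label {suc ℓ} F.zero    = ℓ
label {suc ℓ} (F.suc c) = label c

label-< : ∀ {ℓ} (c : Fin ℓ) → label c < ℓ
label-< F.zero    = ℕP.≤-refl
label-< (F.suc c) = ℕP.m≤n⇒m≤1+n (label-< c)

label-injective : ∀ {ℓ} {c d : Fin ℓ} → label c ≡ label d → c ≡ d
label-injective {c = F.zero}  {F.zero}  e = refl
label-injective {c = F.zero}  {F.suc d} e = contradiction (sym e) (ℕP.<⇒≢ (label-< d))
label-injective {c = F.suc c} {F.zero}  e = contradiction e (ℕP.<⇒≢ (label-< c))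
label-injective {c = F.suc c} {F.suc d} e = cong F.suc (label-injective e)

-- Offsets count upward from the start of a block while heights run down to 0 at its end, whence the
-- subtraction in `value`.
record Position {ℓ} (a : Vec ℕ ℓ) (i : Fin (total a)) : Set where
  constructor position
  field
    block   : Fin ℓ
    offset  : ℕ
    offset< : offset < lookup a block
    index   : toℕ i ≡ start a block N.+ offset
    value   : element a i ≡ (label block , lookup a block N.∸ suc offset)

locate : ∀ {ℓ} (a : Vec ℕ ℓ) i → Position a i
locate {suc ℓ} (x ∷ a) i with F.splitAt x i in eq
... | inj₁ j = position F.zero (toℕ j) (FP.toℕ<n j)
    (trans (cong toℕ (sym (FP.splitAt⁻¹-↑ˡ eq))) (FP.toℕ-↑ˡ j (total a)))
    (trans (cong (element (x ∷ a)) (sym (FP.splitAt⁻¹-↑ˡ eq))) (trans (VecP.lookup-++ˡ (chainV ℓ x) (elementsV a) j) (lookup-chainV x j)))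
  where
  lookup-chainV : ∀ x (j : Fin x) → lookup (chainV ℓ x) j ≡ (ℓ , x N.∸ suc (toℕ j))
  lookup-chainV (suc x) F.zero    = refl
  lookup-chainV (suc x) (F.suc j) = lookup-chainV x j
... | inj₂ j with locate a j
...   | position c k k< ix val = position (F.suc c) k k<
    (trans (cong toℕ (sym (FP.splitAt⁻¹-↑ʳ eq))) (trans (FP.toℕ-↑ʳ x j) (trans (cong (x N.+_) ix) (sym (ℕP.+-assoc x (start a c) k)))))
    (trans (cong (element (x ∷ a)) (sym (FP.splitAt⁻¹-↑ʳ eq))) (trans (VecP.lookup-++ʳ (chainV ℓ x) (elementsV a) j) val))

block-disjoint : ∀ {ℓ} (a : Vec ℕ ℓ) c d {m} → start a c ≤ m → m < start a c N.+ lookup a c → start a d ≤ m → m < start a d N.+ lookup a d → c ≡ d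
block-disjoint (x ∷ a) F.zero    F.zero    p q r s = refl
block-disjoint (x ∷ a) F.zero    (F.suc d) p q r s = contradiction q (ℕP.≤⇒≯ (ℕP.≤-trans (ℕP.m≤m+n x _) r))
block-disjoint (x ∷ a) (F.suc c) F.zero    p q r s = contradiction s (ℕP.≤⇒≯ (ℕP.≤-trans (ℕP.m≤m+n x _) p))
block-disjoint (x ∷ a) (F.suc c) (F.suc d) {m} p q r s = cong F.suc (block-disjoint a c d {m N.∸ x} (lower c p) (upper c q) (lower d r) (upper d s))
  where
  x≤m = ℕP.≤-trans (ℕP.m≤m+n x (start a c)) p
  lower : ∀ c → x N.+ start a c ≤ m → start a c ≤ m N.∸ x
  lower c h = ℕP.m+n≤o⇒m≤o∸n (start a c) (subst (_≤ m) (ℕP.+-comm x (start a c)) h)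
  upper : ∀ c → m < x N.+ start a c N.+ lookup a c → m N.∸ x < start a c N.+ lookup a c
  upper c h = ℕP.+-cancelˡ-< x _ _ (subst₂ _<_ (sym (ℕP.m+[n∸m]≡n x≤m)) (ℕP.+-assoc x (start a c) (lookup a c)) h)
  
element-injective : ∀ {ℓ} (a : Vec ℕ ℓ) {i j} → element a i ≡ element a j → i ≡ j
element-injective a {i} {j} e with locate a i | locate a j
... | position c k k< ix val | position d l l< jx wal with trans (sym val) (trans e wal)
... | f with label-injective {c = c} {d} (cong proj₁ f)
... | refl = FP.toℕ-injective (trans ix (trans (cong (start a c N.+_) (ℕP.suc-injective (ℕP.∸-cancelˡ-≡ k< l< (cong proj₂ f)))) (sym jx)))

≺⇒chainLt : ∀ {ℓ} (a : Vec ℕ ℓ) {i j} → element a i ≺ element a j → chainLt a i j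
≺⇒chainLt a {i} {j} lt with locate a i | locate a j
... | position c k k< ix val | position d l l< jx wal with label-injective {c = c} {d} (trans (sym (cong proj₁ val)) (trans (proj₁ lt) (cong proj₁ wal)))
... | refl = c , subst (start a c ≤_) (sym ix) (ℕP.m≤m+n (start a c) k)
               , subst₂ _<_ (sym ix) (sym jx) (ℕP.+-monoʳ-< (start a c) (N.s≤s⁻¹ k<l))
               , subst (_< start a c N.+ lookup a c) (sym jx) (ℕP.+-monoʳ-< (start a c) l<)
  where
  k<l : suc k < suc l
  k<l = ℕP.∸-cancelʳ-< {o = lookup a c} (subst₂ _<_ (cong proj₂ wal) (cong proj₂ val) (proj₂ lt))

chainLt⇒≺ : ∀ {ℓ} (a : Vec ℕ ℓ) {i j} → chainLt a i j → element a i ≺ element a j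
chainLt⇒≺ a {i} {j} (e , s≤i , i<j , j<) with locate a i | locate a j
... | position c k k< ix val | position d l l< jx wal
  with block-disjoint a c e (subst (start a c ≤_) (sym ix) (ℕP.m≤m+n (start a c) k)) (subst (_< start a c N.+ lookup a c) (sym ix) (ℕP.+-monoʳ-< (start a c) k<)) s≤i (ℕP.<-trans i<j j<)
     | block-disjoint a d e (subst (start a d ≤_) (sym jx) (ℕP.m≤m+n (start a d) l)) (subst (_< start a d N.+ lookup a d) (sym jx) (ℕP.+-monoʳ-< (start a d) l<)) (ℕP.≤-trans s≤i (ℕP.<⇒≤ i<j)) j<
... | refl | refl = subst₂ _≺_ (sym val) (sym wal) (refl , ℕP.∸-monoʳ-< (s≤s (ℕP.+-cancelˡ-< (start a c) k l (subst₂ _<_ ix jx i<j))) l<)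

elements-unique : ∀ {ℓ} (a : Vec ℕ ℓ) → Unique (elements a)
elements-unique a = subst Unique (map-element a) (UniqueP.map⁺ (element-injective a) (UniqueP.allFin⁺ (total a)))

toCone : ∀ {ℓ} (a : Vec ℕ ℓ) → List (List Element) → Mat (total a)
toCone a = toMat _≟E_ (element a)

element-∈ : ∀ {ℓ} (a : Vec ℕ ℓ) i → element a i ∈ elements a
element-∈ a i = subst (element a i ∈_) (map-element a) (∈-map⁺ (element a) (∈-allFin i))

∈-element : ∀ {ℓ} (a : Vec ℕ ℓ) {y} → y ∈ elements a → ∃ λ i → y ≡ element a i
∈-element a m with ∈-map⁻ (element a) (subst (_ ∈_) (sym (map-element a)) m)
... | i , _ , e = i , e

-- Points are transported along the bijection `element a`. Only an inclusion is asked of `p`, not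
-- `Part`, so that a partition of some of the elements can also be tested in the cone of `a`.
Meets⇔Acyclic : ∀ {ℓ} (a : Vec ℕ ℓ) {p} → (∀ {y z} → Rel p y z → y ∈ elements a) →
  Meets (chainLt a) (toCone a p) ⇔ Acyclic (elements a) p
Meets⇔Acyclic a {p} p⊆ = mk⇔ to from
  where
  from : Acyclic (elements a) p → Meets (chainLt a) (toCone a p)
  from (x , const , increasing) = x ∘ element a
    , (λ i j e → const (get-toMat⁻ _≟E_ (element a) p i j e))
    , (λ i j lt → increasing (element-∈ a i) (element-∈ a j) (chainLt⇒≺ a lt))
  to : Meets (chainLt a) (toCone a p) → Acyclic (elements a) p
  to (x , const , increasing) = x′ , const′ , increasing′
    where
    x′ : Element → ℚ
    x′ y with y ∈? elements a
    ... | yes m = x (proj₁ (∈-element a m))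
    ... | no _  = 0ℚ
    x′-element : ∀ i → x′ (element a i) ≡ x i
    x′-element i with element a i ∈? elements a
    ... | yes m = cong x (element-injective a (sym (proj₂ (∈-element a m))))
    ... | no ∉a = ⊥-elim (∉a (element-∈ a i))
    const′ : ∀ {y z} → Rel p y z → x′ y ≡ x′ z
    const′ r with ∈-element a (p⊆ r) | ∈-element a (p⊆ (Rel-sym r))
    ... | i , refl | j , refl = trans (x′-element i) (trans (const i j (get-toMat⁺ _≟E_ (element a) p i j r)) (sym (x′-element j)))
    increasing′ : ∀ {y z} → y ∈ elements a → z ∈ elements a → y ≺ z → x′ y <ℚ x′ z
    increasing′ y∈ z∈ y≺z with ∈-element a y∈ | ∈-element a z∈
    ... | i , refl | j , refl = subst₂ _<ℚ_ (sym (x′-element i)) (sym (x′-element j)) (increasing i j (≺⇒chainLt a y≺z))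
    

-- Inclusion-exclusion over source blocks

module Cones (R : CommutativeRing 0ℓ 0ℓ) (t : CommutativeRing.Carrier R) where
  open CommutativeRing R hiding (refl; sym; trans; zero; _-_)
  open CommutativeRing R using () renaming (refl to ≈-refl; sym to ≈-sym; trans to ≈-trans; reflexive to ≈-reflexive)
  open RingSums R
  open import Algebra.Properties.Ring ring using (-‿distribʳ-*)
  open import Algebra.Properties.CommutativeSemigroup *-commutativeSemigroup using () renaming (x∙yz≈y∙xz to *-left-comm)
  open import Algebra.Definitions.RawMonoid +-rawMonoid using () renaming (_×_ to _·_)
  open import Relation.Binary.Reasoning.Setoid setoid

  [_] : Bool → Carrier
  [ b ] = if b then 1# else 0#

  unsigned : ∀ {A : Set} → List A → Carrier
  unsigned = Weight.weight (λ _ → 1#) (λ _ _ → t)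

  ∑-const : ∀ {A : Set} (xs : List A) → ∑ xs (λ _ → t) ≈ length xs · t
  ∑-const []       = ≈-refl
  ∑-const (x ∷ xs) = +-congˡ (∑-const xs)

  ε : ℕ → Carrier
  ε zero    = 1#
  ε (suc j) = (- 1# + j · t) * ε j

  -- The term `-[B consists of minima] w(B)` has again the form of a weight: the last element of a
  -- block supplies the sign, and any element that is not minimal supplies a factor 0. So the sum
  -- over all partitions, signs included, is still a product.
  module SourceWeight {A : Set} (m : A → Bool) where
    private
      s : A → Carrier
      s x = if m x then - 1# else 0#
      u : A → A → Carrier
      u x _ = if m x then t else 0#

    open Weight s u public renaming (weight to source; tailProduct to sourceProduct; ∑-parts-weight to ∑-parts-source) using ()

    private
      u-nonmin : ∀ {x} ys → m x ≡ false → ∑ ys (u x) ≈ 0#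
      u-nonmin ys e = ∑-zero ys λ _ → ≈-reflexive (cong (if_then t else 0#) e)

      u-min : ∀ {x} ys → m x ≡ true → ∑ ys (u x) ≈ ∑ ys (λ _ → t)
      u-min ys e = ∑-cong ys λ _ → ≈-reflexive (cong (if_then t else 0#) e)

    source-nonmin : ∀ {b z} → z ∈ b → m z ≡ false → source b ≈ 0#
    source-nonmin {x ∷ []}     (here refl) e = ≈-reflexive (cong (if_then - 1# else 0#) e)
    source-nonmin {x ∷ y ∷ ys} (here refl) e = ≈-trans (*-cong (u-nonmin (y ∷ ys) e) ≈-refl) (zeroˡ (source (y ∷ ys)))
    source-nonmin {x ∷ y ∷ ys} (there z∈)  e = ≈-trans (*-congˡ (source-nonmin z∈ e)) (zeroʳ (∑ (y ∷ ys) (u x)))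

    source-min : ∀ {b} → b ≢ [] → (∀ {z} → z ∈ b → m z ≡ true) → source b ≈ - unsigned b
    source-min {[]}         ne h = ⊥-elim (ne refl)
    source-min {x ∷ []}     ne h = ≈-reflexive (cong (if_then - 1# else 0#) (h (here refl)))
    source-min {x ∷ y ∷ ys} ne h = ≈-trans
      (*-cong (u-min (y ∷ ys) (h (here refl))) (source-min (λ ()) (h ∘ there)))
      (≈-sym (-‿distribʳ-* (∑ (y ∷ ys) (λ _ → t)) (unsigned (y ∷ ys))))

    sourceProduct-nonmin : ∀ {us z} → z ∈ us → m z ≡ false → sourceProduct us ≈ 0#
    sourceProduct-nonmin {x ∷ us} (here refl) e = ≈-trans
      (*-cong (≈-trans (+-cong (≈-reflexive (cong (if_then - 1# else 0#) e)) (u-nonmin us e)) (+-identityˡ 0#)) ≈-refl)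
      (zeroˡ (sourceProduct us))
    sourceProduct-nonmin {x ∷ us} (there z∈)  e = ≈-trans (*-congˡ (sourceProduct-nonmin z∈ e)) (zeroʳ (s x + ∑ us (u x)))

    sourceProduct-min : ∀ {us} → (∀ {z} → z ∈ us → m z ≡ true) → sourceProduct us ≈ ε (length us)
    sourceProduct-min {[]}     h = ≈-refl
    sourceProduct-min {x ∷ us} h = *-cong
      (+-cong (≈-reflexive (cong (if_then - 1# else 0#) (h (here refl)))) (≈-trans (u-min us (h (here refl))) (∑-const us)))
      (sourceProduct-min (h ∘ there))

    all-min : ∀ xs → (∀ {z} → z ∈ xs → m z ≡ true) ⊎ (∃ λ z → z ∈ xs × m z ≡ false)
    all-min [] = inj₁ λ ()
    all-min (x ∷ xs) with m x in e | all-min xs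
    ... | false | _                  = inj₂ (x , here refl , e)
    ... | true  | inj₂ (z , z∈ , f) = inj₂ (z , there z∈ , f)
    ... | true  | inj₁ h             = inj₁ λ { (here refl) → e ; (there z∈) → h z∈ }

  module ConeSum {ℓ} (a : Vec ℕ ℓ) (d : ∀ X → Dec (Meets (chainLt a) X)) where
    open SourceWeight (minᵇ a)

    -- If `p` partitions only some of the elements, `toCone a p` has false entries on the diagonal
    -- and is no flat. The decider still answers correctly, since `Meets` reads the true entries
    -- only.
    α : List (List Element) → Carrier
    α p = [ does (d (toCone a p)) ]

    partial : List Element → Carrier
    partial ws = ∑ (parts ws) (λ r → α r * ∏ r unsigned)

    cone : Carrier
    cone = ∑ (parts (elements a)) (λ p → α p * ∏ p (λ b → source b + unsigned b))

    if-zero : ∀ {M : Set} (M? : Dec M) {x} → (M → x ≈ 0#) → [ does M? ] * x ≈ 0#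
    if-zero (yes m) h = ≈-trans (*-identityˡ _) (h m)
    if-zero (no _)  h = zeroˡ _

    cone-zero : ∀ {e xs} → elements a ≡ e ∷ xs → cone ≈ 0#
    cone-zero {e} {xs} eq = ∑-zero (parts (elements a)) λ {p} p∈ → term p (∈-parts⇒Part (elements a) p∈)
      where
      term : ∀ p → Part (elements a) p → α p * ∏ p (λ b → source b + unsigned b) ≈ 0#
      term p P = if-zero (d (toCone a p)) λ M → vanish (Acyclic⇒minimal-block (subst (λ xs → Part xs p) eq P)
        (subst (λ xs → Acyclic xs p) eq (Equivalence.to (Meets⇔Acyclic a (Rel-∈ P)) M)))
        where
        vanish : (∃ λ b → b ∈ p × (∀ {z} → z ∈ b → IsMinimal (e ∷ xs) z)) → ∏ p (λ b → source b + unsigned b) ≈ 0#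
        vanish (b , b∈ , b-min) = ∏-zero b∈ cancel
          where
          cancel : source b + unsigned b ≈ 0#
          cancel = ≈-trans
            (+-congʳ (source-min (All.lookup (Part-nonempty P) b∈) (λ z∈ → IsMinimal⇒minᵇ a (subst (λ xs → IsMinimal xs _) (sym eq) (b-min z∈)))))
            (-‿inverseˡ (unsigned b))

    cone-one : elements a ≡ [] → cone ≈ 1#
    cone-one eq = ≈-trans (≈-reflexive (cong (λ xs → ∑ (parts xs) (λ p → α p * ∏ p (λ b → source b + unsigned b))) eq))
      (≈-trans (+-identityʳ (α [] * 1#)) (≈-trans (*-identityʳ (α []))
        (≈-reflexive (cong [_] (dec-true (d (toCone a [])) meets)))))
      where
      meets : Meets (chainLt a) (toCone a [])
      meets = Equivalence.from (Meets⇔Acyclic a {[]} λ { (_ , () , _) })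
        ((λ _ → 0ℚ) , (λ { (_ , () , _) }) , λ y∈ → contradiction (subst (_ ∈_) eq y∈) λ ())

    α-split : ∀ {p q r} → Part (elements a) p → Split p q r → (∀ {z} → z ∈ concat q → minᵇ a z ≡ true) → α p ≡ α r
    α-split {p} {q} {r} P S q-min = cong [_] (does-⇔
      (⇔-sym (Meets⇔Acyclic a λ (b , b∈ , y∈ , z∈) → Rel-∈ P (b , Split-∈ʳ S b∈ , y∈ , z∈))
        ⇔-∘ (Acyclic-split (elements-unique a) P S (λ b∈ z∈ → ∉⇒IsMinimal a (minᵇ-true⁻ a (q-min (∈-concat⁺′ z∈ b∈))))
        ⇔-∘ Meets⇔Acyclic a (Rel-∈ P)))
      (d (toCone a p)) (d (toCone a r)))

    cone-splits : cone ≈ ∑ (splits (elements a)) (λ s → sourceProduct (proj₁ s) * partial (proj₂ s))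
    cone-splits = begin
      cone
        ≈⟨ ∑-cong (parts (elements a)) (λ p → ≈-trans (*-congˡ (∏-splits p source unsigned)) (≈-sym (∑-*ˡ (splits p) (α p) _))) ⟩
      ∑ (parts (elements a)) (λ p → ∑ (splits p) (λ s → α p * (∏ (proj₁ s) source * ∏ (proj₂ s) unsigned)))
        ≈⟨ ∑-cong∈ (parts (elements a)) (λ {p} p∈ → ∑-cong∈ (splits p) (λ {s} s∈ → term p (proj₁ s) (proj₂ s) (∈-parts⇒Part (elements a) p∈) (∈-splits⇒Split p s∈))) ⟩
      ∑ (parts (elements a)) (λ p → ∑ (splits p) (λ s → F (proj₁ s) (proj₂ s)))
        ≈⟨ ∑-parts-splits (elements a) F ⟩
      ∑ (splits (elements a)) (λ s → ∑ (parts (proj₁ s)) (λ q → ∑ (parts (proj₂ s)) (λ r → F q r)))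
        ≈⟨ ∑-cong (splits (elements a)) (λ s → ≈-trans
             (∑-product (parts (proj₁ s)) (parts (proj₂ s)) (λ q → ∏ q source) (λ r → α r * ∏ r unsigned))
             (*-congʳ (∑-parts-source (proj₁ s)))) ⟩
      ∑ (splits (elements a)) (λ s → sourceProduct (proj₁ s) * partial (proj₂ s)) ∎
      where
      F : List (List Element) → List (List Element) → Carrier
      F q r = ∏ q source * (α r * ∏ r unsigned)
      term : ∀ p q r → Part (elements a) p → Split p q r → α p * (∏ q source * ∏ r unsigned) ≈ F q r
      -- `α p` agrees with `α r` when all points of `q` are minima; otherwise `∏ q source` vanishes
      -- and both sides are zero.
      term p q r P S with all-min (concat q)
      ... | inj₁ h = ≈-trans (*-congʳ (≈-reflexive (α-split P S h))) (*-left-comm (α r) (∏ q source) (∏ r unsigned))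
      ... | inj₂ (z , z∈ , e) with ∈-concat⁻′ q z∈
      ...   | b , z∈b , b∈ = ≈-trans
          (≈-trans (*-congˡ (≈-trans (*-congʳ ∏≈0) (zeroˡ (∏ r unsigned)))) (zeroʳ (α p)))
          (≈-sym (≈-trans (*-congʳ ∏≈0) (zeroˡ (α r * ∏ r unsigned))))
          where
          ∏≈0 : ∏ q source ≈ 0#
          ∏≈0 = ∏-zero b∈ (source-nonmin z∈b e)

  -- The sum of H |S| (a - 1_S) over the sets S of nonempty chains of P_a.
  expand : ∀ {ℓ} → Vec ℕ ℓ → (ℕ → Vec ℕ ℓ → Carrier) → Carrier
  expand []          H = H 0 []
  expand (zero ∷ a)  H = expand a (λ j b → H j (zero ∷ b))
  expand (suc x ∷ a) H = expand a (λ j b → H (suc j) (x ∷ b)) + expand a (λ j b → H j (suc x ∷ b))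

  expand-cong : ∀ {ℓ} (a : Vec ℕ ℓ) {H K} → (∀ j b → Shrink a b → H j b ≈ K j b) → expand a H ≈ expand a K
  expand-cong []          e = e 0 [] []
  expand-cong (zero ∷ a)  e = expand-cong a (λ j b S → e j (zero ∷ b) (keep S))
  expand-cong (suc x ∷ a) e = +-cong (expand-cong a (λ j b S → e (suc j) (x ∷ b) (drop S))) (expand-cong a (λ j b S → e j (suc x ∷ b) (keep S)))

  module _ (m : Element → Bool) where
    -- A splitting that puts a nonminimal element on the left contributes zero, so all of `ys` stays
    -- on the right.
    ∑-splits-nonmin : ∀ ys zs (φ : List Element → List Element → Carrier) → (∀ {y} → y ∈ ys → m y ≡ false) →
      (∀ us ws {z} → z ∈ us → m z ≡ false → φ us ws ≈ 0#) →
      ∑ (splits (ys ++ zs)) (λ s → φ (proj₁ s) (proj₂ s)) ≈ ∑ (splits zs) (λ s → φ (proj₁ s) (ys ++ proj₂ s))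
    ∑-splits-nonmin []       zs φ ys-nonmin vanish = ≈-refl
    ∑-splits-nonmin (y ∷ ys) zs φ ys-nonmin vanish = begin
      ∑ (splits (y ∷ ys ++ zs)) (λ s → φ (proj₁ s) (proj₂ s))
        ≈⟨ ∑-concatMap (splitStep y) (splits (ys ++ zs)) _ ⟩
      ∑ (splits (ys ++ zs)) (λ s → φ (y ∷ proj₁ s) (proj₂ s) + (φ (proj₁ s) (y ∷ proj₂ s) + 0#))
        ≈⟨ ∑-cong (splits (ys ++ zs)) (λ (us , ws) → ≈-trans
             (+-cong (vanish (y ∷ us) ws (here refl) (ys-nonmin (here refl))) (+-identityʳ (φ us (y ∷ ws))))
             (+-identityˡ (φ us (y ∷ ws)))) ⟩
      ∑ (splits (ys ++ zs)) (λ s → φ (proj₁ s) (y ∷ proj₂ s))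
        ≈⟨ ∑-splits-nonmin ys zs (λ us ws → φ us (y ∷ ws)) (ys-nonmin ∘ there) (λ us ws → vanish us (y ∷ ws)) ⟩
      ∑ (splits zs) (λ s → φ (proj₁ s) (y ∷ ys ++ proj₂ s)) ∎

    -- Only the minimum of a nonempty chain can go left, and what then remains lists the elements of
    -- a shrunken vector; the surviving splittings are the sets S of `expand`. The predicate `m`
    -- stays fixed while the recursion moves to tails of `a`, and `agree` ties it to the minima of
    -- the current tail.
    ∑-splits-expand : ∀ {ℓ} (a : Vec ℕ ℓ) (φ : List Element → List Element → Carrier) (ψ : ℕ → List Element → Carrier) →
      (∀ {z} → z ∈ elements a → m z ≡ minᵇ a z) →
      (∀ us ws {z} → z ∈ us → m z ≡ false → φ us ws ≈ 0#) →
      (∀ us ws → (∀ {z} → z ∈ us → m z ≡ true) → φ us ws ≈ ψ (length us) ws) →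
      ∑ (splits (elements a)) (λ s → φ (proj₁ s) (proj₂ s)) ≈ expand a (λ j b → ψ j (elements b))
    ∑-splits-expand []         φ ψ agree vanish value = ≈-trans (+-identityʳ (φ [] [])) (value [] [] λ ())
    ∑-splits-expand (zero ∷ a) φ ψ agree vanish value = ∑-splits-expand a φ ψ agree vanish value
    ∑-splits-expand {suc ℓ} (suc x ∷ a) φ ψ agree vanish value = begin
      ∑ (splits (top ∷ ys ++ zs)) (λ s → φ (proj₁ s) (proj₂ s))
        ≈⟨ ∑-concatMap (splitStep top) (splits (ys ++ zs)) _ ⟩
      ∑ (splits (ys ++ zs)) (λ s → φ (top ∷ proj₁ s) (proj₂ s) + (φ (proj₁ s) (top ∷ proj₂ s) + 0#))
        ≈⟨ ≈-trans (∑-cong (splits (ys ++ zs)) (λ (us , ws) → +-congˡ (+-identityʳ (φ us (top ∷ ws))))) (∑-+ (splits (ys ++ zs)) _ _) ⟩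
      ∑ (splits (ys ++ zs)) (λ s → φ (top ∷ proj₁ s) (proj₂ s)) + ∑ (splits (ys ++ zs)) (λ s → φ (proj₁ s) (top ∷ proj₂ s))
        ≈⟨ +-cong
             (≈-trans (∑-splits-nonmin ys zs (λ us ws → φ (top ∷ us) ws) ys-nonmin (λ us ws z∈ → vanish (top ∷ us) ws (there z∈)))
               (∑-splits-expand a (λ us ws → φ (top ∷ us) (ys ++ ws)) (λ j ws → ψ (suc j) (ys ++ ws)) agree-tail
                 (λ us ws z∈ → vanish (top ∷ us) (ys ++ ws) (there z∈))
                 (λ us ws h → value (top ∷ us) (ys ++ ws) λ { (here refl) → top-min ; (there z∈) → h z∈ })))
             (≈-trans (∑-splits-nonmin ys zs (λ us ws → φ us (top ∷ ws)) ys-nonmin (λ us ws → vanish us (top ∷ ws)))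
               (∑-splits-expand a (λ us ws → φ us (top ∷ ys ++ ws)) (λ j ws → ψ j (top ∷ ys ++ ws)) agree-tail
                 (λ us ws → vanish us (top ∷ ys ++ ws)) (λ us ws → value us (top ∷ ys ++ ws)))) ⟩
      expand (suc x ∷ a) (λ j b → ψ j (elements b)) ∎
      where
      -- The first listed element of a chain has the greatest height, so it is the minimum; the rest
      -- `ys` lies above it.
      top = (ℓ , x)
      ys  = chain ℓ x
      zs  = elements a
      top-min : m top ≡ true
      top-min = trans (agree (here refl)) (minᵇ-true⁺ (suc x ∷ a) (λ m → ℕP.<-irrefl refl (∈-head-chain {a = a} m)))
      ys-nonmin : ∀ {y} → y ∈ ys → m y ≡ false
      ys-nonmin {c , h} y∈ with chain-∈⁻ {x = x} y∈
      ... | refl , h<x = trans (agree (there (∈-++⁺ˡ y∈))) (minᵇ-false⁺ (suc x ∷ a) (∈-++⁺ˡ (chain-∈⁺ (s≤s h<x))))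
      agree-tail : ∀ {z} → z ∈ elements a → m z ≡ minᵇ a z
      agree-tail {c , h} z∈ = trans (agree (there (∈-++⁺ʳ ys z∈))) (cong not (does-⇔
        (mk⇔ (∈-tail-chains {x = suc x} {a} (elements-label a z∈)) (∈-++⁺ʳ (chain ℓ (suc x))))
        ((c , suc h) ∈? elements (suc x ∷ a)) ((c , suc h) ∈? elements a)))

  elements-replicate : ∀ ℓ → elements (replicate ℓ 0) ≡ []
  elements-replicate zero    = refl
  elements-replicate (suc ℓ) = elements-replicate ℓ

  elements-nonempty : ∀ {ℓ} (a : Vec ℕ ℓ) → a ≢ replicate ℓ 0 → ∃₂ λ e xs → elements a ≡ e ∷ xs
  elements-nonempty []          a≢ = ⊥-elim (a≢ refl)
  elements-nonempty (suc x ∷ a) a≢ = _ , _ , refl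
  elements-nonempty (zero ∷ a)  a≢ = elements-nonempty a (a≢ ∘ cong (0 ∷_))

  module _ {ℓ} (dec : (a : Vec ℕ ℓ) (X : Mat (total a)) → Dec (Meets (chainLt a) X)) where
    partial : ∀ b → List Element → Carrier
    partial b = ConeSum.partial b (dec b)

    -- The two sides consult deciders for different cones. Both answers amount to the acyclicity of
    -- `r`, which minima outside `r` do not affect.
    partial-shrink : ∀ {a b} → Shrink a b → partial a (elements b) ≈ partial b (elements b)
    partial-shrink {a} {b} S = ∑-cong∈ (parts (elements b)) λ {r} r∈ → *-congʳ (≈-reflexive (cong [_]
      (does-⇔ (same r (∈-parts⇒Part (elements b) r∈)) (dec a (toCone a r)) (dec b (toCone b r)))))
      where
      same : ∀ r → Part (elements b) r → Meets (chainLt a) (toCone a r) ⇔ Meets (chainLt b) (toCone b r)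
      same r R = ⇔-sym (Meets⇔Acyclic b (Rel-∈ R)) ⇔-∘ (⇔-sym (Acyclic-shrink S R) ⇔-∘ Meets⇔Acyclic a (Shrink-⊆ S ∘ Rel-∈ R))

    -- `cone` is evaluated twice: by its source blocks, which gives 0 or 1, and by expanding the
    -- product over the blocks.
    expand-partial : ∀ a → expand a (λ j b → ε j * partial b (elements b)) ≈ [ does (VecP.≡-dec N._≟_ a (replicate ℓ 0)) ]
    expand-partial a = begin
      expand a (λ j b → ε j * partial b (elements b))
        ≈⟨ expand-cong a (λ j b S → *-congˡ (≈-sym (partial-shrink S))) ⟩
      expand a (λ j b → ε j * partial a (elements b))
        ≈⟨ ≈-sym (∑-splits-expand (minᵇ a) a (λ us ws → sourceProduct us * partial a ws) (λ j ws → ε j * partial a ws) (λ _ → refl)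
             (λ us ws z∈ e → ≈-trans (*-congʳ (sourceProduct-nonmin z∈ e)) (zeroˡ (partial a ws)))
             (λ us ws h → *-congʳ (sourceProduct-min h))) ⟩
      ∑ (splits (elements a)) (λ s → sourceProduct (proj₁ s) * partial a (proj₂ s))
        ≈⟨ ≈-sym cone-splits ⟩
      cone
        ≈⟨ value ⟩
      [ does (VecP.≡-dec N._≟_ a (replicate ℓ 0)) ] ∎
      where
      open ConeSum a (dec a) using (cone; cone-splits; cone-one; cone-zero)
      open SourceWeight (minᵇ a) using (sourceProduct; sourceProduct-nonmin; sourceProduct-min)
      value : cone ≈ [ does (VecP.≡-dec N._≟_ a (replicate ℓ 0)) ]
      value with VecP.≡-dec N._≟_ a (replicate ℓ 0)
      ... | yes e = cone-one (trans (cong elements e) (elements-replicate ℓ))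
      ... | no a≢ = cone-zero (proj₂ (proj₂ (elements-nonempty a a≢)))

-- The Möbius function of the intersection lattice

module ℤΣ = RingSums ℤP.+-*-commutativeRing
open ℤΣ using () renaming (∑ to ∑ℤ; ∏ to ∏ℤ)

sumℤ-map : ∀ (f : A → ℤ) xs → sumℤ (map f xs) ≡ ∑ℤ xs f
sumℤ-map f []       = refl
sumℤ-map f (x ∷ xs) = cong (f x +ℤ_) (sumℤ-map f xs)

∑-matEq : ∀ {n} (h : A → Mat n) (w : A → ℤ) {xs x} → Unique (map h xs) → x ∈ xs →
  ∑ℤ xs (λ y → if matEq (h y) (h x) then w y else + 0) ≡ w x
∑-matEq h w {x ∷ xs} (x∉ ∷ u) (here refl) rewrite matEq-refl (h x) =
  trans (cong (w x +ℤ_) (ℤΣ.∑-zero xs λ {y} y∈ → cong (if_then w y else + 0)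
    (not-true λ e → All.lookup x∉ (∈-map⁺ h y∈) (sym (matEq⁻ e))))) (ℤP.+-identityʳ (w x))
∑-matEq h w {y ∷ xs} {x} (y∉ ∷ u) (there x∈)
  rewrite not-true {matEq (h y) (h x)} (λ e → All.lookup y∉ (∈-map⁺ h x∈) (matEq⁻ e)) =
  trans (ℤP.+-identityˡ _) (∑-matEq h w u x∈)

-- For nonempty `b` this is (-1)^(|b|-1) (|b|-1)!, the Möbius number of the lattice of partitions of
-- `b`.
signed : List A → ℤ
signed = ℤΣ.Weight.weight (λ _ → + 1) (λ _ _ → -ℤ + 1)

möbius : List (List A) → ℤ
möbius p = ∏ℤ p signed

module _ {n : ℕ} {X : Mat n} (E : Equiv X) where
  open Equiv E
  private
    R : Fin n → Fin n → Set
    R x y = get X x y ≡ true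

    -- With this as `u`, a block inside a class of `X` weighs as in `signed` and any other block
    -- weighs 0. The sum over all partitions then runs over the flats up to `X` only.
    joined : Fin n → Fin n → ℤ
    joined x y = if get X x y then -ℤ + 1 else + 0

    open ℤΣ.Weight (λ _ → + 1) joined using (weight; tailProduct; ∑-parts-weight)

    get-false : ∀ {x y z} → get X x y ≡ false → R y z → get X x z ≡ false
    get-false e r = not-true λ xz → contradiction (trans (sym e) (transitive xz (symmetric r))) λ ()

    joined-all : ∀ {x} ys → All (R x) ys → ∑ℤ ys (joined x) ≡ ∑ℤ ys (λ _ → -ℤ + 1)
    joined-all ys rs = ℤΣ.∑-cong∈ ys λ {y} y∈ → cong (if_then -ℤ + 1 else + 0) (All.lookup rs y∈)

    joined-none : ∀ {x} ys → (∀ {y} → y ∈ ys → get X x y ≡ false) → ∑ℤ ys (joined x) ≡ + 0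
    joined-none ys h = ℤΣ.∑-zero ys λ {y} y∈ → cong (if_then -ℤ + 1 else + 0) (h y∈)

    -- When the tail of a block lies in one class, its head is related to all of the tail or to none
    -- of it, so the sum over the tail is complete or zero.
    weight-block : ∀ b → (AllPairs R b × weight b ≡ signed b) ⊎ (¬ AllPairs R b × weight b ≡ + 0)
    weight-block []           = inj₁ ([] , refl)
    weight-block (x ∷ [])     = inj₁ ([] ∷ [] , refl)
    weight-block (x ∷ y ∷ ys) with weight-block (y ∷ ys)
    ... | inj₂ (¬rs , e) = inj₂ ((λ { (_ ∷ rs) → ¬rs rs }) , trans (cong (∑ℤ (y ∷ ys) (joined x) *ℤ_) e) (ℤP.*-zeroʳ (∑ℤ (y ∷ ys) (joined x))))
    ... | inj₁ (rs@(r ∷ _) , e) with get X x y in eq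
    ...   | true  = inj₁ ((eq ∷ All.map (transitive eq) r) ∷ rs ,
              cong₂ _*ℤ_ (cong (-ℤ + 1 +ℤ_) (joined-all ys (All.map (transitive eq) r))) e)
    ...   | false = inj₂ ((λ { ((xy ∷ _) ∷ _) → contradiction (trans (sym eq) xy) λ () }) ,
              cong (_*ℤ weight (y ∷ ys)) (trans (ℤP.+-identityˡ (∑ℤ ys (joined x)))
                (joined-none ys λ y∈ → get-false eq (All.lookup r y∈))))

    All-weight : ∀ p → All (AllPairs R) p → ∏ℤ p weight ≡ möbius p
    All-weight p rs = ℤΣ.∏-cong∈ p λ {b} b∈ → go b (All.lookup rs b∈)
      where
      go : ∀ b → AllPairs R b → weight b ≡ signed b
      go b r with weight-block b
      ... | inj₁ (_ , e)  = e
      ... | inj₂ (¬r , _) = ⊥-elim (¬r r)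

    AllPairs-Rel : ∀ {p} → (∀ {y z} → Rel p y z → R y z) → All (AllPairs R) p
    AllPairs-Rel h = All.tabulate λ b∈ → go (λ y∈ z∈ → h (_ , b∈ , y∈ , z∈))
      where
      go : ∀ {b} → (∀ {y z} → y ∈ b → z ∈ b → R y z) → AllPairs R b
      go {[]}    h = []
      go {x ∷ b} h = All.tabulate (λ z∈ → h (here refl) (there z∈)) ∷ go (λ y∈ z∈ → h (there y∈) (there z∈))

    AllPairs⇒R : ∀ {b y z} → AllPairs R b → y ∈ b → z ∈ b → R y z
    AllPairs⇒R (r ∷ rs) (here refl) (here refl) = reflexive _
    AllPairs⇒R (r ∷ rs) (here refl) (there z∈)  = All.lookup r z∈
    AllPairs⇒R (r ∷ rs) (there y∈)  (here refl) = symmetric (All.lookup r y∈)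
    AllPairs⇒R (r ∷ rs) (there y∈)  (there z∈)  = AllPairs⇒R rs y∈ z∈

    weights : ∀ p → All (AllPairs R) p ⊎ (∏ℤ p weight ≡ + 0)
    weights [] = inj₁ []
    weights (b ∷ p) with weight-block b | weights p
    ... | inj₁ (r , _) | inj₁ rs = inj₁ (r ∷ rs)
    ... | inj₁ (r , _) | inj₂ e  = inj₂ (trans (cong (weight b *ℤ_) e) (ℤP.*-zeroʳ (weight b)))
    ... | inj₂ (_ , e) | _       = inj₂ (cong (_*ℤ ∏ℤ p weight) e)

    weight-leq : ∀ p → ∏ℤ p weight ≡ (if leqL (toFlat p) X then möbius p else + 0)
    weight-leq p with leqL (toFlat p) X in eq
    ... | true = All-weight p (AllPairs-Rel λ {y} {z} r → leqL⁻ {X = toFlat p} {X} eq y z (get-toMat⁺ F._≟_ (λ i → i) p y z r))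
    ... | false with weights p
    ...   | inj₂ e  = e
    ...   | inj₁ rs = contradiction (trans (sym eq) (leqL⁺ {X = toFlat p} {X} λ i j e → related (get-toMat⁻ F._≟_ (λ i → i) p i j e))) λ ()
      where
      related : ∀ {i j} → Rel p i j → R i j
      related (b , b∈ , i∈ , j∈) = AllPairs⇒R (All.lookup rs b∈) i∈ j∈

    -- At most one of several pairwise unrelated points can be related to `x`.
    joined-once : ∀ x ys → AllPairs (λ y z → ¬ R y z) ys →
      (All (λ y → ¬ R x y) ys × ∑ℤ ys (joined x) ≡ + 0) ⊎ (¬ All (λ y → ¬ R x y) ys × ∑ℤ ys (joined x) ≡ -ℤ + 1)
    joined-once x []       []        = inj₁ ([] , refl)
    joined-once x (y ∷ ys) (¬r ∷ rs) with get X x y in eq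
    ... | true  = inj₂ ((λ { (¬xy ∷ _) → ¬xy eq }) ,
            cong (-ℤ + 1 +ℤ_) (joined-none ys λ z∈ → not-true λ xz → All.lookup ¬r z∈ (transitive (symmetric eq) xz)))
    ... | false with joined-once x ys rs
    ...   | inj₁ (¬xs , e) = inj₁ ((λ xy → contradiction (trans (sym eq) xy) λ ()) ∷ ¬xs , trans (ℤP.+-identityˡ _) e)
    ...   | inj₂ (xs , e)  = inj₂ ((λ { (_ ∷ ¬xs) → xs ¬xs }) , trans (ℤP.+-identityˡ _) e)

    -- Going through the list from its end, the first point related to a later one is related to
    -- exactly one, which makes its factor 1 - 1.
    tailProduct-discrete : ∀ xs → AllPairs (λ y z → ¬ R y z) xs × tailProduct xs ≡ + 1 ⊎ tailProduct xs ≡ + 0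
    tailProduct-discrete [] = inj₁ ([] , refl)
    tailProduct-discrete (x ∷ xs) with tailProduct-discrete xs
    ... | inj₂ e = inj₂ (trans (cong ((+ 1 +ℤ ∑ℤ xs (joined x)) *ℤ_) e) (ℤP.*-zeroʳ (+ 1 +ℤ ∑ℤ xs (joined x))))
    ... | inj₁ (rs , e) with joined-once x xs rs
    ...   | inj₁ (r , s) = inj₁ (r ∷ rs , cong₂ (λ a b → (+ 1 +ℤ a) *ℤ b) s e)
    ...   | inj₂ (_ , s) = inj₂ (cong (λ a → (+ 1 +ℤ a) *ℤ tailProduct xs) s)

  AllPairs-≢ : ∀ {R : A → A → Set} {xs y z} → AllPairs R xs → y ∈ xs → z ∈ xs → y ≢ z → R y z ⊎ R z y
  AllPairs-≢ (r ∷ rs) (here refl) (here refl) ne = ⊥-elim (ne refl)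
  AllPairs-≢ (r ∷ rs) (here refl) (there z∈)  ne = inj₁ (All.lookup r z∈)
  AllPairs-≢ (r ∷ rs) (there y∈)  (here refl) ne = inj₂ (All.lookup r y∈)
  AllPairs-≢ (r ∷ rs) (there y∈)  (there z∈)  ne = AllPairs-≢ rs y∈ z∈ ne

  discrete⇒bottom : AllPairs (λ y z → ¬ R y z) (allFin n) → X ≡ bottom n
  discrete⇒bottom rs = ⊑-antisym X⊑ (bottom-⊑ E)
    where
    X⊑ : X ⊑ bottom n
    X⊑ i j e with i F.≟ j
    ... | yes refl = trans (get-tabulate (λ i j → does (i F.≟ j)) i i) (dec-true (i F.≟ i) refl)
    ... | no i≢j with AllPairs-≢ rs (∈-allFin i) (∈-allFin j) i≢j
    ...   | inj₁ ¬ij = ⊥-elim (¬ij e)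
    ...   | inj₂ ¬ji = ⊥-elim (¬ji (symmetric e))

  -- The defining property of the Möbius function, for the candidate `möbius`: the sum is the
  -- product over the points of 1 minus the number of later equivalent points, and some factor is
  -- zero as soon as two points are equivalent.
  ∑-möbius-below : X ≢ bottom n → ∑ℤ (parts (allFin n)) (λ p → if leqL (toFlat p) X then möbius p else + 0) ≡ + 0
  ∑-möbius-below X≢⊥ = begin
    ∑ℤ (parts (allFin n)) (λ p → if leqL (toFlat p) X then möbius p else + 0) ≡⟨ ℤΣ.∑-cong (parts (allFin n)) (λ p → sym (weight-leq p)) ⟩
    ∑ℤ (parts (allFin n)) (λ p → ∏ℤ p weight)                                ≡⟨ ∑-parts-weight (allFin n) ⟩
    tailProduct (allFin n)                                                 ≡⟨ vanish ⟩
    + 0                                                                    ∎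
    where
    open ≡-Reasoning
    vanish : tailProduct (allFin n) ≡ + 0
    vanish with tailProduct-discrete (allFin n)
    ... | inj₁ (rs , _) = ⊥-elim (X≢⊥ (discrete⇒bottom rs))
    ... | inj₂ e        = e

möbius-bottom : ∀ {n} {p : List (List (Fin n))} → Part (allFin n) p → toFlat p ≡ bottom n → möbius p ≡ + 1
möbius-bottom {n} {p} P e = trans (ℤΣ.∏-cong∈ p λ b∈ → singleton _ b∈) (ones p)
  where
  ones : ∀ q → ∏ℤ q (λ _ → + 1) ≡ + 1
  ones []      = refl
  ones (b ∷ q) = trans (ℤP.*-identityˡ (∏ℤ q (λ _ → + 1))) (ones q)
  singleton : ∀ b → b ∈ p → signed b ≡ + 1
  singleton []           b∈ = refl
  singleton (x ∷ [])     b∈ = refl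
  singleton (x ∷ y ∷ ys) b∈ with Unique-block (Unique-concat (UniqueP.allFin⁺ n) P) b∈
  ... | (x≢y ∷ _) ∷ _ = ⊥-elim (x≢y (get-bottom⁻ (subst (λ M → get M x y ≡ true) e
          (get-toMat⁺ F._≟_ (λ i → i) p x y (_ , b∈ , here refl , there (here refl))))))

-- The fuel suffices because a flat strictly below the flat of p has more blocks than p.
mobF-toFlat : ∀ {n} f {p : List (List (Fin n))} → Part (allFin n) p → n ≤ length p N.+ f → mobF f (toFlat p) ≡ möbius p
mobF-toFlat {n} f {p} P le with matEq (toFlat p) (bottom n) in eq
mobF-toFlat {n} zero    {p} P le | true = sym (möbius-bottom P (matEq⁻ eq))
mobF-toFlat {n} (suc f) {p} P le | true = sym (möbius-bottom P (matEq⁻ eq))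
-- Without fuel the bound reads `n ≤ length p`, so the flat has full dimension and is the bottom
-- one, against `eq`.
mobF-toFlat {n} zero    {p} P le | false =
  contradiction (trans (sym eq) (trans (cong (λ Y → matEq Y (bottom n)) X≡⊥) (matEq-refl (bottom n)))) λ ()
  where
  X≡⊥ : toFlat p ≡ bottom n
  X≡⊥ = n≤dimL⇒bottom (toFlat-Equiv P) (ℕP.≤-trans le (ℕP.≤-reflexive (trans (ℕP.+-identityʳ _) (sym (dimL-toFlat P)))))
mobF-toFlat {n} (suc f) {p} P le | false = begin
  -ℤ sumℤ (map (mobF f) (filterᵇ (λ Y → ltL Y X) (flats n)))
    ≡⟨ cong -ℤ_ (trans (sumℤ-map (mobF f) (filterᵇ (λ Y → ltL Y X) (flats n))) (ℤΣ.∑-filterᵇ (λ Y → ltL Y X) (flats n) (mobF f))) ⟩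
  -ℤ ∑ℤ (flats n) (λ Y → if ltL Y X then mobF f Y else + 0)
    ≡⟨ cong -ℤ_ (trans (ℤΣ.∑-↭ (flats-↭-parts n) _) (ℤΣ.∑-map toFlat (parts (allFin n)) _)) ⟩
  -ℤ ∑ℤ (parts (allFin n)) (λ q → if ltL (toFlat q) X then mobF f (toFlat q) else + 0)
    ≡⟨ cong -ℤ_ (ℤΣ.∑-cong∈ (parts (allFin n)) use-ih) ⟩
  -ℤ ∑ℤ (parts (allFin n)) strictly
    -- The sum over all flats up to `X` vanishes and its top term is `möbius p`, so the strict part
    -- is the negative of that term.
    ≡⟨ negate (trans (sym split) (∑-möbius-below (toFlat-Equiv P) X≢⊥)) ⟩
  möbius p ∎
  where
  open ≡-Reasoning
  X = toFlat p
  X≢⊥ : X ≢ bottom n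
  X≢⊥ e = contradiction (trans (sym eq) (trans (cong (λ Y → matEq Y (bottom n)) e) (matEq-refl (bottom n)))) λ ()
  strictly : List (List (Fin n)) → ℤ
  strictly q = if ltL (toFlat q) X then möbius q else + 0
  use-ih : ∀ {q} → q ∈ parts (allFin n) → (if ltL (toFlat q) X then mobF f (toFlat q) else + 0) ≡ strictly q
  use-ih {q} q∈ with ltL (toFlat q) X in lt
  ... | false = refl
  ... | true  = mobF-toFlat f Q (ℕP.≤-trans le (ℕP.≤-trans (ℕP.≤-reflexive (ℕP.+-suc (length p) f)) (ℕP.+-monoˡ-≤ f fewer)))
    where
    Q = ∈-parts⇒Part (allFin n) q∈
    q≢p : toFlat q ≢ X
    q≢p e = contradiction (trans (sym (proj₂ (∧-true⁻ {leqL (toFlat q) X} lt))) (cong not (trans (cong (λ Y → matEq Y X) e) (matEq-refl X)))) λ ()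
    fewer : suc (length p) ≤ length q
    fewer = subst (λ k → suc k ≤ length q) (dimL-toFlat P) (subst (suc (dimL X) ≤_) (dimL-toFlat Q)
      (dimL-strict (toFlat-Equiv P) (toFlat-Equiv Q) (leqL⁻ {X = toFlat q} {X} (proj₁ (∧-true⁻ {leqL (toFlat q) X} lt))) q≢p))
  decompose : ∀ q → (if leqL (toFlat q) X then möbius q else + 0) ≡ strictly q +ℤ (if matEq (toFlat q) X then möbius q else + 0)
  decompose q with matEq (toFlat q) X in e | leqL (toFlat q) X in l
  ... | true  | true  = sym (ℤP.+-identityˡ _)
  ... | false | true  = sym (ℤP.+-identityʳ _)
  ... | false | false = refl
  ... | true  | false = contradiction (trans (sym l) (subst (λ Y → leqL (toFlat q) Y ≡ true) (matEq⁻ {X = toFlat q} {X} e) (leqL⁺ {X = toFlat q} {toFlat q} λ _ _ r → r))) λ ()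
  split : ∑ℤ (parts (allFin n)) (λ q → if leqL (toFlat q) X then möbius q else + 0) ≡ ∑ℤ (parts (allFin n)) strictly +ℤ möbius p
  split = trans (ℤΣ.∑-cong (parts (allFin n)) decompose)
    (trans (ℤΣ.∑-+ (parts (allFin n)) strictly _)
      (cong (∑ℤ (parts (allFin n)) strictly +ℤ_) (∑-matEq toFlat möbius (toFlat-unique n) (Part⇒∈-parts P))))
  negate : ∀ {a b} → a +ℤ b ≡ + 0 → -ℤ a ≡ b
  negate {a} {b} e = sym (trans (sym (ℤP.+-identityˡ b)) (trans (cong (_+ℤ b) (sym (ℤP.+-inverseˡ a)))
    (trans (ℤP.+-assoc (-ℤ a) a b) (trans (cong (-ℤ a +ℤ_) e) (ℤP.+-identityʳ (-ℤ a))))))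

μV-toFlat : ∀ {n} {p : List (List (Fin n))} → Part (allFin n) p → μV (toFlat p) ≡ möbius p
μV-toFlat {n} {p} P = mobF-toFlat n P (ℕP.m≤n+m n (length p))

-- Polynomials

open import Algebra.Properties.CommutativeSemigroup ℤP.+-commutativeSemigroup using () renaming (x∙yz≈y∙xz to +ℤ-left-comm; interchange to +ℤ-interchange)

-- The Cauchy product by recursion on the degree, with `p` shifted instead of an index range; the
-- ring laws follow by induction on it.
conv : Poly → Poly → Poly
conv p q zero    = p 0 *ℤ q 0
conv p q (suc k) = p 0 *ℤ q (suc k) +ℤ conv (p ∘ suc) q k

*P-conv : ∀ p q → p *P q ≗ conv p q
*P-conv p q zero    = ℤP.+-identityʳ _
*P-conv p q (suc k) = cong (p 0 *ℤ q (suc k) +ℤ_) (trans (cong sumℤ shift) (*P-conv (p ∘ suc) q k))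
  where
  shift : map (λ i → p i *ℤ q (suc k N.∸ i)) (applyUpTo suc (suc k)) ≡ map (λ i → p (suc i) *ℤ q (k N.∸ i)) (upTo (suc k))
  shift = trans (map-applyUpTo suc (λ i → p i *ℤ q (suc k N.∸ i)) (suc k)) (sym (map-upTo (λ i → p (suc i) *ℤ q (k N.∸ i)) (suc k)))

conv-cong : ∀ {p p′ q q′} → p ≗ p′ → q ≗ q′ → conv p q ≗ conv p′ q′
conv-cong e f zero    = cong₂ _*ℤ_ (e 0) (f 0)
conv-cong e f (suc k) = cong₂ _+ℤ_ (cong₂ _*ℤ_ (e 0) (f (suc k))) (conv-cong (e ∘ suc) f k)

conv-sucʳ : ∀ p q k → conv p q (suc k) ≡ q 0 *ℤ p (suc k) +ℤ conv p (q ∘ suc) k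
conv-sucʳ p q zero = trans (ℤP.+-comm (p 0 *ℤ q 1) (p 1 *ℤ q 0)) (cong (_+ℤ p 0 *ℤ q 1) (ℤP.*-comm (p 1) (q 0)))
conv-sucʳ p q (suc k) = trans (cong (p 0 *ℤ q (suc (suc k)) +ℤ_) (conv-sucʳ (p ∘ suc) q k)) (+ℤ-left-comm (p 0 *ℤ q (suc (suc k))) (q 0 *ℤ p (suc (suc k))) (conv (p ∘ suc) (q ∘ suc) k))

conv-comm : ∀ p q → conv p q ≗ conv q p
conv-comm p q zero    = ℤP.*-comm (p 0) (q 0)
conv-comm p q (suc k) = trans (cong (p 0 *ℤ q (suc k) +ℤ_) (conv-comm (p ∘ suc) q k)) (sym (conv-sucʳ q p k))

conv-distribʳ : ∀ r p q → conv (p +P q) r ≗ (conv p r +P conv q r)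
conv-distribʳ r p q zero    = ℤP.*-distribʳ-+ (r 0) (p 0) (q 0)
conv-distribʳ r p q (suc k) = trans
  (cong₂ _+ℤ_ (ℤP.*-distribʳ-+ (r (suc k)) (p 0) (q 0)) (conv-distribʳ r (p ∘ suc) (q ∘ suc) k))
  (+ℤ-interchange (p 0 *ℤ r (suc k)) (q 0 *ℤ r (suc k)) (conv (p ∘ suc) r k) (conv (q ∘ suc) r k))

conv-scale : ∀ c p q k → conv (λ i → c *ℤ p i) q k ≡ c *ℤ conv p q k
conv-scale c p q zero    = ℤP.*-assoc c (p 0) (q 0)
conv-scale c p q (suc k) = trans (cong₂ _+ℤ_ (ℤP.*-assoc c (p 0) (q (suc k))) (conv-scale c (p ∘ suc) q k))
  (sym (ℤP.*-distribˡ-+ c (p 0 *ℤ q (suc k)) (conv (p ∘ suc) q k)))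

conv-assoc : ∀ p q r → conv (conv p q) r ≗ conv p (conv q r)
conv-assoc p q r zero    = ℤP.*-assoc (p 0) (q 0) (r 0)
conv-assoc p q r (suc k) = begin
  p 0 *ℤ q 0 *ℤ r (suc k) +ℤ conv ((λ i → p 0 *ℤ q (suc i)) +P conv (p ∘ suc) q) r k
    ≡⟨ cong (p 0 *ℤ q 0 *ℤ r (suc k) +ℤ_) (conv-distribʳ r (λ i → p 0 *ℤ q (suc i)) (conv (p ∘ suc) q) k) ⟩
  p 0 *ℤ q 0 *ℤ r (suc k) +ℤ (conv (λ i → p 0 *ℤ q (suc i)) r k +ℤ conv (conv (p ∘ suc) q) r k)
    ≡⟨ cong₂ (λ a b → a +ℤ (b +ℤ conv (conv (p ∘ suc) q) r k)) (ℤP.*-assoc (p 0) (q 0) (r (suc k))) (conv-scale (p 0) (q ∘ suc) r k) ⟩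
  p 0 *ℤ (q 0 *ℤ r (suc k)) +ℤ (p 0 *ℤ conv (q ∘ suc) r k +ℤ conv (conv (p ∘ suc) q) r k)
    ≡⟨ sym (ℤP.+-assoc (p 0 *ℤ (q 0 *ℤ r (suc k))) (p 0 *ℤ conv (q ∘ suc) r k) (conv (conv (p ∘ suc) q) r k)) ⟩
  (p 0 *ℤ (q 0 *ℤ r (suc k)) +ℤ p 0 *ℤ conv (q ∘ suc) r k) +ℤ conv (conv (p ∘ suc) q) r k
    ≡⟨ cong₂ _+ℤ_ (sym (ℤP.*-distribˡ-+ (p 0) (q 0 *ℤ r (suc k)) (conv (q ∘ suc) r k))) (conv-assoc (p ∘ suc) q r k) ⟩
  p 0 *ℤ (q 0 *ℤ r (suc k) +ℤ conv (q ∘ suc) r k) +ℤ conv (p ∘ suc) (conv q r) k ∎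
  where open ≡-Reasoning

conv-zero : ∀ q → conv zeroP q ≗ zeroP
conv-zero q zero    = refl
conv-zero q (suc k) = trans (ℤP.+-identityˡ _) (conv-zero q k)

conv-const : ∀ c q k → conv (constP c) q k ≡ c *ℤ q k
conv-const c q zero    = refl
conv-const c q (suc k) = trans (cong (c *ℤ q (suc k) +ℤ_) (conv-zero q k)) (ℤP.+-identityʳ _)

negP : Poly → Poly
negP p k = -ℤ p k

polyRing : CommutativeRing 0ℓ 0ℓ
polyRing = record
  { Carrier = Poly
  ; _≈_ = _≗_
  ; _+_ = _+P_
  ; _*_ = _*P_
  ; -_ = negP
  ; 0# = zeroP
  ; 1# = constP (+ 1)
  ; isCommutativeRing = record
    { isRing = record
      { +-isAbelianGroup = record
        { isGroup = record
          { isMonoid = record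
            { isSemigroup = record
              { isMagma = record
                { isEquivalence = record
                  { refl = λ _ → refl ; sym = λ e k → sym (e k) ; trans = λ e f k → trans (e k) (f k) }
                ; ∙-cong = λ e f k → cong₂ _+ℤ_ (e k) (f k) }
              ; assoc = λ p q r k → ℤP.+-assoc (p k) (q k) (r k) }
            ; identity = (λ p k → ℤP.+-identityˡ (p k)) , (λ p k → ℤP.+-identityʳ (p k)) }
          ; inverse = (λ p k → ℤP.+-inverseˡ (p k)) , (λ p k → ℤP.+-inverseʳ (p k))
          ; ⁻¹-cong = λ e k → cong -ℤ_ (e k) }
        ; comm = λ p q k → ℤP.+-comm (p k) (q k) }
      ; *-cong = λ {p} {p′} {q} {q′} e f k → trans (*P-conv p q k) (trans (conv-cong e f k) (sym (*P-conv p′ q′ k)))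
      ; *-assoc = assoc
      ; *-identity = identityˡ , λ p k → trans (comm p (constP (+ 1)) k) (identityˡ p k)
      ; distrib = (λ r p q k → trans (comm r (p +P q) k) (trans (distribʳ r p q k) (cong₂ _+ℤ_ (comm p r k) (comm q r k)))) , distribʳ
      }
    ; *-comm = comm
    }
  }
  where
  comm : ∀ p q → p *P q ≗ q *P p
  comm p q k = trans (*P-conv p q k) (trans (conv-comm p q k) (sym (*P-conv q p k)))
  identityˡ : ∀ p → constP (+ 1) *P p ≗ p
  identityˡ p k = trans (*P-conv (constP (+ 1)) p k) (trans (conv-const (+ 1) p k) (ℤP.*-identityˡ (p k)))
  distribʳ : ∀ r p q → (p +P q) *P r ≗ (p *P r) +P (q *P r)
  distribʳ r p q k = trans (*P-conv (p +P q) r k) (trans (conv-distribʳ r p q k) (sym (cong₂ _+ℤ_ (*P-conv p r k) (*P-conv q r k))))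
  assoc : ∀ p q r → (p *P q) *P r ≗ p *P (q *P r)
  assoc p q r k = trans (*P-conv (p *P q) r k) (trans (conv-cong (*P-conv p q) (λ _ → refl) k) (trans (conv-assoc p q r k)
    (sym (trans (*P-conv p (q *P r) k) (conv-cong {p} (λ _ → refl) (*P-conv q r) k)))))

module 𝔓 = CommutativeRing polyRing
module 𝔓Σ = RingSums polyRing

∑-coefficient : ∀ (xs : List A) (f : A → Poly) k → 𝔓Σ.∑ xs f k ≡ ℤΣ.∑ xs (λ x → f x k)
∑-coefficient []       f k = refl
∑-coefficient (x ∷ xs) f k = cong (f x k +ℤ_) (∑-coefficient xs f k)

sumP-map : ∀ (f : A → Poly) xs → sumP (map f xs) ≡ 𝔓Σ.∑ xs f
sumP-map f []       = refl
sumP-map f (x ∷ xs) = cong (f x +P_) (sumP-map f xs)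

mono : ℕ → ℤ → Poly
mono zero    c         = constP c
mono (suc m) c zero    = + 0
mono (suc m) c (suc k) = mono m c k

mono-coefficient : ∀ m c k → mono m c k ≡ (if m ≡ᵇ k then c else + 0)
mono-coefficient zero    c zero    = refl
mono-coefficient zero    c (suc k) = refl
mono-coefficient (suc m) c zero    = refl
mono-coefficient (suc m) c (suc k) = mono-coefficient m c k

mono-+ : ∀ m a b → mono m a +P mono m b ≗ mono m (a +ℤ b)
mono-+ zero    a b zero    = refl
mono-+ zero    a b (suc k) = refl
mono-+ (suc m) a b zero    = refl
mono-+ (suc m) a b (suc k) = mono-+ m a b k

mono-scale : ∀ c m a k → c *ℤ mono m a k ≡ mono m (c *ℤ a) k
mono-scale c zero    a zero    = refl
mono-scale c zero    a (suc k) = ℤP.*-zeroʳ c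
mono-scale c (suc m) a zero    = ℤP.*-zeroʳ c
mono-scale c (suc m) a (suc k) = mono-scale c m a k

mono-* : ∀ m l a b → mono m a *P mono l b ≗ mono (m N.+ l) (a *ℤ b)
mono-* m l a b k = trans (*P-conv (mono m a) (mono l b) k) (go m k)
  where
  go : ∀ m → conv (mono m a) (mono l b) ≗ mono (m N.+ l) (a *ℤ b)
  go zero    k       = trans (conv-const a (mono l b) k) (mono-scale a l b k)
  go (suc m) zero    = refl
  go (suc m) (suc k) = trans (ℤP.+-identityˡ _) (go m k)

𝕥 : Poly
𝕥 = mono 1 (+ 1)

open Cones polyRing 𝕥 using (unsigned; ∑-const; ε; expand; expand-cong; expand-partial; partial) renaming ([_] to [_]ᴾ)
open import Algebra.Definitions.RawMonoid 𝔓.+-rawMonoid using () renaming (_×_ to _·_)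

·-𝕥 : ∀ n → n · 𝕥 ≗ mono 1 (+ n)
·-𝕥 zero    zero          = refl
·-𝕥 zero    (suc zero)    = refl
·-𝕥 zero    (suc (suc k)) = refl
·-𝕥 (suc n) = 𝔓.trans (𝔓.+-congˡ {𝕥} (·-𝕥 n)) (mono-+ 1 (+ 1) (+ n))

-- The Poincaré polynomial as a sum over set partitions

rank : List (List A) → ℕ
rank []      = 0
rank (b ∷ p) = (length b N.∸ 1) N.+ rank p

-- Every element but the last contributes `t` times the number of elements behind it, and that
-- number is the absolute value of its factor in `signed b`.
unsigned-mono : ∀ (b : List A) → unsigned b ≗ mono (length b N.∸ 1) (+ ∣ signed b ∣)
unsigned-mono []           k = refl
unsigned-mono (x ∷ [])     k = refl
unsigned-mono (x ∷ y ∷ ys) = 𝔓.trans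
  (𝔓.*-cong {𝔓Σ.∑ (y ∷ ys) (λ _ → 𝕥)} (𝔓.trans (∑-const (y ∷ ys)) (·-𝕥 (length (y ∷ ys)))) (unsigned-mono (y ∷ ys)))
  (𝔓.trans (mono-* 1 (length ys) (+ suc (length ys)) (+ ∣ signed (y ∷ ys) ∣)) (λ k → cong (λ c → mono (suc (length ys)) c k) coefficient))
  where
  ∑-minus : ∀ (zs : List _) → ℤΣ.∑ zs (λ _ → -ℤ + 1) ≡ -ℤ + length zs
  ∑-minus []       = refl
  ∑-minus (z ∷ zs) = trans (cong (-ℤ + 1 +ℤ_) (∑-minus zs)) (sym (ℤP.neg-distrib-+ (+ 1) (+ length zs)))
  coefficient : + suc (length ys) *ℤ + ∣ signed (y ∷ ys) ∣ ≡ + ∣ signed (x ∷ y ∷ ys) ∣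
  coefficient = trans (sym (ℤP.pos-* (suc (length ys)) ∣ signed (y ∷ ys) ∣))
    (cong +_ (sym (trans (ℤP.abs-* (ℤΣ.∑ (y ∷ ys) (λ _ → -ℤ + 1)) (signed (y ∷ ys)))
      (cong (λ z → ∣ z ∣ N.* ∣ signed (y ∷ ys) ∣) (∑-minus (y ∷ ys))))))

∏-unsigned : ∀ (p : List (List A)) → 𝔓Σ.∏ p unsigned ≗ mono (rank p) (+ ∣ möbius p ∣)
∏-unsigned []      k = refl
∏-unsigned (b ∷ p) = 𝔓.trans (𝔓.*-cong {unsigned b} (unsigned-mono b) (∏-unsigned p))
  (𝔓.trans (mono-* (length b N.∸ 1) (rank p) (+ ∣ signed b ∣) (+ ∣ möbius p ∣)) (λ k → cong (λ c → mono (rank (b ∷ p)) c k) coefficient))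
  where
  coefficient : + ∣ signed b ∣ *ℤ + ∣ möbius p ∣ ≡ + ∣ möbius (b ∷ p) ∣
  coefficient = trans (sym (ℤP.pos-* ∣ signed b ∣ ∣ möbius p ∣)) (cong +_ (sym (ℤP.abs-* (signed b) (möbius p))))

rank-length : ∀ {p : List (List A)} → All (_≢ []) p → rank p N.+ length p ≡ length (concat p)
rank-length []                   = refl
rank-length {p = [] ∷ p} (n ∷ _) = ⊥-elim (n refl)
rank-length {p = (x ∷ b) ∷ p} (_ ∷ ne) = trans (ℕP.+-suc (length b N.+ rank p) (length p))
  (cong suc (trans (ℕP.+-assoc (length b) (rank p) (length p)) (trans (cong (length b N.+_) (rank-length ne)) (sym (length-++ b)))))

codim-toFlat : ∀ {n} {p : List (List (Fin n))} → Part (allFin n) p → codim (toFlat p) ≡ rank p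
codim-toFlat {n} {p} P = trans (cong (n N.∸_) (dimL-toFlat P)) (trans (cong (N._∸ length p) (sym total-length)) (ℕP.m+n∸n≡m (rank p) (length p)))
  where
  total-length : rank p N.+ length p ≡ n
  total-length = trans (rank-length (Part-nonempty P)) (trans (Perm.↭-length (Part-concat P)) (length-tabulate {n = n} (λ i → i)))

-- The product of the block weights is a single monomial of degree `codim`, and the test
-- `codim X ≡ᵇ k` reads off its coefficient.
Poin-parts : ∀ {n} (lt : Fin n → Fin n → Set) (d : ∀ X → Dec (Meets lt X)) →
  Poin lt d ≗ 𝔓Σ.∑ (parts (allFin n)) (λ p → [ does (d (toFlat p)) ]ᴾ *P 𝔓Σ.∏ p unsigned)
Poin-parts {n} lt d k = begin
  sumℤ (map F (flats n))                     ≡⟨ sumℤ-map F (flats n) ⟩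
  ℤΣ.∑ (flats n) F                           ≡⟨ ℤΣ.∑-↭ (flats-↭-parts n) F ⟩
  ℤΣ.∑ (map toFlat (parts (allFin n))) F     ≡⟨ ℤΣ.∑-map toFlat (parts (allFin n)) F ⟩
  ℤΣ.∑ (parts (allFin n)) (F ∘ toFlat)       ≡⟨ ℤΣ.∑-cong∈ (parts (allFin n)) (λ {p} p∈ → term p (∈-parts⇒Part (allFin n) p∈)) ⟩
  ℤΣ.∑ (parts (allFin n)) (λ p → G p k)      ≡⟨ sym (∑-coefficient (parts (allFin n)) G k) ⟩
  𝔓Σ.∑ (parts (allFin n)) G k                ∎
  where
  open ≡-Reasoning
  F : Mat n → ℤ
  F X = if does (d X) ∧ (codim X ≡ᵇ k) then + ∣ μV X ∣ else + 0
  G : List (List (Fin n)) → Poly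
  G p = [ does (d (toFlat p)) ]ᴾ *P 𝔓Σ.∏ p unsigned
  term : ∀ p → Part (allFin n) p → F (toFlat p) ≡ G p k
  term p P rewrite codim-toFlat P | μV-toFlat P with does (d (toFlat p))
  ... | false = sym (𝔓.zeroˡ (𝔓Σ.∏ p unsigned) k)
  ... | true  = sym (trans (𝔓.*-identityˡ (𝔓Σ.∏ p unsigned) k) (trans (∏-unsigned p k) (mono-coefficient (rank p) (+ ∣ möbius p ∣) k)))

module _ (h : A → B) where
  map-blocks : List (List A) → List (List B)
  map-blocks = map (map h)

  ins-map : ∀ x p → ins (h x) (map-blocks p) ≡ map map-blocks (ins x p)
  ins-map x []      = refl
  ins-map x (b ∷ p) = cong (((h x ∷ map h b) ∷ map-blocks p) ∷_)
    (trans (cong (map (map h b ∷_)) (ins-map x p)) (trans (sym (map-∘ (ins x p))) (map-∘ (ins x p))))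

  -- `parts` never inspects the entries of its list, so it is natural.
  parts-map : ∀ xs → parts (map h xs) ≡ map map-blocks (parts xs)
  parts-map []       = refl
  parts-map (x ∷ xs) = begin
    concatMap (ext (h x)) (parts (map h xs))          ≡⟨ cong (concatMap (ext (h x))) (parts-map xs) ⟩
    concatMap (ext (h x)) (map map-blocks (parts xs)) ≡⟨ concatMap-map (ext (h x)) map-blocks (parts xs) ⟩
    concatMap (ext (h x) ∘ map-blocks) (parts xs)     ≡⟨ concatMap-cong (λ p → cong (((h x ∷ []) ∷ map-blocks p) ∷_) (ins-map x p)) (parts xs) ⟩
    concatMap (map map-blocks ∘ ext x) (parts xs)     ≡⟨ sym (map-concatMap map-blocks (ext x) (parts xs)) ⟩
    map map-blocks (concatMap (ext x) (parts xs))     ∎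
    where open ≡-Reasoning

  ∑-map-const : ∀ xs (f : Poly) → 𝔓Σ.∑ (map h xs) (λ _ → f) ≡ 𝔓Σ.∑ xs (λ _ → f)
  ∑-map-const xs f = 𝔓Σ.∑-map h xs (λ _ → f)

  unsigned-map : ∀ b → unsigned (map h b) ≡ unsigned b
  unsigned-map []           = refl
  unsigned-map (x ∷ [])     = refl
  unsigned-map (x ∷ y ∷ ys) = cong₂ _*P_ (∑-map-const (y ∷ ys) 𝕥) (unsigned-map (y ∷ ys))

  ∏-unsigned-map : ∀ p → 𝔓Σ.∏ (map-blocks p) unsigned ≡ 𝔓Σ.∏ p unsigned
  ∏-unsigned-map []      = refl
  ∏-unsigned-map (b ∷ p) = cong₂ _*P_ (unsigned-map b) (∏-unsigned-map p)

  map-blocks-Rel⁺ : ∀ {p y z} → Rel p y z → Rel (map-blocks p) (h y) (h z)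
  map-blocks-Rel⁺ (b , b∈ , y∈ , z∈) = map h b , ∈-map⁺ (map h) b∈ , ∈-map⁺ h y∈ , ∈-map⁺ h z∈

  map-blocks-Rel⁻ : (∀ {y z} → h y ≡ h z → y ≡ z) → ∀ {p y z} → Rel (map-blocks p) (h y) (h z) → Rel p y z
  map-blocks-Rel⁻ inj (c , c∈ , y∈ , z∈) with ∈-map⁻ (map h) c∈
  ... | b , b∈ , refl with ∈-map⁻ h y∈ | ∈-map⁻ h z∈
  ... | y′ , y′∈ , e | z′ , z′∈ , f = b , b∈ , subst (_∈ b) (sym (inj e)) y′∈ , subst (_∈ b) (sym (inj f)) z′∈

module _ (_≟_ : DecidableEquality A) {n} (el : Fin n → A) (inj : ∀ {i j} → el i ≡ el j → i ≡ j) where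
  toMat-map-blocks : ∀ p → toMat _≟_ el (map-blocks el p) ≡ toFlat p
  toMat-map-blocks p = ⊑-antisym
    (λ i j e → get-toMat⁺ F._≟_ (λ i → i) p i j (map-blocks-Rel⁻ el inj (get-toMat⁻ _≟_ el (map-blocks el p) i j e)))
    (λ i j e → get-toMat⁺ _≟_ el (map-blocks el p) i j (map-blocks-Rel⁺ el (get-toMat⁻ F._≟_ (λ i → i) p i j e)))

  -- This moves the sum from [n] to a fixed set of labels, where the partitions belonging to
  -- different n can be compared.
  Poin-relabel : (lt : Fin n → Fin n → Set) (d : ∀ X → Dec (Meets lt X)) →
    Poin lt d ≗ 𝔓Σ.∑ (parts (map el (allFin n))) (λ p → [ does (d (toMat _≟_ el p)) ]ᴾ *P 𝔓Σ.∏ p unsigned)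
  Poin-relabel lt d = begin
    Poin lt d
      ≈⟨ Poin-parts lt d ⟩
    𝔓Σ.∑ (parts (allFin n)) (λ p → [ does (d (toFlat p)) ]ᴾ *P 𝔓Σ.∏ p unsigned)
      ≈⟨ 𝔓Σ.∑-cong (parts (allFin n)) (λ p k → cong₂ (λ X w → ([ does (d X) ]ᴾ *P w) k) (sym (toMat-map-blocks p)) (sym (∏-unsigned-map el p))) ⟩
    𝔓Σ.∑ (parts (allFin n)) (λ p → [ does (d (toMat _≟_ el (map-blocks el p))) ]ᴾ *P 𝔓Σ.∏ (map-blocks el p) unsigned)
      ≈⟨ 𝔓.reflexive (sym (𝔓Σ.∑-map (map-blocks el) (parts (allFin n)) _)) ⟩
    𝔓Σ.∑ (map (map-blocks el) (parts (allFin n))) (λ p → [ does (d (toMat _≟_ el p)) ]ᴾ *P 𝔓Σ.∏ p unsigned)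
      ≈⟨ 𝔓.reflexive (cong (λ L → 𝔓Σ.∑ L (λ p → [ does (d (toMat _≟_ el p)) ]ᴾ *P 𝔓Σ.∏ p unsigned)) (sym (parts-map el (allFin n)))) ⟩
    𝔓Σ.∑ (parts (map el (allFin n))) (λ p → [ does (d (toMat _≟_ el p)) ]ᴾ *P 𝔓Σ.∏ p unsigned) ∎
    where open import Relation.Binary.Reasoning.Setoid 𝔓.setoid

-- Power series

open 𝔓Σ using (∑)
open import Algebra.Properties.Ring 𝔓.ring using (-‿distribˡ-*)
open import Relation.Binary.Reasoning.Setoid 𝔓.setoid

sumS-map : ∀ {A : Set} {ℓ} (f : A → Series ℓ) xs a → sumS (map f xs) a ≡ ∑ xs (λ x → f x a)
sumS-map f []       a = refl
sumS-map f (x ∷ xs) a = cong (f x a +P_) (sumS-map f xs a)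

-- The coefficient at `c` of the sum over j of `K j` times the j-th elementary symmetric polynomial.
squarefree : ∀ {ℓ} → (ℕ → Poly) → Vec ℕ ℓ → Poly
squarefree K []                = K 0
squarefree K (zero ∷ c)        = squarefree K c
squarefree K (suc zero ∷ c)    = squarefree (K ∘ suc) c
squarefree K (suc (suc _) ∷ c) = 𝔓.0#

squarefree-cong : ∀ {ℓ} {K L} → (∀ j → K j ≗ L j) → (c : Vec ℕ ℓ) → squarefree K c ≗ squarefree L c
squarefree-cong e []                = e 0
squarefree-cong e (zero ∷ c)        = squarefree-cong e c
squarefree-cong e (suc zero ∷ c)    = squarefree-cong (e ∘ suc) c
squarefree-cong e (suc (suc _) ∷ c) = 𝔓.refl

squarefree-minus : ∀ {ℓ} K L (c : Vec ℕ ℓ) → squarefree K c -P squarefree L c ≗ squarefree (λ j → K j -P L j) c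
squarefree-minus K L []                = 𝔓.refl
squarefree-minus K L (zero ∷ c)        = squarefree-minus K L c
squarefree-minus K L (suc zero ∷ c)    = squarefree-minus (K ∘ suc) (L ∘ suc) c
squarefree-minus K L (suc (suc _) ∷ c) = λ _ → refl

squarefree-zero : ∀ {ℓ} (c : Vec ℕ ℓ) → squarefree (λ _ → 𝔓.0#) c ≗ 𝔓.0#
squarefree-zero []                = 𝔓.refl
squarefree-zero (zero ∷ c)        = squarefree-zero c
squarefree-zero (suc zero ∷ c)    = squarefree-zero c
squarefree-zero (suc (suc _) ∷ c) = 𝔓.refl

_≟V_ : ∀ {ℓ} (a b : Vec ℕ ℓ) → Dec (a ≡ b)
_≟V_ = VecP.≡-dec N._≟_

monoS-∷-same : ∀ {ℓ} y (w c : Vec ℕ ℓ) → monoS (y ∷ w) (y ∷ c) ≡ monoS w c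
monoS-∷-same y w c = cong [_]ᴾ (does-⇔ (mk⇔ VecP.∷-injectiveʳ (cong (y ∷_))) ((y ∷ c) ≟V (y ∷ w)) (c ≟V w))

monoS-∷-diff : ∀ {ℓ x y} (w c : Vec ℕ ℓ) → x ≢ y → monoS (y ∷ w) (x ∷ c) ≡ 𝔓.0#
monoS-∷-diff {x = x} {y} w c x≢y = cong [_]ᴾ (dec-false ((x ∷ c) ≟V (y ∷ w)) (x≢y ∘ VecP.∷-injectiveˡ))

-- A set with indicator `c` is the support of `c`; it exists just for 0/1 vectors and has as many
-- members as `c` has ones.
∑-indicators : ∀ {ℓ} (K : ℕ → Poly) (c : Vec ℕ ℓ) →
  ∑ (allVec ℓ bools) (λ S → monoS (indicator S) c 𝔓.* K (countTrue S)) ≗ squarefree K c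
∑-indicators K []      = 𝔓.trans (𝔓.+-identityʳ (𝔓.1# 𝔓.* K 0)) (𝔓.*-identityˡ (K 0))
∑-indicators {suc ℓ} K (x ∷ c) = begin
  ∑ (allVec (suc ℓ) bools) (λ S → monoS (indicator S) (x ∷ c) 𝔓.* K (countTrue S))
    ≈⟨ 𝔓Σ.∑-concatMap (λ v → map (_∷ v) bools) (allVec ℓ bools) _ ⟩
  ∑ (allVec ℓ bools) (λ v → one v 𝔓.+ (zer v 𝔓.+ 𝔓.0#))
    ≈⟨ 𝔓.trans (𝔓Σ.∑-cong (allVec ℓ bools) (λ v → 𝔓.+-congˡ {one v} (𝔓.+-identityʳ (zer v)))) (𝔓Σ.∑-+ (allVec ℓ bools) one zer) ⟩
  ∑ (allVec ℓ bools) one 𝔓.+ ∑ (allVec ℓ bools) zer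
    ≈⟨ value x refl ⟩
  squarefree K (x ∷ c) ∎
  where
  one zer : Vec Bool ℓ → Poly
  one v = monoS (1 ∷ indicator v) (x ∷ c) 𝔓.* K (suc (countTrue v))
  zer v = monoS (0 ∷ indicator v) (x ∷ c) 𝔓.* K (countTrue v)
  one-zero : x ≢ 1 → ∑ (allVec ℓ bools) one ≗ 𝔓.0#
  one-zero x≢ = 𝔓Σ.∑-zero (allVec ℓ bools) λ {v} _ → 𝔓.trans (𝔓.*-congʳ {K (suc (countTrue v))} (𝔓.reflexive (monoS-∷-diff (indicator v) c x≢))) (𝔓.zeroˡ (K (suc (countTrue v))))
  zer-zero : x ≢ 0 → ∑ (allVec ℓ bools) zer ≗ 𝔓.0#
  zer-zero x≢ = 𝔓Σ.∑-zero (allVec ℓ bools) λ {v} _ → 𝔓.trans (𝔓.*-congʳ {K (countTrue v)} (𝔓.reflexive (monoS-∷-diff (indicator v) c x≢))) (𝔓.zeroˡ (K (countTrue v)))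
  value : ∀ y → x ≡ y → ∑ (allVec ℓ bools) one 𝔓.+ ∑ (allVec ℓ bools) zer ≗ squarefree K (y ∷ c)
  value zero refl = 𝔓.trans (𝔓.+-cong (one-zero λ ())
    (𝔓.trans (𝔓Σ.∑-cong (allVec ℓ bools) λ v → 𝔓.*-congʳ {K (countTrue v)} (𝔓.reflexive (monoS-∷-same 0 (indicator v) c))) (∑-indicators K c)))
    (𝔓.+-identityˡ (squarefree K c))
  value (suc zero) refl = 𝔓.trans (𝔓.+-cong
    (𝔓.trans (𝔓Σ.∑-cong (allVec ℓ bools) λ v → 𝔓.*-congʳ {K (suc (countTrue v))} (𝔓.reflexive (monoS-∷-same 1 (indicator v) c))) (∑-indicators (K ∘ suc) c)) (zer-zero λ ()))
    (𝔓.+-identityʳ (squarefree (K ∘ suc) c))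
  value (suc (suc y)) refl = 𝔓.trans (𝔓.+-cong (one-zero λ ()) (zer-zero λ ())) (𝔓.+-identityˡ 𝔓.0#)

oneCoefficient : ℕ → Poly
oneCoefficient zero    = 𝔓.1#
oneCoefficient (suc _) = 𝔓.0#

-- The sum in the denominator starts at j = 1, so the value at 0 is zero although `factorP 0` is 1.
sumCoefficient : ℕ → Poly
sumCoefficient zero    = 𝔓.0#
sumCoefficient (suc j) = factorP (suc j)

oneS-squarefree : ∀ {ℓ} (c : Vec ℕ ℓ) → oneS ℓ c ≗ squarefree oneCoefficient c
oneS-squarefree []      = 𝔓.refl
oneS-squarefree {suc ℓ} (zero ∷ c)        = 𝔓.trans (𝔓.reflexive (monoS-∷-same 0 (replicate ℓ 0) c)) (oneS-squarefree c)
oneS-squarefree {suc ℓ} (suc zero ∷ c)    = 𝔓.trans (𝔓.reflexive (monoS-∷-diff {x = 1} {0} (replicate ℓ 0) c λ ())) (𝔓.sym (squarefree-zero c))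
oneS-squarefree {suc ℓ} (suc (suc x) ∷ c) = 𝔓.reflexive (monoS-∷-diff {x = suc (suc x)} {0} (replicate ℓ 0) c λ ())

countTrue≤ : ∀ {ℓ} (S : Vec Bool ℓ) → countTrue S ≤ ℓ
countTrue≤ []          = z≤n
countTrue≤ (true ∷ S)  = s≤s (countTrue≤ S)
countTrue≤ (false ∷ S) = ℕP.m≤n⇒m≤1+n (countTrue≤ S)

∑-applyUpTo-zero : ∀ (h : ℕ → ℕ) ℓ (f : ℕ → Poly) → (∀ i → f (h i) ≗ 𝔓.0#) → ∑ (applyUpTo h ℓ) f ≗ 𝔓.0#
∑-applyUpTo-zero h zero    f e = 𝔓.refl
∑-applyUpTo-zero h (suc ℓ) f e = 𝔓.trans (𝔓.+-cong (e 0) (∑-applyUpTo-zero (h ∘ suc) ℓ f (e ∘ suc))) (𝔓.+-identityˡ 𝔓.0#)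

∑-applyUpTo-single : ∀ (h : ℕ → ℕ) {ℓ n} (f : ℕ → Poly) → n < ℓ → (∀ i → i ≢ n → f (h i) ≗ 𝔓.0#) → ∑ (applyUpTo h ℓ) f ≗ f (h n)
∑-applyUpTo-single h {suc ℓ} {zero}  f n<      e = 𝔓.trans (𝔓.+-congˡ {f (h 0)} (∑-applyUpTo-zero (h ∘ suc) ℓ f (λ i → e (suc i) λ ()))) (𝔓.+-identityʳ (f (h 0)))
∑-applyUpTo-single h {suc ℓ} {suc n} f (s≤s n<) e = 𝔓.trans
  (𝔓.+-cong (e 0 λ ()) (∑-applyUpTo-single (h ∘ suc) f n< (λ i i≢ → e (suc i) (i≢ ∘ ℕP.suc-injective)))) (𝔓.+-identityˡ (f (h (suc n))))

denomSum-squarefree : ∀ {ℓ} (c : Vec ℕ ℓ) → denomSum ℓ c ≗ squarefree sumCoefficient c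
denomSum-squarefree {ℓ} c = begin
  denomSum ℓ c
    ≈⟨ 𝔓.reflexive (sumS-map (λ j → scaleS (factorP j) (elemS ℓ j)) js c) ⟩
  ∑ js (λ j → factorP j 𝔓.* elemS ℓ j c)
    ≈⟨ 𝔓Σ.∑-cong js (λ j → 𝔓.trans (𝔓.*-congˡ {factorP j} (elem j)) (𝔓.sym (𝔓Σ.∑-*ˡ Ss (factorP j) _))) ⟩
  ∑ js (λ j → ∑ Ss (λ S → term S j))
    ≈⟨ 𝔓Σ.∑-swap js Ss (λ j S → term S j) ⟩
  ∑ Ss (λ S → ∑ js (term S))
    -- For fixed `S` only `j = countTrue S` survives, and it lies in the range from 1 to ℓ unless
    -- `S` is empty.
    ≈⟨ 𝔓Σ.∑-cong Ss (λ S → collect S (countTrue S) refl (countTrue≤ S)) ⟩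
  ∑ Ss (λ S → monoS (indicator S) c 𝔓.* sumCoefficient (countTrue S))
    ≈⟨ ∑-indicators sumCoefficient c ⟩
  squarefree sumCoefficient c ∎
  where
  js = applyUpTo suc ℓ
  Ss = allVec ℓ bools
  term : Vec Bool ℓ → ℕ → Poly
  term S j = factorP j 𝔓.* (if countTrue S ≡ᵇ j then monoS (indicator S) c else 𝔓.0#)
  elem : ∀ j → elemS ℓ j c ≗ ∑ Ss (λ S → if countTrue S ≡ᵇ j then monoS (indicator S) c else 𝔓.0#)
  elem j = 𝔓.trans (𝔓.reflexive (sumS-map (λ S → monoS (indicator S)) (filterᵇ (λ S → countTrue S ≡ᵇ j) Ss) c))
    (𝔓Σ.∑-filterᵇ (λ S → countTrue S ≡ᵇ j) Ss (λ S → monoS (indicator S) c))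
  ≡ᵇ-refl : ∀ n → (n ≡ᵇ n) ≡ true
  ≡ᵇ-refl zero    = refl
  ≡ᵇ-refl (suc n) = ≡ᵇ-refl n
  ≢⇒≡ᵇ : ∀ m n → m ≢ n → (m ≡ᵇ n) ≡ false
  ≢⇒≡ᵇ zero    zero    ne = contradiction refl ne
  ≢⇒≡ᵇ zero    (suc n) ne = refl
  ≢⇒≡ᵇ (suc m) zero    ne = refl
  ≢⇒≡ᵇ (suc m) (suc n) ne = ≢⇒≡ᵇ m n (ne ∘ cong suc)
  term-zero : ∀ S j → countTrue S ≢ j → term S j ≗ 𝔓.0#
  term-zero S j ne = 𝔓.trans (𝔓.*-congˡ {factorP j} (𝔓.reflexive (cong (if_then monoS (indicator S) c else 𝔓.0#) (≢⇒≡ᵇ (countTrue S) j ne)))) (𝔓.zeroʳ (factorP j))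
  collect : ∀ S n → countTrue S ≡ n → n ≤ ℓ → ∑ js (term S) ≗ monoS (indicator S) c 𝔓.* sumCoefficient n
  collect S zero    eq _ = 𝔓.trans (∑-applyUpTo-zero suc ℓ (term S) (λ i → term-zero S (suc i) (λ e → contradiction (trans (sym e) eq) λ ())))
    (𝔓.sym (𝔓.zeroʳ (monoS (indicator S) c)))
  collect S (suc n) eq n< = 𝔓.trans
    (∑-applyUpTo-single suc (term S) n< (λ i i≢ → term-zero S (suc i) (λ e → i≢ (ℕP.suc-injective (trans (sym e) eq)))))
    (𝔓.trans
      (𝔓.*-congˡ {factorP (suc n)} (𝔓.reflexive (cong (if_then monoS (indicator S) c else 𝔓.0#) (trans (cong (_≡ᵇ suc n) eq) (≡ᵇ-refl n)))))
      (𝔓.*-comm (factorP (suc n)) (monoS (indicator S) c)))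

linP-linear : ∀ i → linP i ≗ (𝔓.- 𝔓.1#) 𝔓.+ mono 1 (+ i)
linP-linear i zero          = refl
linP-linear i (suc zero)    = sym (ℤP.+-identityˡ (+ i))
linP-linear i (suc (suc k)) = refl

-- The innermost factor `-1 + 0 t` of `ε` supplies the sign; the further factors are those of
-- `factorP`.
ε-factorP : ∀ n → ε (suc n) ≗ 𝔓.- factorP (suc n)
ε-factorP zero = 𝔓.trans (𝔓.*-identityʳ ((𝔓.- 𝔓.1#) 𝔓.+ 0 · 𝕥)) (𝔓.+-identityʳ (𝔓.- 𝔓.1#))
ε-factorP (suc n) = begin
  ((𝔓.- 𝔓.1#) 𝔓.+ suc n · 𝕥) 𝔓.* ε (suc n)
    ≈⟨ 𝔓.*-cong {u = ε (suc n)} (𝔓.trans (𝔓.+-congˡ {𝔓.- 𝔓.1#} (·-𝕥 (suc n))) (𝔓.sym (linP-linear (suc n)))) (ε-factorP n) ⟩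
  linP (suc n) 𝔓.* (𝔓.- factorP (suc n))
    ≈⟨ 𝔓.*-comm (linP (suc n)) (𝔓.- factorP (suc n)) ⟩
  (𝔓.- factorP (suc n)) 𝔓.* linP (suc n)
    ≈⟨ 𝔓.sym (-‿distribˡ-* (factorP (suc n)) (linP (suc n))) ⟩
  𝔓.- factorP (suc (suc n)) ∎

denominator-squarefree : ∀ {ℓ} (c : Vec ℕ ℓ) → (oneS ℓ -S denomSum ℓ) c ≗ squarefree ε c
denominator-squarefree {ℓ} c = begin
  oneS ℓ c 𝔓.- denomSum ℓ c
    ≈⟨ 𝔓.+-cong (oneS-squarefree c) (𝔓.-‿cong (denomSum-squarefree c)) ⟩
  squarefree oneCoefficient c 𝔓.- squarefree sumCoefficient c
    ≈⟨ squarefree-minus oneCoefficient sumCoefficient c ⟩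
  squarefree (λ j → oneCoefficient j -P sumCoefficient j) c
    ≈⟨ squarefree-cong coefficients c ⟩
  squarefree ε c ∎
  where
  coefficients : ∀ j → oneCoefficient j -P sumCoefficient j ≗ ε j
  coefficients zero    = λ k → ℤP.+-identityʳ _
  coefficients (suc j) = 𝔓.trans (𝔓.+-identityˡ (𝔓.- factorP (suc j))) (𝔓.sym (ε-factorP j))

∑-upTo-suc : ∀ n (f : ℕ → Poly) → ∑ (upTo (suc n)) f ≗ ∑ (upTo n) f 𝔓.+ f n
∑-upTo-suc n f = 𝔓.trans (𝔓.reflexive (cong (λ xs → ∑ xs f) (sym (upTo-∷ʳ n))))
  (𝔓.trans (𝔓Σ.∑-++ (upTo n) (n ∷ []) f) (𝔓.+-congˡ {∑ (upTo n) f} (𝔓.+-identityʳ (f n))))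

-- The difference `a - b` has to be a 0/1 vector, so in each coordinate only the entry of `a` itself
-- and its predecessor survive: the Cauchy product collapses to a sum over sets of nonempty chains.
∑-below-squarefree : ∀ {ℓ} (a : Vec ℕ ℓ) (F : Vec ℕ ℓ → Poly) (K : ℕ → Poly) →
  ∑ (below a) (λ b → F b 𝔓.* squarefree K (zipWith N._∸_ a b)) ≗ expand a (λ j b → F b 𝔓.* K j)
∑-below-squarefree []      F K = 𝔓.+-identityʳ (F [] 𝔓.* K 0)
∑-below-squarefree (x ∷ a) F K = 𝔓.trans
  (𝔓.trans (𝔓Σ.∑-concatMap (λ y → map (y ∷_) (below a)) (upTo (suc x)) G)
    (𝔓Σ.∑-cong (upTo (suc x)) (λ y → 𝔓.reflexive (𝔓Σ.∑-map (y ∷_) (below a) G))))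
  (value x refl)
  where
  G : Vec ℕ _ → Poly
  G b = F b 𝔓.* squarefree K (zipWith N._∸_ (x ∷ a) b)
  slice : ℕ → Poly
  slice y = ∑ (below a) (λ v → F (y ∷ v) 𝔓.* squarefree K (x N.∸ y ∷ zipWith N._∸_ a v))
  slice-by : ∀ y {d} → x N.∸ y ≡ d → slice y ≗ ∑ (below a) (λ v → F (y ∷ v) 𝔓.* squarefree K (d ∷ zipWith N._∸_ a v))
  slice-by y e = 𝔓.reflexive (cong (λ d → ∑ (below a) (λ v → F (y ∷ v) 𝔓.* squarefree K (d ∷ zipWith N._∸_ a v))) e)
  slice-0 : ∀ y → x N.∸ y ≡ 0 → slice y ≗ expand a (λ j b → F (y ∷ b) 𝔓.* K j)
  slice-0 y e = 𝔓.trans (slice-by y e) (∑-below-squarefree a (F ∘ (y ∷_)) K)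
  slice-1 : ∀ y → x N.∸ y ≡ 1 → slice y ≗ expand a (λ j b → F (y ∷ b) 𝔓.* K (suc j))
  slice-1 y e = 𝔓.trans (slice-by y e) (∑-below-squarefree a (F ∘ (y ∷_)) (K ∘ suc))
  slice-2 : ∀ y d → x N.∸ y ≡ suc (suc d) → slice y ≗ 𝔓.0#
  slice-2 y d e = 𝔓.trans (slice-by y e) (𝔓Σ.∑-zero (below a) (λ {v} _ → 𝔓.zeroʳ (F (y ∷ v))))
  value : ∀ z → x ≡ z → ∑ (upTo (suc z)) slice ≗ expand (z ∷ a) (λ j b → F b 𝔓.* K j)
  value zero    refl = 𝔓.trans (𝔓.+-identityʳ (slice 0)) (slice-0 0 refl)
  value (suc z) refl = begin
    ∑ (upTo (suc (suc z))) slice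
      ≈⟨ 𝔓.trans (∑-upTo-suc (suc z) slice) (𝔓.+-congʳ {slice (suc z)} (∑-upTo-suc z slice)) ⟩
    (∑ (upTo z) slice 𝔓.+ slice z) 𝔓.+ slice (suc z)
      ≈⟨ 𝔓.+-congʳ {slice (suc z)} (𝔓.+-congʳ {slice z} (𝔓Σ.∑-zero (upTo z) (λ {y} y∈ → far y (∈-upTo⁻ y∈)))) ⟩
    (𝔓.0# 𝔓.+ slice z) 𝔓.+ slice (suc z)
      ≈⟨ 𝔓.+-cong (𝔓.trans (𝔓.+-identityˡ (slice z)) (slice-1 z (ℕP.m+n∸n≡m 1 z))) (slice-0 (suc z) (ℕP.n∸n≡0 (suc z))) ⟩
    expand (suc z ∷ a) (λ j b → F b 𝔓.* K j) ∎
    where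
    far : ∀ y → y < z → slice y ≗ 𝔓.0#
    far y y<z = go (x N.∸ y) refl (ℕP.m+n≤o⇒m≤o∸n 2 (s≤s y<z))
      where
      go : ∀ d → x N.∸ y ≡ d → 2 ≤ d → slice y ≗ 𝔓.0#
      go (suc (suc d)) e _ = slice-2 y d e
      go (suc zero) e (s≤s ())

Poin-partial : ∀ {ℓ} (dec : (a : Vec ℕ ℓ) (X : Mat (total a)) → Dec (Meets (chainLt a) X)) a →
  Poin (chainLt a) (dec a) ≗ partial dec a (elements a)
Poin-partial dec a = 𝔓.trans (Poin-relabel _≟E_ (element a) (element-injective a) (chainLt a) (dec a))
  (𝔓.reflexive (cong (partial dec a) (map-element a)))

-- The quotient is stated multiplied out: the denominator has constant term 1, hence is invertible,
-- and the identity determines the series.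
theorem1p4 : (ℓ : ℕ) → 1 ≤ ℓ →
    (dec : (a : Vec ℕ ℓ) (X : Mat (total a)) → Dec (Meets (chainLt a) X)) →
    (poinSeries ℓ dec *S (oneS ℓ -S denomSum ℓ)) ≈S oneS ℓ
theorem1p4 ℓ _ dec a = begin
  (poinSeries ℓ dec *S (oneS ℓ -S denomSum ℓ)) a
    ≈⟨ 𝔓.reflexive (sumP-map _ (below a)) ⟩
  ∑ (below a) (λ b → poinSeries ℓ dec b 𝔓.* (oneS ℓ -S denomSum ℓ) (zipWith N._∸_ a b))
    ≈⟨ 𝔓Σ.∑-cong (below a) (λ b → 𝔓.*-congˡ {poinSeries ℓ dec b} (denominator-squarefree (zipWith N._∸_ a b))) ⟩
  ∑ (below a) (λ b → poinSeries ℓ dec b 𝔓.* squarefree ε (zipWith N._∸_ a b))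
    ≈⟨ ∑-below-squarefree a (poinSeries ℓ dec) ε ⟩
  expand a (λ j b → poinSeries ℓ dec b 𝔓.* ε j)
    ≈⟨ expand-cong a (λ j b _ → 𝔓.*-comm (poinSeries ℓ dec b) (ε j)) ⟩
  expand a (λ j b → ε j 𝔓.* poinSeries ℓ dec b)
    ≈⟨ expand-cong a (λ j b _ → 𝔓.*-congˡ {ε j} (Poin-partial dec b)) ⟩
  expand a (λ j b → ε j 𝔓.* partial dec b (elements b))
    -- The indicator of `a` being the zero vector is `oneS ℓ a` by definition.
    ≈⟨ expand-partial dec a ⟩
  oneS ℓ a ∎
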